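{- Let $f\in\mathbb Z[X]$ and let $D$ be a fundamental discriminant. Suppose that $f(n)$ is prime for infinitely many integers $n\ge 0$, and that the integers $n\ge 0$ for which $f(n)$ is prime are asymptotically equidistributed over the residue classes $a \pmod{D}$ with $\gcd(f(a),D)=1$. Then the proportion $\tau_D^-(f)$ of primes of the form $p=f(n)$ ($n\ge0$) that are inert in the quadratic field of discriminant $D$ exists and is a rational number. Moreover, let $D_1$ be the largest odd divisor of $D$ and assume $D_1>1$. For $j=1,3,5,7$ put $$\alpha_j=\frac{\#\{s \bmod 8: f(s)\equiv j \pmod 8\}}{4\,\#\{s\bmod 2: f(s)\equiv 1\pmod 2\}}.$$ Then $$2\tau_D^-(f)=\begin{cases}1-a_{D_1}(f) & \text{if } D \text{ is odd};\\ 1+(\alpha_3+\alpha_7-\alpha_1-\alpha_5)a_{D_1}(f) & \text{if } D\equiv 4\pmod 8;\\ 1+(\alpha_3+\alpha_5-\alpha_1-\alpha_7)a_{D_1}(f) & \text{if } D\equiv 8\pmod{32};\\ 1+(\alpha_5+\alpha_7-\alpha_1-\alpha_3)a_{D_1}(f) & \text{if } D\equiv 24\pmod{32},\end{cases}$$ where $a_{D_1}(f)=\prod_{p\mid D_1}a_p(f)$ and, for an odd prime $p$, $$a_p(f)=\frac{\sum_{j=0}^{p-1}\left(\frac{f(j)}{p}\right)}{p-N_p(f)}.$$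
   Context: $\left(\frac{\cdot}{p}\right)$ is the Legendre symbol. $N_p(f)=\#\{n \bmod p: f(n)\equiv 0\pmod p\}$. The proportion $\tau_D^-(f)$ is the limit as $x\to\infty$ of the number of primes $p\le x$ of the form $f(n)$ with $n\ge 0$ that are inert in $\mathbb Q(\sqrt D)$, divided by the number of primes $p\le x$ of the form $f(n)$ with $n\ge0$. Equidistribution means that for each residue class $a\bmod D$ with $\gcd(f(a),D)=1$, the number of $n\le x$, $n\equiv a\pmod D$, with $f(n)$ prime is asymptotic to the total number of $n\le x$ with $f(n)$ prime divided by the number of such residue classes. -}

module Defs where

open import Data.Bool using (Bool; true; false; if_then_else_)
open import Data.Nat as ℕ using (ℕ; zero; suc)
open import Data.Nat.Primality using (Prime; prime?)
open import Data.Nat.Divisibility as ℕD using ()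
open import Data.Integer as ℤ using (ℤ; +_; -[1+_])
open import Data.Integer.DivMod using (_%ℕ_)
open import Data.Integer.Divisibility as ℤD using ()
open import Data.Integer.GCD as ℤG using ()
open import Data.Rational as ℚ using (ℚ; 0ℚ; 1ℚ)
open import Data.List using (List; []; _∷_; length; filter; upTo; map; foldr)
open import Data.List.Membership.Propositional using (_∈_)
open import Data.List.Relation.Unary.Unique.Propositional using (Unique)
open import Data.Product using (Σ; ∃; _×_; _,_)
open import Data.Sum using (_⊎_)
open import Function.Bundles using (_⇔_)
open import Relation.Nullary using (¬_; Dec; yes; no; does)
open import Relation.Nullary.Decidable using (_×-dec_)
open import Data.List.Relation.Unary.Any using (any?)
open import Relation.Nullary.Decidable using (⌊_⌋)
open import Relation.Binary.PropositionalEquality using (_≡_; _≢_)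

-- Integer polynomials: coefficient lists, lowest degree first.
-- [a₀ , a₁ , … , a_d] represents a₀ + a₁ X + … + a_d X^d.

Poly : Set
Poly = List ℤ

eval : Poly → ℤ → ℤ
eval []       x = + 0
eval (a ∷ as) x = a ℤ.+ x ℤ.* eval as x

_⟨_⟩ : Poly → ℕ → ℤ
f ⟨ n ⟩ = eval f (+ n)

IsPrimeℤ : ℤ → Set
IsPrimeℤ (+ p)    = Prime p
IsPrimeℤ -[1+ _ ] = ⊥' where open import Data.Empty renaming (⊥ to ⊥')

isPrimeℤ? : (z : ℤ) → Dec (IsPrimeℤ z)
isPrimeℤ? (+ p)    = prime? p
isPrimeℤ? -[1+ _ ] = no (λ ())

-- n mod M, with the convention n mod 0 = n (M = |D| ≠ 0 in our use)
_mod'_ : ℕ → ℕ → ℕ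
n mod' zero  = n
n mod' suc k = n ℕ.% suc k

HasCount : (ℕ → Set) → ℕ → Set
HasCount P k = Σ (List ℕ) λ l → Unique l × (∀ p → (p ∈ l) ⇔ P p) × length l ≡ k

ℕ→ℚ : ℕ → ℚ
ℕ→ℚ n = + n ℚ./ 1

ℤ→ℚ : ℤ → ℚ
ℤ→ℚ z = z ℚ./ 1

-- z / d, with the (never used under the hypotheses) convention z / 0 = 0.
_/ᵗ_ : ℤ → ℕ → ℚ
z /ᵗ zero  = 0ℚ
z /ᵗ suc d = z ℚ./ suc d

-- num(x) / den(x) → τ  as x → ∞  (ℚ-valued epsilon-X formulation;
-- the strict inequality forces den(x) > 0 for all large x).
RatioTendsTo : (ℕ → ℚ) → (ℕ → ℚ) → ℚ → Set
RatioTendsTo num den τ =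
  ∀ (ε : ℚ) → 0ℚ ℚ.< ε → ∃ λ X → ∀ x → X ℕ.≤ x →
    ℚ.∣ num x ℚ.- τ ℚ.* den x ∣ ℚ.< ε ℚ.* den x

SquarefreeℤD : ℤ → Set
SquarefreeℤD m = ∀ p → Prime p → ¬ ((+ (p ℕ.* p)) ℤD.∣ m)

FundamentalDiscriminant : ℤ → Set
FundamentalDiscriminant D =
  D ≢ + 1 ×
  ((D %ℕ 4 ≡ 1 × SquarefreeℤD D)
   ⊎ (∃ λ m → D ≡ + 4 ℤ.* m × (m %ℕ 4 ≡ 2 ⊎ m %ℕ 4 ≡ 3) × SquarefreeℤD m))

-- A prime p is inert in Q(√D) (D a fundamental discriminant):
-- p ∤ D and D is not a square modulo 4p
-- (i.e. the Kronecker symbol (D/p) equals -1).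
Inert : ℤ → ℕ → Set
Inert D p = ¬ (+ p ℤD.∣ D) × ¬ (∃ λ (x : ℤ) → + (4 ℕ.* p) ℤD.∣ (x ℤ.* x ℤ.- D))

PrimeOfForm : Poly → ℕ → Set
PrimeOfForm f p = Prime p × ∃ λ (n : ℕ) → f ⟨ n ⟩ ≡ + p

InfinitelyManyPrimeValues : Poly → Set
InfinitelyManyPrimeValues f = ∀ m → ∃ λ n → m ℕ.≤ n × IsPrimeℤ (f ⟨ n ⟩)

primeValueCount : Poly → ℕ → ℕ
primeValueCount f x = length (filter (λ n → isPrimeℤ? (f ⟨ n ⟩)) (upTo (suc x)))

primeValueCountIn : Poly → ℕ → ℕ → ℕ → ℕ
primeValueCountIn f M a x =
  length (filter (λ n → (n mod' M) ℕ.≟ a ×-dec isPrimeℤ? (f ⟨ n ⟩)) (upTo (suc x)))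

goodClass : Poly → ℤ → ℕ → Set
goodClass f D a = ℤG.gcd (f ⟨ a ⟩) D ≡ + 1

goodClass? : (f : Poly) (D : ℤ) (a : ℕ) → Dec (goodClass f D a)
goodClass? f D a = ℤG.gcd (f ⟨ a ⟩) D ℤ.≟ + 1

numGoodClasses : Poly → ℤ → ℕ
numGoodClasses f D = length (filter (goodClass? f D) (upTo ℤ.∣ D ∣))

-- Equidistribution: for each residue class a mod D with gcd(f(a),D)=1,
--   #{n ≤ x, n ≡ a (mod D), f(n) prime} ~ #{n ≤ x, f(n) prime} / k,
-- k = number of such classes; i.e. k·N_a(x) / N(x) → 1.
Equidistributed : Poly → ℤ → Set
Equidistributed f D =
  ∀ a → a ℕ.< ℤ.∣ D ∣ → goodClass f D a →
    RatioTendsTo (λ x → ℕ→ℚ (numGoodClasses f D ℕ.* primeValueCountIn f ℤ.∣ D ∣ a x))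
                 (λ x → ℕ→ℚ (primeValueCount f x))
                 1ℚ

legendre : ℤ → ℕ → ℤ
legendre a zero    = + 0
legendre a (suc k) with a %ℕ suc k
... | zero  = + 0
... | r@(suc _) with any? (λ y → ((y ℕ.* y) ℕ.% suc k) ℕ.≟ r) (upTo (suc k))
...   | yes _ = + 1
...   | no  _ = -[1+ 0 ]

Nₚ : Poly → ℕ → ℕ
Nₚ f p = length (filter (λ n → p ℕD.∣? ℤ.∣ f ⟨ n ⟩ ∣) (upTo p))

sumℤ : List ℤ → ℤ
sumℤ = foldr ℤ._+_ (+ 0)

productℚ : List ℚ → ℚ
productℚ = foldr ℚ._*_ 1ℚ

aₚ : Poly → ℕ → ℚ
aₚ f p = sumℤ (map (λ j → legendre (f ⟨ j ⟩) p) (upTo p)) /ᵗ (p ℕ.∸ Nₚ f p)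

primeDivisors : ℕ → List ℕ
primeDivisors m = filter (λ p → prime? p ×-dec p ℕD.∣? m) (upTo (suc m))

a-prod : Poly → ℕ → ℚ
a-prod f D₁ = productℚ (map (aₚ f) (primeDivisors D₁))

countRes : Poly → (m : ℕ) → .{{ℕ.NonZero m}} → ℕ → ℕ
countRes f m j = length (filter (λ s → (f ⟨ s ⟩ %ℕ m) ℕ.≟ j) (upTo m))

α : Poly → ℕ → ℚ
α f j = (+ (countRes f 8 j)) /ᵗ (4 ℕ.* countRes f 2 1)

LargestOddDivisor : ℕ → ℕ → Set
LargestOddDivisor d m =
  d ℕ.% 2 ≡ 1 × d ℕD.∣ m × (∀ e → e ℕ.% 2 ≡ 1 → e ℕD.∣ m → e ℕ.≤ d)

twoTauFormula : Poly → ℤ → ℕ → ℚ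
twoTauFormula f D D₁ =
  if ⌊ D %ℕ 2 ℕ.≟ 1 ⌋ then 1ℚ ℚ.- a-prod f D₁
  else if ⌊ D %ℕ 8 ℕ.≟ 4 ⌋ then 1ℚ ℚ.+ (α f 3 ℚ.+ α f 7 ℚ.- α f 1 ℚ.- α f 5) ℚ.* a-prod f D₁
  else if ⌊ D %ℕ 32 ℕ.≟ 8 ⌋ then 1ℚ ℚ.+ (α f 3 ℚ.+ α f 5 ℚ.- α f 1 ℚ.- α f 7) ℚ.* a-prod f D₁
  else if ⌊ D %ℕ 32 ℕ.≟ 24 ⌋ then 1ℚ ℚ.+ (α f 5 ℚ.+ α f 7 ℚ.- α f 1 ℚ.- α f 3) ℚ.* a-prod f D₁
  else 0ℚ   -- does not occur for fundamental discriminants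

{-# OPTIONS --safe #-}
module Submission where

-- A prime p ∤ D is inert in ℚ(√D) iff χ(p) = −1 for the quadratic character χ of conductor |D|;
-- by quadratic reciprocity χ(z) = ε(z) ∏ (z/q) over the odd primes q ∣ D, where ε is a character
-- mod 1, 4 or 8. Reciprocity is proved with Gauss's lemma and Eisenstein's lattice points, and
-- Euler's criterion from the bound on the number of roots of X^((p−1)/2) − 1.
--
-- The class of n mod D thus decides whether a prime f(n) ∤ D is inert. If f is not constant it is
-- eventually strictly increasing, so that counting primes p = f(n) ≤ x amounts, up to a bounded
-- error, to counting arguments n ≤ Y with f(n) prime, and equidistribution gives τ = b / k with
-- k classes a such that gcd(f(a), D) = 1 and b of them with χ(f(a)) = −1.
--
-- As χ² is the indicator of coprimality to D, 2b = k − ∑ χ(f(a)) and k = ∑ χ(f(a))², and by the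
-- Chinese remainder theorem both sums factor over the prime powers dividing D.

open import Defs
open import Data.Nat as ℕ using (ℕ; zero; suc)
open import Data.Integer as ℤ using (ℤ; +_; -[1+_])
open import Data.Integer.DivMod using (_%ℕ_; _/ℕ_; a≡a%ℕn+[a/ℕn]*n; n%ℕd<d)
open import Data.Rational as ℚ using (ℚ; 0ℚ; 1ℚ)
open import Data.Product using (Σ; ∃; _×_; _,_; proj₁; proj₂)
open import Data.List.Membership.Propositional using (_∈_; _∉_; find; lose)
open import Relation.Binary.PropositionalEquality using (_≡_; _≢_; refl; sym; trans; cong; cong₂; subst; subst₂; module ≡-Reasoning)
open import Algebra.Structures using (IsCommutativeMonoid)
open import Data.Empty using (⊥; ⊥-elim)
open import Data.Unit using (⊤; tt)
open import Data.List using (List; []; _∷_; _++_; length; replicate; filter; upTo; map; foldr)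
open import Data.List.Membership.Propositional.Properties using (∈-∃++; ∈-++⁻; ∈-++⁺ˡ; ∈-++⁺ʳ; ∈-map⁺; ∈-map⁻; ∈-upTo⁺; ∈-upTo⁻; ∈-filter⁺; ∈-filter⁻; ∈-length)
open import Data.List.Properties using (map-∘; length-map; length-upTo; upTo-∷ʳ; length-replicate; length-++-sucʳ; length-filter; length-++; filter-all; filter-none)
open import Data.List.Relation.Binary.Permutation.Propositional using (_↭_; prep; ↭-refl; ↭-sym; ↭-trans; ↭⇒↭ₛ)
open import Data.List.Relation.Binary.Permutation.Propositional.Properties using (map⁺; shift)
open import Data.List.Relation.Binary.Permutation.Setoid.Properties using (foldr-commMonoid)
open import Data.List.Relation.Unary.All as All using (All; []; _∷_)
open import Data.List.Relation.Unary.All.Properties as AllP using ()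
open import Data.List.Relation.Unary.Any using (here; there; any?)
open import Data.List.Relation.Unary.AllPairs using (AllPairs; []; _∷_)
open import Data.List.Relation.Unary.Unique.Propositional using (Unique)
open import Data.List.Relation.Unary.Unique.Propositional.Properties as UniqueP using ()
open import Data.Nat.Properties as ℕP using ()
open import Data.Nat.DivMod as ℕDM using ()
open import Data.Nat.Divisibility as ℕD using ()
open import Data.Nat.Primality as ℕPr using (Prime; prime?; euclidsLemma)
open import Data.Integer.Properties as ℤP using ()
open import Data.Integer.Divisibility as ℤD using ()
open import Data.Integer.Divisibility.Signed as ℤS using ()
open import Data.Integer.Tactic.RingSolver using (solve-∀)
open import Data.Nat.Tactic.RingSolver using () renaming (solve-∀ to ℕsolve-∀)
open import Data.Nat.Coprimality as ℕC using (Coprime)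
open import Data.Nat.GCD as ℕG using ()
open import Data.Rational.Properties as ℚP using ()
open import Data.Sum using (_⊎_; inj₁; inj₂; [_,_]′)
open import Function using (_∘_; case_of_)
open import Function.Bundles using (Equivalence; _⇔_; mk⇔)
open import Relation.Binary.Definitions using (tri<; tri≈; tri>)
open import Relation.Nullary using (¬_; Dec; yes; no; contradiction)
open import Relation.Nullary.Decidable using (_×-dec_; _⊎-dec_; _→-dec_; ¬?; from-yes)
open import Relation.Unary using (Decidable)
open import Data.Nat.ListAction using (product)
open import Data.Nat.ListAction.Properties using (product-↭; ∈⇒∣product)
open import Data.Nat.Primality.Factorisation using (factorise; factorisationHasAllPrimeFactors)

-- Inertness of p is a condition on D modulo 4p, whereas the count needs a condition on p modulo D.
-- Reciprocity in the form (q*/p) = (p/q), with q* = ±q ≡ 1 mod 4, makes this exchange without sign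
-- cases, because D is a product of such q* and one of 1, -4, 8, -8. Parity arguments are carried
-- out with signs ±1 in ℤ: sums modulo 2 become products, which share their lemmas with the sums
-- over residue classes. Three things disturb the count: one prime can come from several arguments,
-- χ decides inertness only of primes not dividing D, and primes are ordered by size while
-- equidistribution orders arguments. All are confined to n < N, for a bound N beyond which f
-- increases strictly and exceeds |D|, and together they change a count by at most N. A constant f
-- has no such N and is treated by itself, with an exact ratio instead of an estimate.

-- Duplicate-free lists, finite sums and products

unique-⊆-length : {A : Set} {xs ys : List A} → Unique xs → (∀ {x} → x ∈ xs → x ∈ ys) →
  length xs ℕ.≤ length ys
unique-⊆-length {xs = []}     _        _ = ℕ.z≤n
unique-⊆-length {xs = x ∷ xs} (x∉ ∷ u) s with ∈-∃++ (s (here refl))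
... | as , bs , refl = subst (suc (length xs) ℕ.≤_) (sym (length-++-sucʳ as x bs))
    (ℕ.s≤s (unique-⊆-length u ⊆'))
  where
  ⊆' : ∀ {y} → y ∈ xs → y ∈ as ++ bs
  ⊆' y∈ with ∈-++⁻ as (s (there y∈))
  ... | inj₁ p           = ∈-++⁺ˡ p
  ... | inj₂ (here refl) = contradiction refl (All.lookup x∉ y∈)
  ... | inj₂ (there p)   = ∈-++⁺ʳ as p

-- Pigeonhole: every entry of `xs` uses up an entry of `ys` of its own, and the length bound leaves
-- none over.
unique-⊆-↭ : {A : Set} {xs ys : List A} → Unique xs → (∀ {x} → x ∈ xs → x ∈ ys) →
  length ys ℕ.≤ length xs → xs ↭ ys
unique-⊆-↭ {xs = []} {[]}    _        _ _ = ↭-refl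
unique-⊆-↭ {xs = x ∷ xs} (x∉ ∷ u) s len with ∈-∃++ (s (here refl))
... | as , bs , refl = ↭-trans (prep x (unique-⊆-↭ u ⊆'
        (ℕ.s≤s⁻¹ (subst (ℕ._≤ suc (length xs)) (length-++-sucʳ as x bs) len))))
      (↭-sym (shift x as bs))
  where
  ⊆' : ∀ {y} → y ∈ xs → y ∈ as ++ bs
  ⊆' y∈ with ∈-++⁻ as (s (there y∈))
  ... | inj₁ p           = ∈-++⁺ˡ p
  ... | inj₂ (here refl) = contradiction refl (All.lookup x∉ y∈)
  ... | inj₂ (there p)   = ∈-++⁺ʳ as p

-- `R` is kept general because roots modulo p must be pairwise incongruent, not merely unequal.
allPairs-map : {A B : Set} {R : B → B → Set} (σ : A → B) {xs : List A} →
  (∀ {x y} → x ∈ xs → y ∈ xs → x ≢ y → R (σ x) (σ y)) → Unique xs → AllPairs R (map σ xs)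
allPairs-map σ {[]}     r _        = []
allPairs-map σ {x ∷ xs} r (x∉ ∷ u) =
  AllP.map⁺ (All.tabulate (λ y∈ → r (here refl) (there y∈) (All.lookup x∉ y∈)))
  ∷ allPairs-map σ (λ p q → r (there p) (there q)) u

unique-map : {A B : Set} (σ : A → B) {xs : List A} →
  (∀ {x y} → x ∈ xs → y ∈ xs → σ x ≡ σ y → x ≡ y) → Unique xs → Unique (map σ xs)
unique-map σ inj = allPairs-map σ (λ p q x≢y → x≢y ∘ inj p q)

-- An injection of a finite set into itself is onto, so no inverse map has to be exhibited. Gauss's
-- lemma and Chinese remaindering both rest on this.
map-perm-upTo : ∀ n (σ : ℕ → ℕ) → (∀ {i} → i ℕ.< n → σ i ℕ.< n) →
  (∀ {i j} → i ℕ.< n → j ℕ.< n → σ i ≡ σ j → i ≡ j) → map σ (upTo n) ↭ upTo n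
map-perm-upTo n σ bd inj = unique-⊆-↭
  (unique-map σ (λ p q → inj (∈-upTo⁻ p) (∈-upTo⁻ q)) (UniqueP.upTo⁺ n))
  (λ y∈ → case ∈-map⁻ σ y∈ of λ { (i , i∈ , refl) → ∈-upTo⁺ (bd (∈-upTo⁻ i∈)) })
  (ℕP.≤-reflexive (sym (length-map σ (upTo n))))

module BigOp {A : Set} {_∙_ : A → A → A} {ε : A} (M : IsCommutativeMonoid _≡_ _∙_ ε) where

  private module M = IsCommutativeMonoid M

  -- This shape makes the integer sum agree definitionally with `sumℤ (map _ _)`, the numerator of
  -- `aₚ`.
  big : {B : Set} → (B → A) → List B → A
  big g l = foldr _∙_ ε (map g l)

  big-cong : {B : Set} {g h : B → A} (l : List B) → (∀ {x} → x ∈ l → g x ≡ h x) → big g l ≡ big h l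
  big-cong []      e = refl
  big-cong (x ∷ l) e = cong₂ _∙_ (e (here refl)) (big-cong l (e ∘ there))

  big-∙ : {B : Set} (g h : B → A) (l : List B) → big (λ x → g x ∙ h x) l ≡ big g l ∙ big h l
  big-∙ g h []      = sym (M.identityˡ ε)
  big-∙ g h (x ∷ l) = begin
    (g x ∙ h x) ∙ big (λ y → g y ∙ h y) l ≡⟨ cong ((g x ∙ h x) ∙_) (big-∙ g h l) ⟩
    (g x ∙ h x) ∙ (big g l ∙ big h l)     ≡⟨ M.assoc _ _ _ ⟩
    g x ∙ (h x ∙ (big g l ∙ big h l))     ≡⟨ cong (g x ∙_) (sym (M.assoc _ _ _)) ⟩
    g x ∙ ((h x ∙ big g l) ∙ big h l)     ≡⟨ cong (λ z → g x ∙ (z ∙ big h l)) (M.comm _ _) ⟩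
    g x ∙ ((big g l ∙ h x) ∙ big h l)     ≡⟨ cong (g x ∙_) (M.assoc _ _ _) ⟩
    g x ∙ (big g l ∙ (h x ∙ big h l))     ≡⟨ sym (M.assoc _ _ _) ⟩
    (g x ∙ big g l) ∙ (h x ∙ big h l)     ∎
    where open ≡-Reasoning

  big-ε : {B : Set} (l : List B) → big (λ _ → ε) l ≡ ε
  big-ε []      = refl
  big-ε (x ∷ l) = trans (M.identityˡ _) (big-ε l)

  big-swap : {B C : Set} (g : B → C → A) (l : List B) (l' : List C) →
    big (λ x → big (g x) l') l ≡ big (λ y → big (λ x → g x y) l) l'
  big-swap g []      l' = sym (big-ε l')
  big-swap g (x ∷ l) l' = trans (cong (big (g x) l' ∙_) (big-swap g l l'))
    (sym (big-∙ (g x) (λ y → big (λ x → g x y) l) l'))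

  big-↭ : {B : Set} (g : B → A) {l l' : List B} → l ↭ l' → big g l ≡ big g l'
  big-↭ g p = foldr-commMonoid M.setoid M (↭⇒↭ₛ (map⁺ g p))

  big-map : {B C : Set} (g : C → A) (σ : B → C) (l : List B) → big g (map σ l) ≡ big (g ∘ σ) l
  big-map g σ l = cong (foldr _∙_ ε) (sym (map-∘ l))

  big-++ : {B : Set} (g : B → A) (l l' : List B) → big g (l ++ l') ≡ big g l ∙ big g l'
  big-++ g []      l' = sym (M.identityˡ _)
  big-++ g (x ∷ l) l' = trans (cong (g x ∙_) (big-++ g l l')) (sym (M.assoc _ _ _))

  big-upTo-suc : (g : ℕ → A) (n : ℕ) → big g (upTo (suc n)) ≡ big g (upTo n) ∙ g n
  big-upTo-suc g n = begin
    big g (upTo (suc n))        ≡⟨ cong (big g) (sym (upTo-∷ʳ n)) ⟩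
    big g (upTo n ++ n ∷ [])    ≡⟨ big-++ g (upTo n) (n ∷ []) ⟩
    big g (upTo n) ∙ (g n ∙ ε)  ≡⟨ cong (big g (upTo n) ∙_) (M.identityʳ _) ⟩
    big g (upTo n) ∙ g n        ∎
    where open ≡-Reasoning

  big-upTo-+ : (g : ℕ → A) (m n : ℕ) →
    big g (upTo (n ℕ.+ m)) ≡ big g (upTo m) ∙ big (λ i → g (i ℕ.+ m)) (upTo n)
  big-upTo-+ g m zero    = sym (M.identityʳ _)
  big-upTo-+ g m (suc n) = begin
    big g (upTo (suc (n ℕ.+ m)))                                       ≡⟨ big-upTo-suc g (n ℕ.+ m) ⟩
    big g (upTo (n ℕ.+ m)) ∙ g (n ℕ.+ m)                               ≡⟨ cong (_∙ g (n ℕ.+ m)) (big-upTo-+ g m n) ⟩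
    (big g (upTo m) ∙ big (λ i → g (i ℕ.+ m)) (upTo n)) ∙ g (n ℕ.+ m)  ≡⟨ M.assoc _ _ _ ⟩
    big g (upTo m) ∙ (big (λ i → g (i ℕ.+ m)) (upTo n) ∙ g (n ℕ.+ m))  ≡⟨ cong (big g (upTo m) ∙_) (sym (big-upTo-suc _ n)) ⟩
    big g (upTo m) ∙ big (λ i → g (i ℕ.+ m)) (upTo (suc n))            ∎
    where open ≡-Reasoning

  -- Division with remainder: an index below n·m is a + b·m with a < m and b < n in exactly one way.
  big-upTo-* : (g : ℕ → A) (m n : ℕ) →
    big g (upTo (n ℕ.* m)) ≡ big (λ b → big (λ a → g (a ℕ.+ b ℕ.* m)) (upTo m)) (upTo n)
  big-upTo-* g m zero    = refl
  big-upTo-* g m (suc n) = begin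
    big g (upTo (m ℕ.+ n ℕ.* m))                                              ≡⟨ big-upTo-+ g (n ℕ.* m) m ⟩
    big g (upTo (n ℕ.* m)) ∙ big (λ a → g (a ℕ.+ n ℕ.* m)) (upTo m)           ≡⟨ cong (_∙ big (λ a → g (a ℕ.+ n ℕ.* m)) (upTo m)) (big-upTo-* g m n) ⟩
    big (λ b → big (λ a → g (a ℕ.+ b ℕ.* m)) (upTo m)) (upTo n) ∙ big (λ a → g (a ℕ.+ n ℕ.* m)) (upTo m)
                                                                              ≡⟨ sym (big-upTo-suc _ n) ⟩
    big (λ b → big (λ a → g (a ℕ.+ b ℕ.* m)) (upTo m)) (upTo (suc n))         ∎
    where open ≡-Reasoning

  big-perm : (g : ℕ → A) (n : ℕ) (σ : ℕ → ℕ) → (∀ {i} → i ℕ.< n → σ i ℕ.< n) →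
    (∀ {i j} → i ℕ.< n → j ℕ.< n → σ i ≡ σ j → i ≡ j) → big (g ∘ σ) (upTo n) ≡ big g (upTo n)
  big-perm g n σ bd inj = trans (sym (big-map g σ (upTo n))) (big-↭ g (map-perm-upTo n σ bd inj))

open BigOp ℤP.+-0-isCommutativeMonoid public
  using ()
  renaming (big to ∑; big-cong to ∑-cong; big-∙ to ∑-+; big-ε to ∑-0; big-swap to ∑-swap;
            big-upTo-* to ∑-upTo-*; big-perm to ∑-perm)

open BigOp ℤP.*-1-isCommutativeMonoid public
  using ()
  renaming (big to ∏; big-cong to ∏-cong; big-∙ to ∏-*; big-ε to ∏-1; big-swap to ∏-swap;
            big-upTo-suc to ∏-upTo-suc; big-perm to ∏-perm)

∑-*ˡ : {B : Set} (c : ℤ) (g : B → ℤ) (l : List B) → ∑ (λ x → c ℤ.* g x) l ≡ c ℤ.* ∑ g l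
∑-*ˡ c g []      = sym (ℤP.*-zeroʳ c)
∑-*ˡ c g (x ∷ l) = trans (cong (λ z → c ℤ.* g x ℤ.+ z) (∑-*ˡ c g l)) (sym (ℤP.*-distribˡ-+ c (g x) (∑ g l)))

∑-const : {B : Set} (c : ℤ) (l : List B) → ∑ (λ _ → c) l ≡ + length l ℤ.* c
∑-const c []      = refl
∑-const c (x ∷ l) = trans (cong (ℤ._+_ c) (∑-const c l)) (sym (ℤP.suc-* (+ length l) c))

𝟙 : {P : Set} → Dec P → ℤ
𝟙 (yes _) = + 1
𝟙 (no _)  = + 0

𝟙-⇔ : {P Q : Set} (p? : Dec P) (q? : Dec Q) → (P → Q) → (Q → P) → 𝟙 p? ≡ 𝟙 q?
𝟙-⇔ (yes p) (yes q) f g = refl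
𝟙-⇔ (yes p) (no ¬q) f g = contradiction (f p) ¬q
𝟙-⇔ (no ¬p) (yes q) f g = contradiction (g q) ¬p
𝟙-⇔ (no ¬p) (no ¬q) f g = refl

-- Turns cardinalities into sums, which can then be interchanged and factored.
length-filter-∑ : {B : Set} {P : B → Set} (P? : Decidable P) (l : List B) →
  + length (filter P? l) ≡ ∑ (λ x → 𝟙 (P? x)) l
length-filter-∑ P? []      = refl
length-filter-∑ P? (x ∷ l) with P? x
... | yes _ = cong (ℤ._+_ (+ 1)) (length-filter-∑ P? l)
... | no _  = trans (length-filter-∑ P? l) (sym (ℤP.+-identityˡ _))

-- Congruences, Legendre symbols and roots of polynomials modulo a prime

infix 4 _≋_[_]

-- With an explicit quotient, compatibility with the ring operations is a ring identity. A record
-- also keeps `a`, `b` and `m` visible to unification, which divisibility of an absolute value would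
-- not.
record _≋_[_] (a b : ℤ) (m : ℕ) : Set where
  constructor mk≋
  field
    quot : ℤ
    eq   : a ≡ b ℤ.+ quot ℤ.* + m

module _ where
  open import Data.Integer using (_+_; _*_; _-_; -_; _^_)

  ≋-reflexive : ∀ {a b m} → a ≡ b → a ≋ b [ m ]
  ≋-reflexive {a} refl = mk≋ (+ 0) (sym (ℤP.+-identityʳ a))

  ≋-refl : ∀ {a m} → a ≋ a [ m ]
  ≋-refl = ≋-reflexive refl

  ≋-sym : ∀ {a b m} → a ≋ b [ m ] → b ≋ a [ m ]
  ≋-sym {b = b} {m} (mk≋ k refl) = mk≋ (- k) (lem b k (+ m))
    where
    lem : ∀ b k m → b ≡ b + k * m + - k * m
    lem = solve-∀

  ≋-trans : ∀ {a b c m} → a ≋ b [ m ] → b ≋ c [ m ] → a ≋ c [ m ]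
  ≋-trans {c = c} {m} (mk≋ k refl) (mk≋ l refl) = mk≋ (l + k) (lem c k l (+ m))
    where
    lem : ∀ c k l m → c + l * m + k * m ≡ c + (l + k) * m
    lem = solve-∀

  ≋-+ : ∀ {a b c d m} → a ≋ b [ m ] → c ≋ d [ m ] → a + c ≋ b + d [ m ]
  ≋-+ {b = b} {d = d} {m} (mk≋ k refl) (mk≋ l refl) = mk≋ (k + l) (lem b d k l (+ m))
    where
    lem : ∀ b d k l m → b + k * m + (d + l * m) ≡ b + d + (k + l) * m
    lem = solve-∀

  ≋-* : ∀ {a b c d m} → a ≋ b [ m ] → c ≋ d [ m ] → a * c ≋ b * d [ m ]
  ≋-* {b = b} {d = d} {m} (mk≋ k refl) (mk≋ l refl) = mk≋ (b * l + k * d + k * l * + m) (lem b d k l (+ m))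
    where
    lem : ∀ b d k l m → (b + k * m) * (d + l * m) ≡ b * d + (b * l + k * d + k * l * m) * m
    lem = solve-∀

  ≋-neg : ∀ {a b m} → a ≋ b [ m ] → - a ≋ - b [ m ]
  ≋-neg {b = b} {m} (mk≋ k refl) = mk≋ (- k) (lem b k (+ m))
    where
    lem : ∀ b k m → - (b + k * m) ≡ - b + - k * m
    lem = solve-∀

  ≋-^ : ∀ {a b m} n → a ≋ b [ m ] → a ^ n ≋ b ^ n [ m ]
  ≋-^ zero    e = ≋-refl
  ≋-^ (suc n) e = ≋-* e (≋-^ n e)

  ≋-∏ : ∀ {B : Set} {g h : B → ℤ} {m} (l : List B) → (∀ {x} → x ∈ l → g x ≋ h x [ m ]) →
    ∏ g l ≋ ∏ h l [ m ]
  ≋-∏ []      e = ≋-refl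
  ≋-∏ (x ∷ l) e = ≋-* (e (here refl)) (≋-∏ l (e ∘ there))

  ≋-eval : ∀ (f : Poly) {a b m} → a ≋ b [ m ] → eval f a ≋ eval f b [ m ]
  ≋-eval []      e = ≋-refl
  ≋-eval (c ∷ f) e = ≋-+ (≋-refl {c}) (≋-* e (≋-eval f e))

  ≋-∣ : ∀ {a b m n} → n ℕD.∣ m → a ≋ b [ m ] → a ≋ b [ n ]
  ≋-∣ {b = b} {n = n} (ℕD.divides q refl) (mk≋ k refl) = mk≋ (k * + q)
    (cong (_+_ b) (trans (cong (k *_) (ℤP.pos-* q n)) (sym (ℤP.*-assoc k (+ q) (+ n)))))

  ≋⇒∣ : ∀ {a b m} → a ≋ b [ m ] → + m ℤD.∣ (a - b)
  ≋⇒∣ {b = b} {m} (mk≋ k refl) = ℤS.∣⇒∣ᵤ (ℤS.divides k (lem b (k * + m)))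
    where
    lem : ∀ b c → b + c - b ≡ c
    lem = solve-∀

  ∣⇒≋ : ∀ {a b m} → + m ℤD.∣ (a - b) → a ≋ b [ m ]
  ∣⇒≋ {a} {b} {m} d with ℤS.∣ᵤ⇒∣ {+ m} {a - b} d
  ... | ℤS.divides q e = mk≋ q (trans (lem a b) (cong (_+_ b) e))
    where
    lem : ∀ a b → a ≡ b + (a - b)
    lem = solve-∀

  ≋0⇒∣ : ∀ {a m} → a ≋ + 0 [ m ] → m ℕD.∣ ℤ.∣ a ∣
  ≋0⇒∣ {a} e = subst (λ z → _ ℕD.∣ ℤ.∣ z ∣) (ℤP.+-identityʳ a) (≋⇒∣ e)

  ∣⇒≋0 : ∀ {a m} → m ℕD.∣ ℤ.∣ a ∣ → a ≋ + 0 [ m ]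
  ∣⇒≋0 {a} d = ∣⇒≋ (subst (λ z → _ ℕD.∣ ℤ.∣ z ∣) (sym (ℤP.+-identityʳ a)) d)

  -- The only multiple of m smaller than m in absolute value is 0. This is how congruences are
  -- turned back into equalities.
  ≋-small : ∀ {a b m} → a ≋ b [ m ] → ℤ.∣ a - b ∣ ℕ.< m → a ≡ b
  ≋-small {a} {b} e lt with ℤ.∣ a - b ∣ in eq | ≋⇒∣ e
  ... | zero  | _ = ℤP.i-j≡0⇒i≡j a b (ℤP.∣i∣≡0⇒i≡0 eq)
  ... | suc n | d = contradiction (ℕD.∣⇒≤ d) (ℕP.<⇒≱ lt)

  ≋-+-cancelˡ : ∀ {a b m} c → c + a ≋ c + b [ m ] → a ≋ b [ m ]
  ≋-+-cancelˡ {a} {b} {m} c (mk≋ k e) = mk≋ k (begin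
    a                           ≡⟨ lem c a ⟩
    c + a - c                   ≡⟨ cong (_- c) e ⟩
    c + b + k * + m - c         ≡⟨ lem' c b (k * + m) ⟩
    b + k * + m                 ∎)
    where
    open ≡-Reasoning
    lem : ∀ c a → a ≡ c + a - c
    lem = solve-∀
    lem' : ∀ c b d → c + b + d - c ≡ b + d
    lem' = solve-∀

≋-small-ℕ : ∀ {i j m} → + i ≋ + j [ m ] → i ℕ.< m → j ℕ.< m → i ≡ j
≋-small-ℕ {i} {j} e i< j< = ℤP.+-injective (≋-small e
  (subst (ℕ._< _) (cong ℤ.∣_∣ (sym (ℤP.m-n≡m⊖n i j)))
    (ℕP.≤-<-trans (ℤP.∣m⊝n∣≤m⊔n i j) (ℕP.⊔-pres-<m i< j<))))

%ℕ-≋ : ∀ a m .{{_ : ℕ.NonZero m}} → + (a %ℕ m) ≋ a [ m ]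
%ℕ-≋ a m = ≋-sym (mk≋ (a /ℕ m) (a≡a%ℕn+[a/ℕn]*n a m))

≋⇒%ℕ : ∀ {a b} m .{{_ : ℕ.NonZero m}} → a ≋ b [ m ] → a %ℕ m ≡ b %ℕ m
≋⇒%ℕ {a} {b} m e = ≋-small-ℕ (≋-trans (%ℕ-≋ a m) (≋-trans e (≋-sym (%ℕ-≋ b m)))) (n%ℕd<d a m) (n%ℕd<d b m)

%ℕ⇒≋ : ∀ {a b} m .{{_ : ℕ.NonZero m}} → a %ℕ m ≡ b %ℕ m → a ≋ b [ m ]
%ℕ⇒≋ {a} {b} m e = ≋-trans (≋-sym (%ℕ-≋ a m)) (≋-trans (≋-reflexive (cong +_ e)) (%ℕ-≋ b m))

%ℕ0⇒∣ : ∀ a m .{{_ : ℕ.NonZero m}} → a %ℕ m ≡ 0 → m ℕD.∣ ℤ.∣ a ∣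
%ℕ0⇒∣ a m e = ≋0⇒∣ (≋-trans (≋-sym (%ℕ-≋ a m)) (≋-reflexive (cong +_ e)))

∣⇒%ℕ0 : ∀ a m .{{_ : ℕ.NonZero m}} → m ℕD.∣ ℤ.∣ a ∣ → a %ℕ m ≡ 0
∣⇒%ℕ0 a m d = ≋-small-ℕ (≋-trans (%ℕ-≋ a m) (∣⇒≋0 d)) (n%ℕd<d a m) (ℕ.>-nonZero⁻¹ m)

euclid-≋ : ∀ {p} a b → Prime p → a ℤ.* b ≋ + 0 [ p ] → a ≋ + 0 [ p ] ⊎ b ≋ + 0 [ p ]
euclid-≋ {p} a b pr e with euclidsLemma ℤ.∣ a ∣ ℤ.∣ b ∣ pr (subst (p ℕD.∣_) (ℤP.abs-* a b) (≋0⇒∣ e))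
... | inj₁ d = inj₁ (∣⇒≋0 d)
... | inj₂ d = inj₂ (∣⇒≋0 d)

≋-diff : ∀ {a b m} → a ≋ b [ m ] → a ℤ.- b ≋ + 0 [ m ]
≋-diff {a} {b} e = ∣⇒≋0 (≋⇒∣ e)

diff-≋ : ∀ {a b m} → a ℤ.- b ≋ + 0 [ m ] → a ≋ b [ m ]
diff-≋ e = ∣⇒≋ (≋0⇒∣ e)

≋-*-cancelʳ : ∀ {p} a b c → Prime p → ¬ (c ≋ + 0 [ p ]) → a ℤ.* c ≋ b ℤ.* c [ p ] → a ≋ b [ p ]
≋-*-cancelʳ a b c pr c≢0 e with euclid-≋ (a ℤ.- b) c pr
  (≋-trans (≋-reflexive (lem a b c)) (≋-diff e))
  where
  lem : ∀ a b c → (a ℤ.- b) ℤ.* c ≡ a ℤ.* c ℤ.- b ℤ.* c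
  lem = solve-∀
... | inj₁ d = diff-≋ d
... | inj₂ d = contradiction d c≢0

-- Monic polynomials by their non-leading coefficients, lowest degree first.
monic : List ℤ → ℤ → ℤ
monic []       x = + 1
monic (c ∷ cs) x = x ℤ.* monic cs x ℤ.+ c

-- Synthetic division by X - r: the coefficients of the quotient are the intermediate values of
-- Horner's scheme at r.
monic-quotient : List ℤ → ℤ → List ℤ
monic-quotient []            r = []
monic-quotient (_ ∷ [])      r = []
monic-quotient (_ ∷ c ∷ cs) r = monic (c ∷ cs) r ∷ monic-quotient (c ∷ cs) r

length-monic-quotient : ∀ c cs r → length (monic-quotient (c ∷ cs) r) ≡ length cs
length-monic-quotient _ []       r = refl
length-monic-quotient _ (c ∷ cs) r = cong suc (length-monic-quotient c cs r)

monic-divide : ∀ c cs r x →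
  monic (c ∷ cs) x ℤ.- monic (c ∷ cs) r ≡ (x ℤ.- r) ℤ.* monic (monic-quotient (c ∷ cs) r) x
monic-divide c []        r x = lem c r x
  where
  lem : ∀ c r x → x ℤ.* + 1 ℤ.+ c ℤ.- (r ℤ.* + 1 ℤ.+ c) ≡ (x ℤ.- r) ℤ.* + 1
  lem = solve-∀
monic-divide c (d ∷ cs) r x = begin
  x ℤ.* A ℤ.+ c ℤ.- (r ℤ.* B ℤ.+ c)         ≡⟨ lem c r x A B ⟩
  x ℤ.* (A ℤ.- B) ℤ.+ (x ℤ.- r) ℤ.* B       ≡⟨ cong (λ z → x ℤ.* z ℤ.+ (x ℤ.- r) ℤ.* B) (monic-divide d cs r x) ⟩
  x ℤ.* ((x ℤ.- r) ℤ.* Q) ℤ.+ (x ℤ.- r) ℤ.* B ≡⟨ lem' r x B Q ⟩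
  (x ℤ.- r) ℤ.* (x ℤ.* Q ℤ.+ B)             ∎
  where
  open ≡-Reasoning
  A = monic (d ∷ cs) x
  B = monic (d ∷ cs) r
  Q = monic (monic-quotient (d ∷ cs) r) x
  lem : ∀ c r x A B → x ℤ.* A ℤ.+ c ℤ.- (r ℤ.* B ℤ.+ c) ≡ x ℤ.* (A ℤ.- B) ℤ.+ (x ℤ.- r) ℤ.* B
  lem = solve-∀
  lem' : ∀ r x B Q → x ℤ.* ((x ℤ.- r) ℤ.* Q) ℤ.+ (x ℤ.- r) ℤ.* B ≡ (x ℤ.- r) ℤ.* (x ℤ.* Q ℤ.+ B)
  lem' = solve-∀

-- Lagrange's bound. Dividing by X - r lowers the degree by one, and every other root s survives in
-- the quotient because s - r is a unit modulo p. The implicit leading coefficient 1 ends the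
-- induction: the constant 1 has no root modulo p.
monic-roots : ∀ {p} → Prime p → ∀ cs rs → AllPairs (λ a b → ¬ a ≋ b [ p ]) rs →
  All (λ r → monic cs r ≋ + 0 [ p ]) rs → length rs ℕ.≤ length cs
monic-roots pr cs       []       _        _        = ℕ.z≤n
monic-roots pr []       (r ∷ rs) _        (z ∷ _)  =
  contradiction (subst Prime (ℕD.∣1⇒≡1 (≋0⇒∣ z)) pr) ℕPr.¬prime[1]
monic-roots pr (c ∷ cs) (r ∷ rs) (d ∷ ds) (z ∷ zs) = ℕ.s≤s
  (subst (length rs ℕ.≤_) (length-monic-quotient c cs r)
    (monic-roots pr (monic-quotient (c ∷ cs) r) rs ds
      (All.tabulate λ {s} s∈ → quotient-root s (All.lookup d s∈) (All.lookup zs s∈))))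
  where
  quotient-root : ∀ s → ¬ r ≋ s [ _ ] → monic (c ∷ cs) s ≋ + 0 [ _ ] →
    monic (monic-quotient (c ∷ cs) r) s ≋ + 0 [ _ ]
  quotient-root s r≢s e with euclid-≋ (s ℤ.- r) _ pr
    (≋-trans (≋-reflexive (sym (monic-divide c cs r s))) (≋-diff (≋-trans e (≋-sym z))))
  ... | inj₁ q = contradiction (≋-sym (diff-≋ q)) r≢s
  ... | inj₂ q = q

-- Pairs each value of the symbol with the reason for it, so later proofs match on this view rather
-- than repeat the case analysis of `legendre`.
data LegendreView (a : ℤ) (k : ℕ) : ℤ → Set where
  divisible  : a %ℕ suc k ≡ 0 → LegendreView a k (+ 0)
  residue    : a %ℕ suc k ≢ 0 → ∀ y → (y ℕ.* y) ℕ.% suc k ≡ a %ℕ suc k → LegendreView a k (+ 1)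
  nonresidue : a %ℕ suc k ≢ 0 → (∀ y → y ℕ.< suc k → (y ℕ.* y) ℕ.% suc k ≢ a %ℕ suc k) →
               LegendreView a k -[1+ 0 ]

legendre-view : ∀ a k → LegendreView a k (legendre a (suc k))
legendre-view a k with a %ℕ suc k in e
... | zero  = divisible e
... | r@(suc _) with any? (λ y → ((y ℕ.* y) ℕ.% suc k) ℕ.≟ r) (upTo (suc k))
...   | yes s = let y , _ , q = find s in
                residue (λ z → case trans (sym e) z of λ ()) y (trans q (sym e))
...   | no ¬s = nonresidue (λ z → case trans (sym e) z of λ ())
                (λ y y< q → ¬s (lose (∈-upTo⁺ y<) (trans q e)))

-- Gauss's lemma and quadratic reciprocity

-- The parity of an exponent is recorded as a power of -1, so the additive bookkeeping of Gauss and
-- Eisenstein becomes multiplicative.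
sgn : ℕ → ℤ
sgn zero    = + 1
sgn (suc n) = ℤ.- sgn n

sgn-+ : ∀ m n → sgn (m ℕ.+ n) ≡ sgn m ℤ.* sgn n
sgn-+ zero    n = sym (ℤP.*-identityˡ _)
sgn-+ (suc m) n = trans (cong ℤ.-_ (sgn-+ m n)) (ℤP.neg-distribˡ-* (sgn m) (sgn n))

sgn-double : ∀ n → sgn (n ℕ.+ n) ≡ + 1
sgn-double zero    = refl
sgn-double (suc n) = trans (cong (ℤ.-_ ∘ sgn) (ℕP.+-suc n n))
  (trans (ℤP.neg-involutive _) (sgn-double n))

sgn-*-odd : ∀ m h → sgn (m ℕ.* suc (h ℕ.+ h)) ≡ sgn m
sgn-*-odd zero    h = refl
sgn-*-odd (suc m) h = begin
  sgn (suc (h ℕ.+ h) ℕ.+ m ℕ.* suc (h ℕ.+ h))          ≡⟨ sgn-+ (suc (h ℕ.+ h)) (m ℕ.* suc (h ℕ.+ h)) ⟩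
  ℤ.- sgn (h ℕ.+ h) ℤ.* sgn (m ℕ.* suc (h ℕ.+ h))       ≡⟨ cong₂ (λ a b → ℤ.- a ℤ.* b) (sgn-double h) (sgn-*-odd m h) ⟩
  -[1+ 0 ] ℤ.* sgn m                                    ≡⟨ ℤP.-1*i≡-i (sgn m) ⟩
  ℤ.- sgn m                                             ∎
  where open ≡-Reasoning

-1^≡sgn : ∀ n → -[1+ 0 ] ℤ.^ n ≡ sgn n
-1^≡sgn zero    = refl
-1^≡sgn (suc n) = trans (cong (ℤ._*_ -[1+ 0 ]) (-1^≡sgn n)) (ℤP.-1*i≡-i (sgn n))

∏-const : {B : Set} (c : ℤ) (l : List B) → ∏ (λ _ → c) l ≡ c ℤ.^ length l
∏-const c []      = refl
∏-const c (x ∷ l) = cong (ℤ._*_ c) (∏-const c l)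

sgn-^ : ∀ m n → sgn m ℤ.^ n ≡ sgn (n ℕ.* m)
sgn-^ m zero    = refl
sgn-^ m (suc n) = trans (cong (ℤ._*_ (sgn m)) (sgn-^ m n)) (sym (sgn-+ m (n ℕ.* m)))

IsSign : ℤ → Set
IsSign z = z ≡ + 1 ⊎ z ≡ -[1+ 0 ]

isSign-* : ∀ {x y} → IsSign x → IsSign y → IsSign (x ℤ.* y)
isSign-* (inj₁ refl) (inj₁ refl) = inj₁ refl
isSign-* (inj₁ refl) (inj₂ refl) = inj₂ refl
isSign-* (inj₂ refl) (inj₁ refl) = inj₂ refl
isSign-* (inj₂ refl) (inj₂ refl) = inj₁ refl

isSign-² : ∀ {x} → IsSign x → x ℤ.* x ≡ + 1
isSign-² (inj₁ refl) = refl
isSign-² (inj₂ refl) = refl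

isSign-∏ : {B : Set} {g : B → ℤ} (l : List B) → (∀ x → IsSign (g x)) → IsSign (∏ g l)
isSign-∏ []      s = inj₁ refl
isSign-∏ (x ∷ l) s = isSign-* (s x) (isSign-∏ l s)

isSign-sgn : ∀ n → IsSign (sgn n)
isSign-sgn zero = inj₁ refl
isSign-sgn (suc n) with isSign-sgn n
... | inj₁ e = inj₂ (cong ℤ.-_ e)
... | inj₂ e = inj₁ (cong ℤ.-_ e)

isSign-unique : ∀ {x y} → IsSign x → x ℤ.* y ≡ + 1 → x ≡ y
isSign-unique {x} {y} s e = begin
  x                 ≡⟨ sym (ℤP.*-identityʳ x) ⟩
  x ℤ.* + 1         ≡⟨ cong (x ℤ.*_) (sym e) ⟩
  x ℤ.* (x ℤ.* y)   ≡⟨ sym (ℤP.*-assoc x x y) ⟩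
  x ℤ.* x ℤ.* y     ≡⟨ cong (ℤ._* y) (isSign-² s) ⟩
  + 1 ℤ.* y         ≡⟨ ℤP.*-identityˡ y ⟩
  y                 ∎
  where open ≡-Reasoning

data IsTernary : ℤ → Set where
  isZero : IsTernary (+ 0)
  isOne  : IsTernary (+ 1)
  isNeg  : IsTernary -[1+ 0 ]

ternary-* : ∀ {x y} → IsTernary x → IsTernary y → IsTernary (x ℤ.* y)
ternary-* isZero q      = isZero
ternary-* isOne  isZero = isZero
ternary-* isOne  isOne  = isOne
ternary-* isOne  isNeg  = isNeg
ternary-* isNeg  isZero = isZero
ternary-* isNeg  isOne  = isNeg
ternary-* isNeg  isNeg  = isOne

sign⇒ternary : ∀ {x} → IsSign x → IsTernary x
sign⇒ternary (inj₁ refl) = isOne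
sign⇒ternary (inj₂ refl) = isNeg

-- Two of the numbers -1, 0, 1 differ by at most 2. This lifts Euler's criterion from a congruence
-- to an equality of integers.
ternary-≋ : ∀ {x y m} → IsTernary x → IsTernary y → 2 ℕ.< m → x ≋ y [ m ] → x ≡ y
ternary-≋ {m = m} p q m> e = ≋-small e (ℕP.≤-<-trans (bound p q) m>)
  where
  bound : ∀ {x y} → IsTernary x → IsTernary y → ℤ.∣ x ℤ.- y ∣ ℕ.≤ 2
  bound isZero isZero = ℕ.z≤n
  bound isZero isOne  = ℕ.s≤s ℕ.z≤n
  bound isZero isNeg  = ℕ.s≤s ℕ.z≤n
  bound isOne  isZero = ℕ.s≤s ℕ.z≤n
  bound isOne  isOne  = ℕ.z≤n
  bound isOne  isNeg  = ℕ.s≤s (ℕ.s≤s ℕ.z≤n)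
  bound isNeg  isZero = ℕ.s≤s ℕ.z≤n
  bound isNeg  isOne  = ℕ.s≤s (ℕ.s≤s ℕ.z≤n)
  bound isNeg  isNeg  = ℕ.z≤n

legendre-ternary : ∀ a k → IsTernary (legendre a k)
legendre-ternary a zero    = isZero
legendre-ternary a (suc k) with legendre a (suc k) | legendre-view a k
... | _ | divisible _      = isZero
... | _ | residue _ _ _    = isOne
... | _ | nonresidue _ _   = isNeg

legendre-cong : ∀ {a b} k → a ≋ b [ k ] → legendre a k ≡ legendre b k
legendre-cong zero    e = refl
legendre-cong {a} {b} (suc k) e with legendre a (suc k) | legendre-view a k | legendre b (suc k) | legendre-view b k | ≋⇒%ℕ (suc k) e
... | _ | divisible p      | _ | divisible q      | r = refl
... | _ | divisible p      | _ | residue q _ _    | r = contradiction (trans (sym r) p) q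
... | _ | divisible p      | _ | nonresidue q _   | r = contradiction (trans (sym r) p) q
... | _ | residue p _ _    | _ | divisible q      | r = contradiction (trans r q) p
... | _ | residue p _ _    | _ | residue q _ _    | r = refl
... | _ | residue p y s    | _ | nonresidue q n   | r =
  -- `nonresidue` excludes only roots below the modulus, hence the reduction of `y`.
  contradiction (trans (ℕDM.%-distribˡ-* (y ℕ.% suc k) (y ℕ.% suc k) (suc k))
    (trans (cong₂ (λ u v → (u ℕ.* v) ℕ.% suc k) (ℕDM.m%n%n≡m%n y (suc k)) (ℕDM.m%n%n≡m%n y (suc k)))
    (trans (sym (ℕDM.%-distribˡ-* y y (suc k))) (trans s r)))) (n (y ℕ.% suc k) (ℕDM.m%n<n y (suc k)))
... | _ | nonresidue p _   | _ | divisible q      | r = contradiction (trans r q) p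
... | _ | nonresidue p n   | _ | residue q y s    | r =
  contradiction (trans (ℕDM.%-distribˡ-* (y ℕ.% suc k) (y ℕ.% suc k) (suc k))
    (trans (cong₂ (λ u v → (u ℕ.* v) ℕ.% suc k) (ℕDM.m%n%n≡m%n y (suc k)) (ℕDM.m%n%n≡m%n y (suc k)))
    (trans (sym (ℕDM.%-distribˡ-* y y (suc k))) (trans s (sym r))))) (n (y ℕ.% suc k) (ℕDM.m%n<n y (suc k)))
... | _ | nonresidue p _   | _ | nonresidue q _   | r = refl

monic-replicate : ∀ n x → monic (replicate n (+ 0)) x ≡ x ℤ.^ n
monic-replicate zero    x = refl
monic-replicate (suc n) x = trans (ℤP.+-identityʳ _) (cong (ℤ._*_ x) (monic-replicate n x))

-- Taking h = (p - 1)/2 as the parameter avoids division; the index i of `upTo h` stands for the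
-- residue i + 1.
module OddPrime (h : ℕ) (pr : Prime (suc (h ℕ.+ h))) where

  p : ℕ
  p = suc (h ℕ.+ h)

  h>0 : 0 ℕ.< h
  h>0 = positive h pr
    where
    positive : ∀ h → Prime (suc (h ℕ.+ h)) → 0 ℕ.< h
    positive zero    pr = contradiction pr ℕPr.¬prime[1]
    positive (suc _) _  = ℕ.s≤s ℕ.z≤n

  p>2 : 2 ℕ.< p
  p>2 = ℕ.s≤s (ℕP.+-mono-≤ h>0 h>0)

  below-≢0 : ∀ {n} → 0 ℕ.< n → n ℕ.< p → ¬ + n ≋ + 0 [ p ]
  below-≢0 {n} n> n< e = ℕP.<⇒≢ n> (sym (≋-small-ℕ e n< (ℕ.s≤s ℕ.z≤n)))

  -- For 0 < r < p, `e r` and `suc (s r)` are the sign and the absolute value of the residue of r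
  -- nearest to 0; the shift by one makes `s r` an index of `upTo h`.
  e : ℕ → ℤ
  e r with r ℕ.≤? h
  ... | yes _ = + 1
  ... | no _  = -[1+ 0 ]

  s : ℕ → ℕ
  s r with r ℕ.≤? h
  ... | yes _ = ℕ.pred r
  ... | no _  = h ℕ.+ h ℕ.∸ r

  data AbsView (r : ℕ) : ℤ → ℕ → Set where
    low  : ∀ {t} → t ℕ.< h → r ≡ suc t → AbsView r (+ 1) t
    high : ∀ {t} → t ℕ.< h → r ℕ.+ suc t ≡ p → AbsView r -[1+ 0 ] t

  abs-view : ∀ r → 0 ℕ.< r → r ℕ.< p → AbsView r (e r) (s r)
  abs-view (suc r) _ r< with suc r ℕ.≤? h
  ... | yes r≤ = low r≤ refl
  ... | no r≰  = high (ℕP.+-cancelʳ-< (suc r) _ h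
                   (subst (ℕ._< h ℕ.+ suc r) (sym (ℕP.m∸n+n≡m (ℕ.s≤s⁻¹ r<)))
                     (ℕP.+-monoʳ-< h (ℕP.≰⇒> r≰))))
                 (trans (ℕP.+-suc (suc r) _) (cong suc (ℕP.m+[n∸m]≡n (ℕ.s≤s⁻¹ r<))))

  e-sign : ∀ r → IsSign (e r)
  e-sign r with r ℕ.≤? h
  ... | yes _ = inj₁ refl
  ... | no _  = inj₂ refl

  abs-≋ : ∀ {r} → 0 ℕ.< r → r ℕ.< p → + r ≋ e r ℤ.* + suc (s r) [ p ]
  abs-≋ {r} r> r< with e r | s r | abs-view r r> r<
  ... | _ | t | low _ eq  = ≋-reflexive (trans (cong +_ eq) (sym (ℤP.*-identityˡ _)))
  ... | _ | t | high _ eq = mk≋ (+ 1) (begin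
    + r                                         ≡⟨ lem (+ r) (+ suc t) ⟩
    -[1+ 0 ] ℤ.* + suc t ℤ.+ + 1 ℤ.* (+ r ℤ.+ + suc t) ≡⟨ cong (λ z → -[1+ 0 ] ℤ.* + suc t ℤ.+ + 1 ℤ.* + z) eq ⟩
    -[1+ 0 ] ℤ.* + suc t ℤ.+ + 1 ℤ.* + p        ∎)
    where
    open ≡-Reasoning
    lem : ∀ r t → r ≡ -[1+ 0 ] ℤ.* t ℤ.+ + 1 ℤ.* (r ℤ.+ t)
    lem = solve-∀

  -- As p is odd, r and p - r have opposite parities, so passing to the absolutely least residue
  -- changes the parity exactly when it changes the sign. This links Gauss's signs to Eisenstein's
  -- floors.
  abs-sgn : ∀ {r} → 0 ℕ.< r → r ℕ.< p → sgn r ≡ e r ℤ.* sgn (suc (s r))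
  abs-sgn {r} r> r< with e r | s r | abs-view r r> r<
  ... | _ | t | low _ eq  = trans (cong sgn eq) (sym (ℤP.*-identityˡ _))
  ... | _ | t | high _ eq = begin
    sgn r                                        ≡⟨ lem (sgn r) ⟩
    -[1+ 0 ] ℤ.* (sgn r ℤ.* -[1+ 0 ])            ≡⟨ cong (λ z → -[1+ 0 ] ℤ.* (sgn r ℤ.* z)) (sym sgn-p) ⟩
    -[1+ 0 ] ℤ.* (sgn r ℤ.* sgn p)               ≡⟨ cong (λ z → -[1+ 0 ] ℤ.* (sgn r ℤ.* sgn z)) (sym eq) ⟩
    -[1+ 0 ] ℤ.* (sgn r ℤ.* sgn (r ℕ.+ suc t))   ≡⟨ cong (λ z → -[1+ 0 ] ℤ.* (sgn r ℤ.* z)) (sgn-+ r (suc t)) ⟩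
    -[1+ 0 ] ℤ.* (sgn r ℤ.* (sgn r ℤ.* sgn (suc t))) ≡⟨ cong (-[1+ 0 ] ℤ.*_) (sym (ℤP.*-assoc (sgn r) (sgn r) _)) ⟩
    -[1+ 0 ] ℤ.* (sgn r ℤ.* sgn r ℤ.* sgn (suc t)) ≡⟨ cong (λ z → -[1+ 0 ] ℤ.* (z ℤ.* sgn (suc t))) (isSign-² (isSign-sgn r)) ⟩
    -[1+ 0 ] ℤ.* (+ 1 ℤ.* sgn (suc t))           ≡⟨ cong (-[1+ 0 ] ℤ.*_) (ℤP.*-identityˡ (sgn (suc t))) ⟩
    -[1+ 0 ] ℤ.* sgn (suc t)                     ∎
    where
    open ≡-Reasoning
    sgn-p : sgn p ≡ -[1+ 0 ]
    sgn-p = cong ℤ.-_ (sgn-double h)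
    lem : ∀ r → r ≡ -[1+ 0 ] ℤ.* (r ℤ.* -[1+ 0 ])
    lem = solve-∀

  s-bound : ∀ {r} → 0 ℕ.< r → r ℕ.< p → s r ℕ.< h
  s-bound {r} r> r< with e r | s r | abs-view r r> r<
  ... | _ | t | low b _  = b
  ... | _ | t | high b _ = b

  s-inj : ∀ {r r'} → 0 ℕ.< r → r ℕ.< p → 0 ℕ.< r' → r' ℕ.< p → s r ≡ s r' → r ≡ r' ⊎ r ℕ.+ r' ≡ p
  s-inj {r} {r'} r> r< r'> r'< eq with e r | s r | abs-view r r> r< | e r' | s r' | abs-view r' r'> r'<
  ... | _ | t | low _ u  | _ | t' | low _ v  = inj₁ (trans u (trans (cong suc eq) (sym v)))
  ... | _ | t | low _ u  | _ | t' | high _ v = inj₂ (trans (ℕP.+-comm r r') (trans (cong (r' ℕ.+_) (trans u (cong suc eq))) v))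
  ... | _ | t | high _ u | _ | t' | low _ v  = inj₂ (trans (cong (r ℕ.+_) (trans v (cong suc (sym eq)))) u)
  ... | _ | t | high _ u | _ | t' | high _ v = inj₁ (ℕP.+-cancelʳ-≡ (suc t) r r' (trans u (trans (sym v) (cong (λ z → r' ℕ.+ suc z) (sym eq)))))

  R : ℤ → ℕ → ℕ
  R a i = (a ℤ.* + suc i) %ℕ p

  σ : ℤ → ℕ → ℕ
  σ a i = s (R a i)

  -- The sign in Gauss's lemma: -1 to the number of negative absolutely least residues among a, 2a,
  -- ..., ha.
  G : ℤ → ℤ
  G a = ∏ (e ∘ R a) (upTo h)

  G-sign : ∀ a → IsSign (G a)
  G-sign a = isSign-∏ (upTo h) (e-sign ∘ R a)

  i<h⇒suc<p : ∀ {i} → i ℕ.< h → suc i ℕ.< p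
  i<h⇒suc<p i< = ℕ.s≤s (ℕP.≤-trans i< (ℕP.m≤m+n h h))

  module _ (a : ℤ) (a≢0 : ¬ a ≋ + 0 [ p ]) where

    R<p : ∀ i → R a i ℕ.< p
    R<p i = n%ℕd<d (a ℤ.* + suc i) p

    R>0 : ∀ {i} → i ℕ.< h → 0 ℕ.< R a i
    R>0 {i} i< = ℕP.n≢0⇒n>0 λ z → case euclid-≋ a (+ suc i) pr (∣⇒≋0 (%ℕ0⇒∣ (a ℤ.* + suc i) p z)) of λ
      { (inj₁ q) → a≢0 q
      ; (inj₂ q) → below-≢0 (ℕ.s≤s ℕ.z≤n) (i<h⇒suc<p i<) q }

    -- Equal absolute values mean a(i + 1) ≡ ±a(j + 1). The minus sign would make p divide i + j +
    -- 2, which lies strictly between 0 and p.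
    σ-inj : ∀ {i j} → i ℕ.< h → j ℕ.< h → σ a i ≡ σ a j → i ≡ j
    σ-inj {i} {j} i< j< eq with s-inj (R>0 i<) (R<p i) (R>0 j<) (R<p j) eq
    ... | inj₁ u = ℕP.suc-injective (≋-small-ℕ
          (≋-*-cancelʳ (+ suc i) (+ suc j) a pr a≢0
            (≋-trans (≋-reflexive (ℤP.*-comm (+ suc i) a))
              (≋-trans (%ℕ⇒≋ p u) (≋-reflexive (ℤP.*-comm a (+ suc j))))))
          (i<h⇒suc<p i<) (i<h⇒suc<p j<))
    ... | inj₂ u = ⊥-elim (case euclid-≋ a (+ (suc i ℕ.+ suc j)) pr sum≋0 of λ
      { (inj₁ q) → a≢0 q
      ; (inj₂ q) → below-≢0 (ℕ.s≤s ℕ.z≤n) (ℕ.s≤s (ℕP.+-mono-≤ i< j<)) q })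
      where
      sum≋0 : a ℤ.* + (suc i ℕ.+ suc j) ≋ + 0 [ p ]
      sum≋0 = ≋-trans (≋-reflexive (ℤP.*-distribˡ-+ a (+ suc i) (+ suc j)))
        (≋-trans (≋-+ (≋-sym (%ℕ-≋ (a ℤ.* + suc i) p)) (≋-sym (%ℕ-≋ (a ℤ.* + suc j) p)))
          (≋-trans (≋-reflexive (cong +_ u)) (mk≋ (+ 1) (sym (trans (ℤP.+-identityˡ _) (ℤP.*-identityˡ (+ p)))))))

    ∏-σ : (g : ℕ → ℤ) → ∏ (g ∘ σ a) (upTo h) ≡ ∏ g (upTo h)
    ∏-σ g = ∏-perm g h (σ a) (λ {i} i< → s-bound (R>0 i<) (R<p i)) σ-inj

    factorial≢0 : ∀ n → n ℕ.≤ h → ¬ ∏ (λ i → + suc i) (upTo n) ≋ + 0 [ p ]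
    factorial≢0 zero    _  q = below-≢0 (ℕ.s≤s ℕ.z≤n) (ℕP.<-trans (ℕ.s≤s (ℕ.s≤s ℕ.z≤n)) p>2) q
    factorial≢0 (suc n) n< q with euclid-≋ _ (+ suc n) pr
      (≋-trans (≋-reflexive (sym (∏-upTo-suc (λ i → + suc i) n))) q)
    ... | inj₁ r = factorial≢0 n (ℕP.<⇒≤ n<) r
    ... | inj₂ r = below-≢0 (ℕ.s≤s ℕ.z≤n) (i<h⇒suc<p n<) r

    -- Multiply a(i + 1) ≡ ±(σ i + 1) over i < h. Since σ permutes the indices, h! appears on both
    -- sides, and it is a unit modulo p.
    gauss : a ℤ.^ h ≋ G a [ p ]
    gauss = ≋-*-cancelʳ (a ℤ.^ h) (G a) h! pr (factorial≢0 h ℕP.≤-refl)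
      (≋-trans (≋-reflexive lhs) (≋-trans (≋-∏ (upTo h) step) (≋-reflexive rhs)))
      where
      h! = ∏ (λ i → + suc i) (upTo h)
      lhs : a ℤ.^ h ℤ.* h! ≡ ∏ (λ i → a ℤ.* + suc i) (upTo h)
      lhs = trans (cong (ℤ._* h!) (trans (cong (a ℤ.^_) (sym (length-upTo h))) (sym (∏-const a (upTo h)))))
        (sym (∏-* (λ _ → a) (λ i → + suc i) (upTo h)))
      step : ∀ {i} → i ∈ upTo h → a ℤ.* + suc i ≋ e (R a i) ℤ.* + suc (σ a i) [ p ]
      step {i} i∈ = ≋-trans (≋-sym (%ℕ-≋ (a ℤ.* + suc i) p)) (abs-≋ (R>0 (∈-upTo⁻ i∈)) (R<p i))
      rhs : ∏ (λ i → e (R a i) ℤ.* + suc (σ a i)) (upTo h) ≡ G a ℤ.* h!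
      rhs = trans (∏-* (e ∘ R a) (λ i → + suc (σ a i)) (upTo h)) (cong (ℤ._*_ (G a)) (∏-σ (λ i → + suc i)))

    -- Obtained by squaring Gauss's congruence. In this form it says that nonzero squares are roots
    -- of X^h - 1.
    fermat : (a ℤ.* a) ℤ.^ h ≋ + 1 [ p ]
    fermat = ≋-trans (≋-reflexive (^-*-distrib h))
      (≋-trans (≋-* gauss gauss) (≋-reflexive (isSign-² (G-sign a))))
      where
      ^-*-distrib : ∀ n → (a ℤ.* a) ℤ.^ n ≡ a ℤ.^ n ℤ.* a ℤ.^ n
      ^-*-distrib zero    = refl
      ^-*-distrib (suc n) = trans (cong (ℤ._*_ (a ℤ.* a)) (^-*-distrib n)) (lem a (a ℤ.^ n))
        where
        lem : ∀ a b → a ℤ.* a ℤ.* (b ℤ.* b) ≡ a ℤ.* b ℤ.* (a ℤ.* b)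
        lem = solve-∀

  square : ℕ → ℤ
  square i = + suc i ℤ.* + suc i

  square-inj : ∀ {i j} → i ℕ.< h → j ℕ.< h → square i ≋ square j [ p ] → i ≡ j
  square-inj {i} {j} i< j< q with euclid-≋ (+ suc i ℤ.- + suc j) (+ (suc i ℕ.+ suc j)) pr
    (≋-trans (≋-reflexive (lem (+ suc i) (+ suc j))) (≋-diff q))
    where
    lem : ∀ x y → (x ℤ.- y) ℤ.* (x ℤ.+ y) ≡ x ℤ.* x ℤ.- y ℤ.* y
    lem = solve-∀
  ... | inj₁ r = ℕP.suc-injective (≋-small-ℕ (diff-≋ r) (i<h⇒suc<p i<) (i<h⇒suc<p j<))
  ... | inj₂ r = contradiction r (below-≢0 (ℕ.s≤s ℕ.z≤n) (ℕ.s≤s (ℕP.+-mono-≤ i< j<)))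

  -- Otherwise X^h − 1 would have h + 1 roots: the h squares and a.
  nonsquare-power≢1 : ∀ a → (∀ {i} → i ℕ.< h → ¬ a ≋ square i [ p ]) → ¬ a ℤ.^ h ≋ + 1 [ p ]
  nonsquare-power≢1 a non q = ℕP.<⇒≱ (ℕP.n<1+n h)
    (subst₂ ℕ._≤_ (cong suc (trans (length-map square (upTo h)) (length-upTo h)))
      (trans (cong suc (length-replicate (ℕ.pred h))) suc-pred)
      (monic-roots pr cs (a ∷ map square (upTo h)) (pairs-head ∷ pairs-tail) (root a q ∷ roots)))
    where
    suc-pred : suc (ℕ.pred h) ≡ h
    suc-pred = ℕP.suc-pred h {{ℕ.>-nonZero h>0}}
    -- X^h - 1: the constant term, then h - 1 zeros; the leading coefficient is implicit.
    cs : List ℤ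
    cs = -[1+ 0 ] ∷ replicate (ℕ.pred h) (+ 0)
    root : ∀ x → x ℤ.^ h ≋ + 1 [ p ] → monic cs x ≋ + 0 [ p ]
    root x r = ≋-trans (≋-reflexive (cong (ℤ._+ -[1+ 0 ])
      (trans (cong (x ℤ.*_) (monic-replicate (ℕ.pred h) x)) (cong (x ℤ.^_) suc-pred))))
      (≋-+ r (≋-refl { -[1+ 0 ] }))
    pairs-head : All (λ b → ¬ a ≋ b [ p ]) (map square (upTo h))
    pairs-head = AllP.map⁺ (All.tabulate (λ i∈ → non (∈-upTo⁻ i∈)))
    pairs-tail : AllPairs (λ a b → ¬ a ≋ b [ p ]) (map square (upTo h))
    pairs-tail = allPairs-map square (λ i∈ j∈ i≢j → i≢j ∘ square-inj (∈-upTo⁻ i∈) (∈-upTo⁻ j∈))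
      (UniqueP.upTo⁺ h)
    roots : All (λ r → monic cs r ≋ + 0 [ p ]) (map square (upTo h))
    roots = AllP.map⁺ (All.tabulate (λ {i} i∈ → root (square i)
      (fermat (+ suc i) (below-≢0 (ℕ.s≤s ℕ.z≤n) (i<h⇒suc<p (∈-upTo⁻ i∈))))))

  leg : ℤ → ℤ
  leg a = legendre a p

  -- Squares satisfy it by `fermat`. For a nonresidue Gauss's lemma leaves only ±1, and the root
  -- bound excludes +1.
  euler : ∀ a → leg a ≋ a ℤ.^ h [ p ]
  euler a with leg a | legendre-view a (h ℕ.+ h)
  ... | _ | divisible z = ≋-sym (≋-trans (≋-^ h (∣⇒≋0 (%ℕ0⇒∣ a p z))) (≋-reflexive (0^ h h>0)))
    where
    0^ : ∀ n → 0 ℕ.< n → (+ 0) ℤ.^ n ≡ + 0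
    0^ (suc n) _ = refl
  ... | _ | residue z y q = ≋-sym (≋-trans (≋-^ h (≋-sym y²≋a)) (fermat (+ y) y≢0))
    where
    y²≋a : + y ℤ.* + y ≋ a [ p ]
    y²≋a = ≋-trans (≋-reflexive (sym (ℤP.pos-* y y))) (%ℕ⇒≋ p q)
    y≢0 : ¬ + y ≋ + 0 [ p ]
    y≢0 r = z (∣⇒%ℕ0 a p (≋0⇒∣ (≋-trans (≋-sym y²≋a) (≋-* r r))))
  ... | _ | nonresidue z n with G-sign a
  ...   | inj₂ g = ≋-sym (≋-trans (gauss a (λ r → z (∣⇒%ℕ0 a p (≋0⇒∣ r)))) (≋-reflexive g))
  ...   | inj₁ g = contradiction
          (≋-trans (gauss a (λ r → z (∣⇒%ℕ0 a p (≋0⇒∣ r)))) (≋-reflexive g))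
          (nonsquare-power≢1 a λ {i} i< r → n (suc i) (i<h⇒suc<p i<)
            (sym (≋⇒%ℕ {a} {+ (suc i ℕ.* suc i)} p (≋-trans r (≋-reflexive (sym (ℤP.pos-* (suc i) (suc i))))))))

  leg-* : ∀ a b → leg (a ℤ.* b) ≡ leg a ℤ.* leg b
  leg-* a b = ternary-≋ (legendre-ternary (a ℤ.* b) p) (ternary-* (legendre-ternary a p) (legendre-ternary b p)) p>2
    (≋-trans (euler (a ℤ.* b)) (≋-trans (≋-reflexive (distrib h)) (≋-sym (≋-* (euler a) (euler b)))))
    where
    distrib : ∀ n → (a ℤ.* b) ℤ.^ n ≡ a ℤ.^ n ℤ.* b ℤ.^ n
    distrib zero    = refl
    distrib (suc n) = trans (cong (ℤ._*_ (a ℤ.* b)) (distrib n)) (lem a b (a ℤ.^ n) (b ℤ.^ n))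
      where
      lem : ∀ a b c d → a ℤ.* b ℤ.* (c ℤ.* d) ≡ a ℤ.* c ℤ.* (b ℤ.* d)
      lem = solve-∀

  leg-G : ∀ a → ¬ a ≋ + 0 [ p ] → leg a ≡ G a
  leg-G a a≢0 = ternary-≋ (legendre-ternary a p) (sign⇒ternary (G-sign a)) p>2 (≋-trans (euler a) (gauss a a≢0))

  leg-sign : ∀ a → ¬ a ≋ + 0 [ p ] → IsSign (leg a)
  leg-sign a a≢0 = subst IsSign (sym (leg-G a a≢0)) (G-sign a)

  leg-1 : leg (+ 1) ≡ + 1
  leg-1 = ternary-≋ (legendre-ternary (+ 1) p) isOne p>2 (≋-trans (euler (+ 1)) (≋-reflexive (ℤP.^-zeroˡ h)))

  leg-neg1 : leg -[1+ 0 ] ≡ sgn h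
  leg-neg1 = ternary-≋ (legendre-ternary -[1+ 0 ] p) (sign⇒ternary (isSign-sgn h)) p>2
    (≋-trans (euler -[1+ 0 ]) (≋-reflexive (-1^≡sgn h)))

  leg-sgn : ∀ n → leg (sgn n) ≡ sgn (n ℕ.* h)
  leg-sgn zero    = leg-1
  leg-sgn (suc n) = begin
    leg (ℤ.- sgn n)                 ≡⟨ cong leg (sym (ℤP.-1*i≡-i (sgn n))) ⟩
    leg (-[1+ 0 ] ℤ.* sgn n)        ≡⟨ leg-* -[1+ 0 ] (sgn n) ⟩
    leg -[1+ 0 ] ℤ.* leg (sgn n)    ≡⟨ cong₂ ℤ._*_ leg-neg1 (leg-sgn n) ⟩
    sgn h ℤ.* sgn (n ℕ.* h)         ≡⟨ sym (sgn-+ h (n ℕ.* h)) ⟩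
    sgn (h ℕ.+ n ℕ.* h)             ∎
    where open ≡-Reasoning

  -- -1 to the power 1 + 2 + ... + h = (p² - 1)/8, the right-hand side of the second supplementary
  -- law.
  T : ℤ
  T = ∏ (λ i → sgn (suc i)) (upTo h)

  T-sign : IsSign T
  T-sign = isSign-∏ (upTo h) (λ i → isSign-sgn (suc i))

  -- The exponent counts the lattice points under the line of slope b/p with abscissa from 1 to h.
  floors : ℕ → ℤ
  floors b = ∏ (λ i → sgn ((b ℕ.* suc i) ℕ./ p)) (upTo h)

  -- Parities, written as signs, in b(i + 1) = r + p⌊b(i + 1)/p⌋, multiplied over all i < h.
  eisenstein : ∀ b → ¬ + b ≋ + 0 [ p ] →
    ∏ (λ i → sgn (b ℕ.* suc i)) (upTo h) ≡ leg (+ b) ℤ.* T ℤ.* floors b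
  eisenstein b b≢0 = begin
    ∏ (λ i → sgn (b ℕ.* suc i)) (upTo h)                            ≡⟨ ∏-cong (upTo h) (λ i∈ → step (∈-upTo⁻ i∈)) ⟩
    ∏ (λ i → e (R (+ b) i) ℤ.* S i ℤ.* F i) (upTo h)                ≡⟨ ∏-* _ F (upTo h) ⟩
    ∏ (λ i → e (R (+ b) i) ℤ.* S i) (upTo h) ℤ.* floors b           ≡⟨ cong (ℤ._* floors b) (∏-* _ S (upTo h)) ⟩
    G (+ b) ℤ.* ∏ S (upTo h) ℤ.* floors b                           ≡⟨ cong₂ (λ x y → x ℤ.* y ℤ.* floors b) (sym (leg-G (+ b) b≢0)) (∏-σ (+ b) b≢0 (λ i → sgn (suc i))) ⟩
    leg (+ b) ℤ.* T ℤ.* floors b                                    ∎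
    where
    open ≡-Reasoning
    S F : ℕ → ℤ
    S i = sgn (suc (σ (+ b) i))
    F i = sgn ((b ℕ.* suc i) ℕ./ p)
    step : ∀ {i} → i ℕ.< h → sgn (b ℕ.* suc i) ≡ e (R (+ b) i) ℤ.* S i ℤ.* F i
    step {i} i< = begin
      sgn (b ℕ.* suc i)                                                           ≡⟨ cong sgn (ℕDM.m≡m%n+[m/n]*n (b ℕ.* suc i) p) ⟩
      sgn ((b ℕ.* suc i) ℕ.% p ℕ.+ (b ℕ.* suc i) ℕ./ p ℕ.* p)                     ≡⟨ sgn-+ ((b ℕ.* suc i) ℕ.% p) ((b ℕ.* suc i) ℕ./ p ℕ.* p) ⟩
      sgn ((b ℕ.* suc i) ℕ.% p) ℤ.* sgn ((b ℕ.* suc i) ℕ./ p ℕ.* p)               ≡⟨ cong₂ ℤ._*_ (cong (λ z → sgn (z %ℕ p)) (ℤP.pos-* b (suc i))) (sgn-*-odd ((b ℕ.* suc i) ℕ./ p) h) ⟩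
      sgn (R (+ b) i) ℤ.* F i                                                     ≡⟨ cong (ℤ._* F i) (abs-sgn (R>0 (+ b) b≢0 i<) (R<p (+ b) b≢0 i)) ⟩
      e (R (+ b) i) ℤ.* S i ℤ.* F i                                               ∎

  -- For odd b the left side of `eisenstein` is `T` itself, and `T` cancels.
  leg-odd : ∀ k → ¬ + suc (k ℕ.+ k) ≋ + 0 [ p ] → leg (+ suc (k ℕ.+ k)) ≡ floors (suc (k ℕ.+ k))
  leg-odd k b≢0 = isSign-unique (leg-sign (+ b) b≢0) (begin
    leg (+ b) ℤ.* floors b                    ≡⟨ sym (ℤP.*-identityʳ _) ⟩
    leg (+ b) ℤ.* floors b ℤ.* + 1            ≡⟨ cong (leg (+ b) ℤ.* floors b ℤ.*_) (sym (isSign-² T-sign)) ⟩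
    leg (+ b) ℤ.* floors b ℤ.* (T ℤ.* T)      ≡⟨ lem (leg (+ b)) (floors b) T ⟩
    leg (+ b) ℤ.* T ℤ.* floors b ℤ.* T        ≡⟨ cong (ℤ._* T) (sym (eisenstein b b≢0)) ⟩
    ∏ (λ i → sgn (b ℕ.* suc i)) (upTo h) ℤ.* T ≡⟨ cong (ℤ._* T) (∏-cong (upTo h) (λ {i} _ → trans (cong sgn (ℕP.*-comm b (suc i))) (sgn-*-odd (suc i) k))) ⟩
    T ℤ.* T                                   ≡⟨ isSign-² T-sign ⟩
    + 1                                       ∎)
    where
    open ≡-Reasoning
    b = suc (k ℕ.+ k)
    lem : ∀ a b c → a ℤ.* b ℤ.* (c ℤ.* c) ≡ a ℤ.* c ℤ.* b ℤ.* c
    lem = solve-∀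

  -- For b = 2 the left side of `eisenstein` is a product over even exponents, and all floors vanish
  -- because 2(i + 1) < p. Hence (2/p)·T = 1.
  leg-2 : leg (+ 2) ≡ T
  leg-2 = isSign-unique (leg-sign (+ 2) 2≢0) (begin
    leg (+ 2) ℤ.* T                        ≡⟨ sym (ℤP.*-identityʳ _) ⟩
    leg (+ 2) ℤ.* T ℤ.* + 1                ≡⟨ cong (leg (+ 2) ℤ.* T ℤ.*_) (sym floors-2) ⟩
    leg (+ 2) ℤ.* T ℤ.* floors 2           ≡⟨ sym (eisenstein 2 2≢0) ⟩
    ∏ (λ i → sgn (2 ℕ.* suc i)) (upTo h)   ≡⟨ ∏-cong (upTo h) (λ {i} _ → trans (cong (λ z → sgn (suc i ℕ.+ z)) (ℕP.+-identityʳ (suc i))) (sgn-double (suc i))) ⟩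
    ∏ (λ _ → + 1) (upTo h)                 ≡⟨ ∏-1 (upTo h) ⟩
    + 1                                    ∎)
    where
    open ≡-Reasoning
    2≢0 : ¬ + 2 ≋ + 0 [ p ]
    2≢0 = below-≢0 (ℕ.s≤s ℕ.z≤n) p>2
    floors-2 : floors 2 ≡ + 1
    floors-2 = trans (∏-cong (upTo h) (λ {i} i∈ → cong sgn (ℕDM.m<n⇒m/n≡0
        (ℕ.s≤s (ℕP.+-mono-≤ (∈-upTo⁻ i∈) (subst (ℕ._≤ h) (sym (ℕP.+-identityʳ (suc i))) (∈-upTo⁻ i∈)))))))
      (∏-1 (upTo h))

below : ℕ → ℕ → ℤ
below j F with j ℕ.<? F
... | yes _ = -[1+ 0 ]
... | no _  = + 1

∏-below : ∀ n F → ∏ (λ j → below j F) (upTo n) ≡ sgn (n ℕ.⊓ F)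
∏-below zero    F = refl
∏-below (suc n) F = trans (∏-upTo-suc (λ j → below j F) n) (trans (cong (ℤ._* below n F) (∏-below n F)) (step n F))
  where
  step : ∀ n F → sgn (n ℕ.⊓ F) ℤ.* below n F ≡ sgn (suc n ℕ.⊓ F)
  step n F with n ℕ.<? F
  ... | yes n<F = trans (ℤP.*-comm (sgn (n ℕ.⊓ F)) -[1+ 0 ]) (trans (ℤP.-1*i≡-i _)
        (trans (cong (ℤ.-_ ∘ sgn) (ℕP.m≤n⇒m⊓n≡m (ℕP.<⇒≤ n<F))) (cong sgn (sym (ℕP.m≤n⇒m⊓n≡m n<F)))))
  ... | no n≮F  = trans (ℤP.*-identityʳ _) (cong sgn
        (trans (ℕP.m≥n⇒m⊓n≡n (ℕP.≮⇒≥ n≮F)) (sym (ℕP.m≥n⇒m⊓n≡n (ℕP.m≤n⇒m≤1+n (ℕP.≮⇒≥ n≮F))))))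

side : ℕ → ℕ → ℤ
side x y with x ℕ.<? y
... | yes _ = -[1+ 0 ]
... | no _  = + 1

side-antisym : ∀ x y → x ≢ y → side x y ℤ.* side y x ≡ -[1+ 0 ]
side-antisym x y x≢y with x ℕ.<? y | y ℕ.<? x
... | yes p | yes q = contradiction q (ℕP.<-asym p)
... | yes p | no q  = refl
... | no p  | yes q = refl
... | no p  | no q  = contradiction (ℕP.≤-antisym (ℕP.≮⇒≥ q) (ℕP.≮⇒≥ p)) x≢y

-- Kept asymmetric so that it can be instantiated at (h, k) and (k, h), once for each side of the
-- diagonal.
module Reciprocity (h k : ℕ) (prh : Prime (suc (h ℕ.+ h))) (prk : Prime (suc (k ℕ.+ k))) (h≢k : h ≢ k) where

  private
    module H = OddPrime h prh
    module K = OddPrime k prk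
    p = suc (h ℕ.+ h)
    q = suc (k ℕ.+ k)

  q≢0 : ¬ + q ≋ + 0 [ p ]
  q≢0 e with ℕPr.prime⇒irreducible prk (≋0⇒∣ e)
  ... | inj₁ r = contradiction (subst Prime r prh) ℕPr.¬prime[1]
  ... | inj₂ r = h≢k (double-inj h k (ℕP.suc-injective r))
    where
    double-inj : ∀ h k → h ℕ.+ h ≡ k ℕ.+ k → h ≡ k
    double-inj h k r with ℕP.<-cmp h k
    ... | tri< a _ _ = contradiction r (ℕP.<⇒≢ (ℕP.+-mono-< a a))
    ... | tri≈ _ b _ = b
    ... | tri> _ _ c = contradiction (sym r) (ℕP.<⇒≢ (ℕP.+-mono-< c c))

  -- No lattice point lies on the diagonal: p would divide q or the number i + 1 < p.
  lattice-≢ : ∀ {i} j → i ℕ.< h → p ℕ.* suc j ≢ q ℕ.* suc i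
  lattice-≢ {i} j i< eq with euclidsLemma q (suc i) prh (ℕD.divides (suc j) (trans (sym eq) (ℕP.*-comm p (suc j))))
  ... | inj₁ d = q≢0 (∣⇒≋0 d)
  ... | inj₂ d = contradiction (ℕD.∣⇒≤ d) (ℕP.<⇒≱ (H.i<h⇒suc<p i<))

  -- The floor counts the j with p(j + 1) below q(i + 1). It is at most k, as qh < p(k + 1), so
  -- cutting off at height k loses no point.
  floor-side : ∀ {i} → i ℕ.< h → sgn ((q ℕ.* suc i) ℕ./ p) ≡ ∏ (λ j → side (p ℕ.* suc j) (q ℕ.* suc i)) (upTo k)
  floor-side {i} i< = sym (trans (∏-cong (upTo k) (λ {j} _ → same j))
    (trans (∏-below k F) (cong sgn (ℕP.m≥n⇒m⊓n≡n F≤k))))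
    where
    F = (q ℕ.* suc i) ℕ./ p
    F≤k : F ℕ.≤ k
    F≤k = ℕ.s≤s⁻¹ (ℕDM.m<n*o⇒m/o<n (ℕP.≤-<-trans (ℕP.*-monoʳ-≤ q i<)
      (subst (q ℕ.* h ℕ.<_) (sym (lem h k)) (ℕP.m<m+n (q ℕ.* h) (ℕ.s≤s ℕ.z≤n)))))
      where
      lem : ∀ h k → suc k ℕ.* suc (h ℕ.+ h) ≡ suc (k ℕ.+ k) ℕ.* h ℕ.+ suc (h ℕ.+ k)
      lem = ℕsolve-∀
    same : ∀ j → side (p ℕ.* suc j) (q ℕ.* suc i) ≡ below j F
    same j with (p ℕ.* suc j) ℕ.<? (q ℕ.* suc i) | j ℕ.<? F
    ... | yes _ | yes _ = refl
    ... | no _  | no _  = refl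
    ... | yes a | no b  = contradiction
          (subst (ℕ._≤ F) (ℕDM.m*n/n≡m (suc j) p) (ℕDM./-monoˡ-≤ p (ℕP.≤-trans (ℕP.≤-reflexive (ℕP.*-comm (suc j) p)) (ℕP.<⇒≤ a)))) b
    ... | no a  | yes b = contradiction
          (ℕP.≤∧≢⇒< (ℕP.≤-trans (ℕP.*-monoʳ-≤ p b) (ℕP.≤-trans (ℕP.≤-reflexive (ℕP.*-comm p F)) (ℕDM.m/n*n≤m (q ℕ.* suc i) p))) (lattice-≢ j i<)) a

  leg-side : H.leg (+ q) ≡ ∏ (λ i → ∏ (λ j → side (p ℕ.* suc j) (q ℕ.* suc i)) (upTo k)) (upTo h)
  leg-side = trans (H.leg-odd k q≢0) (∏-cong (upTo h) (λ i∈ → floor-side (∈-upTo⁻ i∈)))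

module _ (h k : ℕ) (prh : Prime (suc (h ℕ.+ h))) (prk : Prime (suc (k ℕ.+ k))) (h≢k : h ≢ k) where

  private
    module H = OddPrime h prh
    module K = OddPrime k prk
    module HK = Reciprocity h k prh prk h≢k
    module KH = Reciprocity k h prk prh (h≢k ∘ sym)
    p = suc (h ℕ.+ h)
    q = suc (k ℕ.+ k)

  -- A lattice point (i + 1, j + 1) of the h × k rectangle lies on exactly one side of the diagonal.
  reciprocity-* : legendre (+ q) p ℤ.* legendre (+ p) q ≡ sgn (k ℕ.* h)
  reciprocity-* = begin
    legendre (+ q) p ℤ.* legendre (+ p) q
      ≡⟨ cong₂ ℤ._*_ HK.leg-side (trans KH.leg-side (∏-swap _ (upTo k) (upTo h))) ⟩
    ∏ (λ i → ∏ (t i) (upTo k)) (upTo h) ℤ.* ∏ (λ i → ∏ (t' i) (upTo k)) (upTo h)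
      ≡⟨ sym (∏-* _ _ (upTo h)) ⟩
    ∏ (λ i → ∏ (t i) (upTo k) ℤ.* ∏ (t' i) (upTo k)) (upTo h)
      ≡⟨ ∏-cong (upTo h) (λ {i} i∈ → trans (sym (∏-* (t i) (t' i) (upTo k)))
           (trans (∏-cong (upTo k) (λ {j} _ → side-antisym _ _ (HK.lattice-≢ j (∈-upTo⁻ i∈)))) (const k))) ⟩
    ∏ (λ _ → sgn k) (upTo h)
      ≡⟨ trans (∏-const (sgn k) (upTo h)) (cong (sgn k ℤ.^_) (length-upTo h)) ⟩
    sgn k ℤ.^ h
      ≡⟨ trans (sgn-^ k h) (cong sgn (ℕP.*-comm h k)) ⟩
    sgn (k ℕ.* h) ∎
    where
    open ≡-Reasoning
    t t' : ℕ → ℕ → ℤ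
    t i j  = side (p ℕ.* suc j) (q ℕ.* suc i)
    t' i j = side (q ℕ.* suc i) (p ℕ.* suc j)
    const : ∀ n → ∏ (λ _ → -[1+ 0 ]) (upTo n) ≡ sgn n
    const n = trans (∏-const -[1+ 0 ] (upTo n)) (trans (cong (-[1+ 0 ] ℤ.^_) (length-upTo n)) (-1^≡sgn n))

  -- The factor (-1)^(kh) equals ((-1)^k/p), so it can be absorbed into the numerator, turning q
  -- into q*.
  reciprocity : legendre (sgn k ℤ.* + q) p ≡ legendre (+ p) q
  reciprocity = begin
    legendre (sgn k ℤ.* + q) p                      ≡⟨ H.leg-* (sgn k) (+ q) ⟩
    H.leg (sgn k) ℤ.* H.leg (+ q)                   ≡⟨ cong (ℤ._* H.leg (+ q)) (trans (H.leg-sgn k) (sym reciprocity-*)) ⟩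
    H.leg (+ q) ℤ.* K.leg (+ p) ℤ.* H.leg (+ q)     ≡⟨ lem (H.leg (+ q)) (K.leg (+ p)) ⟩
    H.leg (+ q) ℤ.* H.leg (+ q) ℤ.* K.leg (+ p)     ≡⟨ cong (ℤ._* K.leg (+ p)) (isSign-² (H.leg-sign (+ q) HK.q≢0)) ⟩
    + 1 ℤ.* K.leg (+ p)                             ≡⟨ ℤP.*-identityˡ _ ⟩
    legendre (+ p) q                                ∎
    where
    open ≡-Reasoning
    lem : ∀ a b → a ℤ.* b ℤ.* a ≡ a ℤ.* a ℤ.* b
    lem = solve-∀

-- Fundamental discriminants and their characters

data Parity : ℕ → Set where
  twice : ∀ k → Parity (k ℕ.+ k)
  1+twice : ∀ k → Parity (suc (k ℕ.+ k))

parity : ∀ n → Parity n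
parity zero    = twice 0
parity (suc n) with parity n
... | twice k = 1+twice k
... | 1+twice k = subst Parity (cong suc (ℕP.+-suc k k)) (twice (suc k))

double%2 : ∀ k → (k ℕ.+ k) ℕ.% 2 ≡ 0
double%2 k = ℕD.n∣m⇒m%n≡0 (k ℕ.+ k) 2 (ℕD.divides k (lem k))
  where
  lem : ∀ k → k ℕ.+ k ≡ k ℕ.* 2
  lem = ℕsolve-∀

IsOddPrime : ℕ → Set
IsOddPrime q = ∃ λ k → q ≡ suc (k ℕ.+ k) × Prime q

prime∤⇒coprime : ∀ {p n} → Prime p → ¬ p ℕD.∣ n → Coprime p n
prime∤⇒coprime pr p∤n (d∣p , d∣n) with ℕPr.prime⇒irreducible pr d∣p
... | inj₁ refl = refl
... | inj₂ refl = contradiction d∣n p∤n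

coprime-*-∣ : ∀ {m n o} → Coprime m n → m ℕD.∣ o → n ℕD.∣ o → m ℕ.* n ℕD.∣ o
coprime-*-∣ {m} {n} c m∣o (ℕD.divides a refl) =
  ℕD.*-monoˡ-∣ n (ℕC.coprime-divisor c (subst (m ℕD.∣_) (ℕP.*-comm a n) m∣o))

prime-divisor-≡ : ∀ {p q} → Prime p → Prime q → p ℕD.∣ q → p ≡ q
prime-divisor-≡ prp prq d with ℕPr.prime⇒irreducible prq d
... | inj₁ refl = contradiction prp ℕPr.¬prime[1]
... | inj₂ e    = e

-- The paper's four cases: D = 1, −4, 8 or −8 times the product of the q* for the odd primes q ∣ D.
data Kind : Set where
  one neg4 pos8 neg8 : Kind

unit : Kind → ℤ
unit one  = + 1
unit neg4 = -[1+ 3 ]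
unit pos8 = + 8
unit neg8 = -[1+ 7 ]

conductor : Kind → ℕ
conductor K = ℤ.∣ unit K ∣

-- Residues are taken mod 8 for every kind, although ε neg4 depends only on z mod 4.
ε-residue : Kind → ℕ → ℤ
ε-residue one  _ = + 1
ε-residue neg4 1 = + 1
ε-residue neg4 3 = -[1+ 0 ]
ε-residue neg4 5 = + 1
ε-residue neg4 7 = -[1+ 0 ]
ε-residue pos8 1 = + 1
ε-residue pos8 3 = -[1+ 0 ]
ε-residue pos8 5 = -[1+ 0 ]
ε-residue pos8 7 = + 1
ε-residue neg8 1 = + 1
ε-residue neg8 3 = + 1
ε-residue neg8 5 = -[1+ 0 ]
ε-residue neg8 7 = -[1+ 0 ]
ε-residue _    _ = + 0

ε : Kind → ℤ → ℤ
ε K z = ε-residue K (z %ℕ 8)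

-- The prime discriminant q*; the exponent is (q - 1)/2 for odd q.
star : ℕ → ℤ
star q = sgn ℕ.⌊ q /2⌋ ℤ.* + q

-- The primes are in the denominators here, so the value depends only on z modulo |D| and makes
-- sense for f(a) whether or not it is prime.
χ : Kind → List ℕ → ℤ → ℤ
χ K qs z = ε K z ℤ.* ∏ (legendre z) qs

ε-cong8 : ∀ K {a b} → a ≋ b [ 8 ] → ε K a ≡ ε K b
ε-cong8 K e = cong (ε-residue K) (≋⇒%ℕ 8 e)

-- The exact period matters: Chinese remaindering splits |D| as the conductor times the odd part, so
-- period 8 would be too coarse for `neg4`.
ε-cong : ∀ K {a b} → a ≋ b [ conductor K ] → ε K a ≡ ε K b
ε-cong one  e = refl
ε-cong neg4 {a} {b} e = begin
  ε-residue neg4 (a %ℕ 8)          ≡⟨ mod4 (n%ℕd<d a 8) ⟩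
  ε-residue neg4 (a %ℕ 8 ℕ.% 4)    ≡⟨ cong (ε-residue neg4) (≋⇒%ℕ {+ (a %ℕ 8)} {+ (b %ℕ 8)} 4
    (≋-trans (≋-∣ (ℕD.divides 2 refl) (%ℕ-≋ a 8)) (≋-trans e (≋-sym (≋-∣ (ℕD.divides 2 refl) (%ℕ-≋ b 8)))))) ⟩
  ε-residue neg4 (b %ℕ 8 ℕ.% 4)    ≡⟨ sym (mod4 (n%ℕd<d b 8)) ⟩
  ε-residue neg4 (b %ℕ 8)          ∎
  where
  open ≡-Reasoning
  mod4 : ∀ {r} → r ℕ.< 8 → ε-residue neg4 r ≡ ε-residue neg4 (r ℕ.% 4)
  mod4 = from-yes (ℕP.allUpTo? (λ r → ε-residue neg4 r ℤ.≟ ε-residue neg4 (r ℕ.% 4)) 8)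
ε-cong pos8 e = ε-cong8 pos8 e
ε-cong neg8 e = ε-cong8 neg8 e

ε-* : ∀ K a b → ε K (a ℤ.* b) ≡ ε K a ℤ.* ε K b
ε-* K a b = begin
  ε K (a ℤ.* b)                                    ≡⟨ ε-cong8 K (≋-* (≋-sym (%ℕ-≋ a 8)) (≋-sym (%ℕ-≋ b 8))) ⟩
  ε K (+ (a %ℕ 8) ℤ.* + (b %ℕ 8))                  ≡⟨ check K (n%ℕd<d a 8) (n%ℕd<d b 8) ⟩
  ε-residue K (a %ℕ 8) ℤ.* ε-residue K (b %ℕ 8)    ∎
  where
  open ≡-Reasoning
  dec : ∀ K → Dec (∀ {r} → r ℕ.< 8 → ∀ {s} → s ℕ.< 8 → ε K (+ r ℤ.* + s) ≡ ε-residue K r ℤ.* ε-residue K s)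
  dec K = ℕP.allUpTo? (λ r → ℕP.allUpTo? (λ s → ε K (+ r ℤ.* + s) ℤ.≟ ε-residue K r ℤ.* ε-residue K s) 8) 8
  -- The decision procedure evaluates only at a concrete kind, hence the split.
  check : ∀ K {r s} → r ℕ.< 8 → s ℕ.< 8 → ε K (+ r ℤ.* + s) ≡ ε-residue K r ℤ.* ε-residue K s
  check one  r< s< = refl
  check neg4 r< s< = from-yes (dec neg4) r< s<
  check pos8 r< s< = from-yes (dec pos8) r< s<
  check neg8 r< s< = from-yes (dec neg8) r< s<

ε-ternary : ∀ K z → IsTernary (ε K z)
ε-ternary K z = check K (n%ℕd<d z 8)
  where
  ternary? : ∀ z → Dec (IsTernary z)
  ternary? (+ 0)                = yes isZero
  ternary? (+ 1)                = yes isOne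
  ternary? (+ suc (suc n))      = no λ ()
  ternary? -[1+ zero ]          = yes isNeg
  ternary? -[1+ suc n ]         = no λ ()
  check : ∀ K {r} → r ℕ.< 8 → IsTernary (ε-residue K r)
  check one  = λ _ → isOne
  check neg4 = from-yes (ℕP.allUpTo? (λ r → ternary? (ε-residue neg4 r)) 8)
  check pos8 = from-yes (ℕP.allUpTo? (λ r → ternary? (ε-residue pos8 r)) 8)
  check neg8 = from-yes (ℕP.allUpTo? (λ r → ternary? (ε-residue neg8 r)) 8)

χ-ternary : ∀ K qs z → IsTernary (χ K qs z)
χ-ternary K qs z = ternary-* (ε-ternary K z) (∏-ternary qs)
  where
  ∏-ternary : ∀ qs → IsTernary (∏ (legendre z) qs)
  ∏-ternary []       = isOne
  ∏-ternary (q ∷ qs) = ternary-* (legendre-ternary z q) (∏-ternary qs)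

χ-cong : ∀ K qs {a b m} → a ≋ b [ m ] → conductor K ℕD.∣ m → (∀ {q} → q ∈ qs → q ℕD.∣ m) →
  χ K qs a ≡ χ K qs b
χ-cong K qs e K∣m qs∣m = cong₂ ℤ._*_ (ε-cong K (≋-∣ K∣m e))
  (∏-cong qs (λ {q} q∈ → legendre-cong q (≋-∣ (qs∣m q∈) e)))

ε-shift : ∀ K h → ε K (+ suc (h ℕ.+ h)) ≡ ε K (+ suc (4 ℕ.+ h ℕ.+ (4 ℕ.+ h)))
ε-shift K h = sym (ε-cong8 K {b = + suc (h ℕ.+ h)} (mk≋ (+ 1) (cong +_ (lem h))))
  where
  lem : ∀ h → suc (4 ℕ.+ h ℕ.+ (4 ℕ.+ h)) ≡ suc (h ℕ.+ h) ℕ.+ 8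
  lem = ℕsolve-∀

-- Raising h by 4 raises 2h + 1 by 8 and preserves both sides, so four initial values suffice.
sgn-ε : ∀ h → sgn h ≡ ε neg4 (+ suc (h ℕ.+ h))
sgn-ε 0 = refl
sgn-ε 1 = refl
sgn-ε 2 = refl
sgn-ε 3 = refl
sgn-ε (suc (suc (suc (suc h)))) = begin
  ℤ.- ℤ.- ℤ.- ℤ.- sgn h                  ≡⟨ lem (sgn h) ⟩
  sgn h                                  ≡⟨ sgn-ε h ⟩
  ε neg4 (+ suc (h ℕ.+ h))               ≡⟨ ε-shift neg4 h ⟩
  ε neg4 (+ suc (4 ℕ.+ h ℕ.+ (4 ℕ.+ h))) ∎
  where
  open ≡-Reasoning
  lem : ∀ x → ℤ.- ℤ.- ℤ.- ℤ.- x ≡ x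
  lem = solve-∀

-- Periodic as well: the four new exponents h + 1, ..., h + 4 have the even sum 4h + 10.
T-ε : ∀ h → ∏ (λ i → sgn (suc i)) (upTo h) ≡ ε pos8 (+ suc (h ℕ.+ h))
T-ε 0 = refl
T-ε 1 = refl
T-ε 2 = refl
T-ε 3 = refl
T-ε (suc (suc (suc (suc h)))) = begin
  ∏ t (upTo (4 ℕ.+ h))                   ≡⟨ split ⟩
  T ℤ.* (ℤ.- x) ℤ.* (ℤ.- ℤ.- x) ℤ.* (ℤ.- ℤ.- ℤ.- x) ℤ.* (ℤ.- ℤ.- ℤ.- ℤ.- x) ≡⟨ lem T x ⟩
  T ℤ.* ((x ℤ.* x) ℤ.* (x ℤ.* x))        ≡⟨ cong (λ z → T ℤ.* (z ℤ.* z)) (isSign-² (isSign-sgn h)) ⟩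
  T ℤ.* + 1                              ≡⟨ ℤP.*-identityʳ T ⟩
  T                                      ≡⟨ T-ε h ⟩
  ε pos8 (+ suc (h ℕ.+ h))               ≡⟨ ε-shift pos8 h ⟩
  ε pos8 (+ suc (4 ℕ.+ h ℕ.+ (4 ℕ.+ h))) ∎
  where
  open ≡-Reasoning
  t : ℕ → ℤ
  t i = sgn (suc i)
  T = ∏ t (upTo h)
  x = sgn h
  split : ∏ t (upTo (4 ℕ.+ h)) ≡ T ℤ.* t h ℤ.* t (1 ℕ.+ h) ℤ.* t (2 ℕ.+ h) ℤ.* t (3 ℕ.+ h)
  split = trans (∏-upTo-suc t (3 ℕ.+ h)) (cong (ℤ._* t (3 ℕ.+ h))
    (trans (∏-upTo-suc t (2 ℕ.+ h)) (cong (ℤ._* t (2 ℕ.+ h))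
    (trans (∏-upTo-suc t (1 ℕ.+ h)) (cong (ℤ._* t (1 ℕ.+ h)) (∏-upTo-suc t h))))))
  lem : ∀ T x → T ℤ.* (ℤ.- x) ℤ.* (ℤ.- ℤ.- x) ℤ.* (ℤ.- ℤ.- ℤ.- x) ℤ.* (ℤ.- ℤ.- ℤ.- ℤ.- x)
    ≡ T ℤ.* ((x ℤ.* x) ℤ.* (x ℤ.* x))
  lem = solve-∀

star-odd : ∀ k → star (suc (k ℕ.+ k)) ≡ sgn k ℤ.* + suc (k ℕ.+ k)
star-odd k = cong (λ z → sgn z ℤ.* + suc (k ℕ.+ k)) (sym (ℕP.n≡⌈n+n/2⌉ k))

module _ (h : ℕ) (pr : Prime (suc (h ℕ.+ h))) where

  private
    module H = OddPrime h pr
    p = suc (h ℕ.+ h)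

  -- Both supplementary laws at once: 4 is a square, 8 = 2·4 and -8 = -1·8, while `ε neg8` is the
  -- product of `ε neg4` and `ε pos8`.
  leg-unit : ∀ K → legendre (unit K) p ≡ ε K (+ p)
  leg-unit one  = H.leg-1
  leg-unit neg4 = trans (H.leg-* -[1+ 0 ] (+ 4)) (trans (cong₂ ℤ._*_ H.leg-neg1
    (trans (H.leg-* (+ 2) (+ 2)) (isSign-² (subst IsSign (sym H.leg-2) H.T-sign))))
    (trans (ℤP.*-identityʳ _) (sgn-ε h)))
  leg-unit pos8 = trans (H.leg-* (+ 2) (+ 4)) (trans (cong (ℤ._*_ (H.leg (+ 2)))
    (trans (H.leg-* (+ 2) (+ 2)) (isSign-² (subst IsSign (sym H.leg-2) H.T-sign))))
    (trans (ℤP.*-identityʳ _) (trans H.leg-2 (T-ε h))))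
  leg-unit neg8 = trans (H.leg-* -[1+ 0 ] (+ 8)) (trans (cong₂ ℤ._*_ (trans H.leg-neg1 (sgn-ε h)) (leg-unit pos8))
    (neg4*pos8 (n%ℕd<d (+ p) 8)))
    where
    neg4*pos8 : ∀ {r} → r ℕ.< 8 → ε-residue neg4 r ℤ.* ε-residue pos8 r ≡ ε-residue neg8 r
    neg4*pos8 = from-yes (ℕP.allUpTo? (λ r → ε-residue neg4 r ℤ.* ε-residue pos8 r ℤ.≟ ε-residue neg8 r) 8)

  leg-∏ : ∀ {B : Set} (g : B → ℤ) l → legendre (∏ g l) p ≡ ∏ (λ x → legendre (g x) p) l
  leg-∏ g []      = H.leg-1
  leg-∏ g (x ∷ l) = trans (H.leg-* (g x) (∏ g l)) (cong (ℤ._*_ (legendre (g x) p)) (leg-∏ g l))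

  leg-star : ∀ {q} → IsOddPrime q → q ≢ p → legendre (star q) p ≡ legendre (+ p) q
  leg-star (k , refl , prk) q≢p = trans (cong (λ z → legendre z p) (star-odd k))
    (reciprocity h k pr prk (λ { refl → q≢p refl }))

  leg-disc : ∀ K qs → (∀ {q} → q ∈ qs → IsOddPrime q) → p ∉ qs →
    legendre (unit K ℤ.* ∏ star qs) p ≡ χ K qs (+ p)
  leg-disc K qs odd p∉ = trans (H.leg-* (unit K) (∏ star qs)) (cong₂ ℤ._*_ (leg-unit K)
    (trans (leg-∏ star qs) (∏-cong qs (λ q∈ → leg-star (odd q∈) (λ { refl → p∉ q∈ })))))

  ¬2∣p : ¬ p ℕD.∣ 2
  ¬2∣p d = ℕP.<⇒≱ H.p>2 (ℕD.∣⇒≤ d)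

  4⊥p : Coprime 4 p
  4⊥p = ℕC.sym (prime∤⇒coprime pr (λ d → [ ¬2∣p , ¬2∣p ]′ (euclidsLemma 2 2 pr d)))

  -- `Inert` concerns squares modulo 4p, the Legendre symbol only p. The factor 4 imposes nothing
  -- further, because D ≡ 0 or 1 is a square modulo 4 and 4 is coprime to p.
  inert-odd : ∀ D → D ≋ + 0 [ 4 ] ⊎ D ≋ + 1 [ 4 ] → Inert D p ⇔ legendre D p ≡ -[1+ 0 ]
  inert-odd D D≋ = mk⇔ to from
    where
    to : Inert D p → legendre D p ≡ -[1+ 0 ]
    to (p∤D , nonsq) with legendre D p | legendre-view D (h ℕ.+ h)
    ... | _ | divisible z    = contradiction (%ℕ0⇒∣ D p z) p∤D
    ... | _ | nonresidue _ _ = refl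
    ... | _ | residue _ y r  = ⊥-elim (adjust D≋ (parity y))
      where
      y²≋D : + y ℤ.* + y ≋ D [ p ]
      y²≋D = ≋-trans (≋-reflexive (sym (ℤP.pos-* y y))) (%ℕ⇒≋ p r)
      y+p≋y : + (y ℕ.+ p) ≋ + y [ p ]
      y+p≋y = mk≋ (+ 1) (cong (ℤ._+_ (+ y)) (sym (ℤP.*-identityˡ (+ p))))
      -- Of y and y + p one has the parity of D, which makes it a square root of D mod 4 too.
      solution : ∀ x → + x ≋ + y [ p ] → + x ℤ.* + x ≋ D [ 4 ] → ⊥
      solution x e e4 = nonsq (+ x , coprime-*-∣ 4⊥p (≋⇒∣ e4) (≋⇒∣ (≋-trans (≋-* e e) y²≋D)))
      even² : ∀ k → + (k ℕ.+ k) ℤ.* + (k ℕ.+ k) ≋ + 0 [ 4 ]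
      even² k = mk≋ (+ k ℤ.* + k) (lem (+ k))
        where
        lem : ∀ k → (k ℤ.+ k) ℤ.* (k ℤ.+ k) ≡ + 0 ℤ.+ k ℤ.* k ℤ.* + 4
        lem = solve-∀
      odd² : ∀ k → + suc (k ℕ.+ k) ℤ.* + suc (k ℕ.+ k) ≋ + 1 [ 4 ]
      odd² k = mk≋ (+ k ℤ.* + k ℤ.+ + k) (lem (+ k))
        where
        lem : ∀ k → (+ 1 ℤ.+ (k ℤ.+ k)) ℤ.* (+ 1 ℤ.+ (k ℤ.+ k)) ≡ + 1 ℤ.+ (k ℤ.* k ℤ.+ k) ℤ.* + 4
        lem = solve-∀
      odd+odd : ∀ k → (k ℕ.+ h ℕ.+ 1) ℕ.+ (k ℕ.+ h ℕ.+ 1) ≡ suc (k ℕ.+ k) ℕ.+ p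
      odd+odd k = lem k h
        where
        lem : ∀ k h → (k ℕ.+ h ℕ.+ 1) ℕ.+ (k ℕ.+ h ℕ.+ 1) ≡ suc (k ℕ.+ k) ℕ.+ suc (h ℕ.+ h)
        lem = ℕsolve-∀
      even+odd : ∀ k → suc ((k ℕ.+ h) ℕ.+ (k ℕ.+ h)) ≡ (k ℕ.+ k) ℕ.+ p
      even+odd k = lem k h
        where
        lem : ∀ k h → suc ((k ℕ.+ h) ℕ.+ (k ℕ.+ h)) ≡ (k ℕ.+ k) ℕ.+ suc (h ℕ.+ h)
        lem = ℕsolve-∀
      adjust : D ≋ + 0 [ 4 ] ⊎ D ≋ + 1 [ 4 ] → Parity y → ⊥
      adjust (inj₁ e) (twice k) = solution y ≋-refl (≋-trans (even² k) (≋-sym e))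
      adjust (inj₁ e) (1+twice k)  = solution (y ℕ.+ p) y+p≋y
        (≋-trans (subst (λ z → + z ℤ.* + z ≋ + 0 [ 4 ]) (odd+odd k) (even² (k ℕ.+ h ℕ.+ 1))) (≋-sym e))
      adjust (inj₂ e) (twice k) = solution (y ℕ.+ p) y+p≋y
        (≋-trans (subst (λ z → + z ℤ.* + z ≋ + 1 [ 4 ]) (even+odd k) (odd² (k ℕ.+ h))) (≋-sym e))
      adjust (inj₂ e) (1+twice k)  = solution y ≋-refl (≋-trans (odd² k) (≋-sym e))
    from : legendre D p ≡ -[1+ 0 ] → Inert D p
    from eq with legendre D p | legendre-view D (h ℕ.+ h)
    ... | _ | divisible z    = case eq of λ ()
    ... | _ | residue _ _ _  = case eq of λ ()
    ... | _ | nonresidue z n = (λ d → z (∣⇒%ℕ0 D p d)) , λ { (x , d) →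
          n (x %ℕ p) (n%ℕd<d x p) (≋⇒%ℕ {+ (x %ℕ p ℕ.* (x %ℕ p))} {D} p
            (≋-trans (≋-reflexive (ℤP.pos-* (x %ℕ p) (x %ℕ p)))
              (≋-trans (≋-* (%ℕ-≋ x p) (%ℕ-≋ x p)) (≋-∣ (ℕD.n∣m*n 4) (∣⇒≋ {x ℤ.* x} {D} {4 ℕ.* p} d))))) }

star-mod4 : ∀ {q} → IsOddPrime q → star q ≋ + 1 [ 4 ]
star-mod4 (k , refl , _) = ≋-trans (≋-reflexive (star-odd k)) (residue1 k)
  where
  residue1 : ∀ k → sgn k ℤ.* + suc (k ℕ.+ k) ≋ + 1 [ 4 ]
  residue1 k with parity k
  ... | twice j = mk≋ (+ j) (trans (cong (ℤ._* + suc (j ℕ.+ j ℕ.+ (j ℕ.+ j))) (sgn-double j)) (lem (+ j)))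
    where
    lem : ∀ j → + 1 ℤ.* (+ 1 ℤ.+ (j ℤ.+ j ℤ.+ (j ℤ.+ j))) ≡ + 1 ℤ.+ j ℤ.* + 4
    lem = solve-∀
  -- -(4j + 3) = 1 - 4(j + 1).
  ... | 1+twice j  = mk≋ (ℤ.- (+ j ℤ.+ + 1)) (trans
      (cong₂ (λ x y → ℤ.- x ℤ.* + y) (sgn-double j) (swap j)) (lem (+ j)))
    where
    swap : ∀ j → suc (suc (j ℕ.+ j) ℕ.+ suc (j ℕ.+ j)) ≡ 3 ℕ.+ (j ℕ.+ j ℕ.+ (j ℕ.+ j))
    swap = ℕsolve-∀
    lem : ∀ j → -[1+ 0 ] ℤ.* (+ 3 ℤ.+ (j ℤ.+ j ℤ.+ (j ℤ.+ j))) ≡ + 1 ℤ.+ ℤ.- (j ℤ.+ + 1) ℤ.* + 4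
    lem = solve-∀

∏-star-mod4 : ∀ qs → (∀ {q} → q ∈ qs → IsOddPrime q) → ∏ star qs ≋ + 1 [ 4 ]
∏-star-mod4 qs odd = ≋-trans (≋-∏ qs (λ q∈ → star-mod4 (odd q∈))) (≋-reflexive (∏-1 qs))

abs-sign-* : ∀ {x} y → IsSign x → ℤ.∣ x ℤ.* y ∣ ≡ ℤ.∣ y ∣
abs-sign-* y (inj₁ refl) = cong ℤ.∣_∣ (ℤP.*-identityˡ y)
abs-sign-* y (inj₂ refl) = trans (cong ℤ.∣_∣ (ℤP.-1*i≡-i y)) (ℤP.∣-i∣≡∣i∣ y)

abs-∏-star : ∀ qs → ℤ.∣ ∏ star qs ∣ ≡ product qs
abs-∏-star []       = refl
abs-∏-star (q ∷ qs) = trans (ℤP.abs-* (star q) (∏ star qs))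
  (cong₂ ℕ._*_ (abs-sign-* (+ q) (isSign-sgn ℕ.⌊ q /2⌋)) (abs-∏-star qs))

ε-pos8-star : ∀ {q} → IsOddPrime q → ε pos8 (star q) ≡ legendre (+ 2) q
ε-pos8-star (k , refl , pr) = begin
  ε pos8 (star q)                        ≡⟨ cong (ε pos8) (star-odd k) ⟩
  ε pos8 (sgn k ℤ.* + q)                 ≡⟨ ε-* pos8 (sgn k) (+ q) ⟩
  ε pos8 (sgn k) ℤ.* ε pos8 (+ q)        ≡⟨ cong (ℤ._* ε pos8 (+ q)) (ε-sign (isSign-sgn k)) ⟩
  + 1 ℤ.* ε pos8 (+ q)                   ≡⟨ ℤP.*-identityˡ _ ⟩
  ε pos8 (+ q)                           ≡⟨ sym (T-ε k) ⟩
  OddPrime.T k pr                        ≡⟨ sym (OddPrime.leg-2 k pr) ⟩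
  legendre (+ 2) q                       ∎
  where
  open ≡-Reasoning
  q = suc (k ℕ.+ k)
  ε-sign : ∀ {x} → IsSign x → ε pos8 x ≡ + 1
  ε-sign (inj₁ refl) = refl
  ε-sign (inj₂ refl) = refl

-- Needed for p = 2, which lies outside reciprocity for odd primes: for odd D it compares D modulo 8
-- with χ(2).
χ-2 : ∀ qs → (∀ {q} → q ∈ qs → IsOddPrime q) → ε pos8 (∏ star qs) ≡ ∏ (legendre (+ 2)) qs
χ-2 []       odd = refl
χ-2 (q ∷ qs) odd = trans (ε-* pos8 (star q) (∏ star qs))
  (cong₂ ℤ._*_ (ε-pos8-star (odd (here refl))) (χ-2 qs (odd ∘ there)))

-- Here 4p = 8. The only possible residues of D modulo 8 are 1, which is a square, and 5, which is
-- not.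
inert-2 : ∀ D → D ≋ + 1 [ 4 ] → Inert D 2 ⇔ ε pos8 D ≡ -[1+ 0 ]
inert-2 D D≋1 with residue8 (n%ℕd<d D 8) (trans (≋⇒%ℕ 4 (≋-∣ (ℕD.divides 2 refl) (%ℕ-≋ D 8))) (≋⇒%ℕ 4 D≋1))
  where
  residue8 : ∀ {r} → r ℕ.< 8 → r ℕ.% 4 ≡ 1 → r ≡ 1 ⊎ r ≡ 5
  residue8 = from-yes (ℕP.allUpTo? (λ r → (r ℕ.% 4 ℕ.≟ 1) →-dec ((r ℕ.≟ 1) ⊎-dec (r ℕ.≟ 5))) 8)
... | inj₁ e = mk⇔ (λ (_ , n) → contradiction (+ 1 , ≋⇒∣ {+ 1 ℤ.* + 1} {D} (≋-sym (%ℕ⇒≋ 8 e))) n)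
                   (λ q → case trans (sym (cong (ε-residue pos8) e)) q of λ ())
... | inj₂ e = mk⇔ (λ _ → cong (ε-residue pos8) e) λ _ → odd , nonsquare
  where
  odd : ¬ (2 ℕD.∣ ℤ.∣ D ∣)
  odd d = case trans (sym (≋⇒%ℕ 2 (≋-∣ (ℕD.divides 2 refl) D≋1))) (∣⇒%ℕ0 D 2 d) of λ ()
  squares : ∀ {r} → r ℕ.< 8 → (r ℕ.* r) ℕ.% 8 ≢ 5
  squares = from-yes (ℕP.allUpTo? (λ r → ¬? ((r ℕ.* r) ℕ.% 8 ℕ.≟ 5)) 8)
  nonsquare : ¬ (∃ λ x → + 8 ℤD.∣ (x ℤ.* x ℤ.- D))
  nonsquare (x , d) = squares (n%ℕd<d x 8) (trans
    (≋⇒%ℕ {+ (x %ℕ 8 ℕ.* (x %ℕ 8))} {D} 8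
      (≋-trans (≋-reflexive (ℤP.pos-* (x %ℕ 8) (x %ℕ 8)))
        (≋-trans (≋-* (%ℕ-≋ x 8) (%ℕ-≋ x 8)) (∣⇒≋ {x ℤ.* x} {D} d)))) e)

∈-primeDivisors⁻ : ∀ {n q} → q ∈ primeDivisors n → Prime q × q ℕD.∣ n
∈-primeDivisors⁻ {n} q∈ = proj₂ (∈-filter⁻ (λ p → prime? p ×-dec p ℕD.∣? n) {xs = upTo (suc n)} q∈)

∈-primeDivisors⁺ : ∀ {n q} .{{_ : ℕ.NonZero n}} → Prime q → q ℕD.∣ n → q ∈ primeDivisors n
∈-primeDivisors⁺ {n} pr d = ∈-filter⁺ (λ p → prime? p ×-dec p ℕD.∣? n) (∈-upTo⁺ (ℕ.s≤s (ℕD.∣⇒≤ d))) (pr , d)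

primeDivisors-unique : ∀ n → Unique (primeDivisors n)
primeDivisors-unique n = UniqueP.filter⁺ (λ p → prime? p ×-dec p ℕD.∣? n) (UniqueP.upTo⁺ (suc n))

¬2∣odd : ∀ {n} → n ℕ.% 2 ≡ 1 → ¬ 2 ℕD.∣ n
¬2∣odd {n} o d = case trans (sym o) (ℕD.n∣m⇒m%n≡0 n 2 d) of λ ()

primeDivisors-odd : ∀ {n q} → n ℕ.% 2 ≡ 1 → q ∈ primeDivisors n → IsOddPrime q
primeDivisors-odd {n} {q} n-odd q∈ with ∈-primeDivisors⁻ {n} q∈ | parity q
... | pr , _ | 1+twice k = k , refl , pr
... | _ , d  | twice k   = contradiction (ℕD.∣-trans (ℕD.m%n≡0⇒n∣m _ 2 (double%2 k)) d) (¬2∣odd n-odd)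

squarefree⇒unique : ∀ ps → All Prime ps → (∀ p → Prime p → ¬ p ℕ.* p ℕD.∣ product ps) → Unique ps
squarefree⇒unique []       _          sf = []
squarefree⇒unique (p ∷ ps) (pr ∷ prs) sf =
  All.tabulate (λ { {q} q∈ refl → sf p pr (ℕD.*-monoʳ-∣ p (∈⇒∣product q∈)) })
  ∷ squarefree⇒unique ps prs (λ q prq d → sf q prq (ℕD.∣n⇒∣m*n p d))

-- A squarefree number has a factorisation without repetition, which is therefore a permutation of
-- the list of its prime divisors.
product-primeDivisors : ∀ n .{{_ : ℕ.NonZero n}} → (∀ p → Prime p → ¬ p ℕ.* p ℕD.∣ n) →
  product (primeDivisors n) ≡ n
product-primeDivisors n sf with factorise n
... | record { factors = ps ; isFactorisation = eq ; factorsPrime = prs } =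
  trans (sym (product-↭ perm)) (sym eq)
  where
  ps-unique : Unique ps
  ps-unique = squarefree⇒unique ps prs (λ p pr d → sf p pr (subst (p ℕ.* p ℕD.∣_) (sym eq) d))
  perm : ps ↭ primeDivisors n
  perm = unique-⊆-↭ ps-unique
    (λ p∈ → ∈-primeDivisors⁺ (All.lookup prs p∈) (subst (_ ℕD.∣_) (sym eq) (∈⇒∣product p∈)))
    (unique-⊆-length (primeDivisors-unique n) λ q∈ → let pr , d = ∈-primeDivisors⁻ {n} q∈ in
      factorisationHasAllPrimeFactors pr (subst (_ ℕD.∣_) eq d) prs)

-- `n` is the odd part of |D|. Taking the primes from `primeDivisors n` gives the same list over
-- which `a-prod` multiplies.
record Disc (D : ℤ) : Set where
  field
    K      : Kind
    n      : ℕ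
    n-odd  : n ℕ.% 2 ≡ 1
    D≡     : D ≡ unit K ℤ.* ∏ star (primeDivisors n)
    ∏qs≡n  : product (primeDivisors n) ≡ n

  qs : List ℕ
  qs = primeDivisors n

  qs-odd : ∀ {q} → q ∈ qs → IsOddPrime q
  qs-odd = primeDivisors-odd {n} n-odd

  ∣D∣≡ : ℤ.∣ D ∣ ≡ conductor K ℕ.* n
  ∣D∣≡ = trans (cong ℤ.∣_∣ D≡) (trans (ℤP.abs-* (unit K) (∏ star qs))
    (cong (conductor K ℕ.*_) (trans (abs-∏-star qs) ∏qs≡n)))

  conductor∣D : conductor K ℕD.∣ ℤ.∣ D ∣
  conductor∣D = ℕD.divides n (trans ∣D∣≡ (ℕP.*-comm (conductor K) n))

  n∣D : n ℕD.∣ ℤ.∣ D ∣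
  n∣D = ℕD.divides (conductor K) ∣D∣≡

  q∣D : ∀ {q} → q ∈ qs → q ℕD.∣ ℤ.∣ D ∣
  q∣D q∈ = ℕD.∣-trans (proj₂ (∈-primeDivisors⁻ {n} q∈)) n∣D

same-abs : ∀ {x y} → ℤ.∣ x ∣ ≡ ℤ.∣ y ∣ → x ≡ y ⊎ x ≡ ℤ.- y
same-abs {x} {y} e with ℤP.+∣i∣≡i⊎+∣i∣≡-i x | ℤP.+∣i∣≡i⊎+∣i∣≡-i y
... | inj₁ p | inj₁ q = inj₁ (trans (sym p) (trans (cong +_ e) q))
... | inj₁ p | inj₂ q = inj₂ (trans (sym p) (trans (cong +_ e) q))
... | inj₂ p | inj₁ q = inj₂ (trans (sym (ℤP.neg-involutive x)) (cong ℤ.-_ (trans (sym p) (trans (cong +_ e) q))))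
... | inj₂ p | inj₂ q = inj₁ (ℤP.neg-injective (trans (sym p) (trans (cong +_ e) q)))

abs%2 : ∀ z → ℤ.∣ z ∣ ℕ.% 2 ≡ z %ℕ 2
abs%2 z with ℤP.+∣i∣≡i⊎+∣i∣≡-i z
... | inj₁ p = cong (_%ℕ 2) p
... | inj₂ p = trans (cong (_%ℕ 2) p) (≋⇒%ℕ { ℤ.- z } {z} 2 (mk≋ (ℤ.- z) (lem z)))
  where
  lem : ∀ z → ℤ.- z ≡ z ℤ.+ ℤ.- z ℤ.* + 2
  lem = solve-∀

-- |m| is the product of its primes, so m = ±∏ q*. Since that product is 1 modulo 4, the residue of
-- m modulo 4 decides the sign.
module OddSquarefree (m : ℤ) (m-odd : m %ℕ 2 ≡ 1) (sf : SquarefreeℤD m) where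

  n : ℕ
  n = ℤ.∣ m ∣

  n-odd : n ℕ.% 2 ≡ 1
  n-odd = trans (abs%2 m) m-odd

  n≢0 : n ≢ 0
  n≢0 e = case trans (sym (cong (ℕ._% 2) e)) n-odd of λ ()

  ∏qs≡n : product (primeDivisors n) ≡ n
  ∏qs≡n = product-primeDivisors n {{ℕ.≢-nonZero n≢0}} sf

  S : ℤ
  S = ∏ star (primeDivisors n)

  S≋1 : S ≋ + 1 [ 4 ]
  S≋1 = ∏-star-mod4 (primeDivisors n) (primeDivisors-odd {n} n-odd)

  ±S : m ≡ S ⊎ m ≡ ℤ.- S
  ±S = same-abs (sym (trans (abs-∏-star (primeDivisors n)) ∏qs≡n))

  +S : m %ℕ 4 ≡ 1 → m ≡ S
  +S e with ±S
  ... | inj₁ p = p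
  ... | inj₂ p = case trans (sym e) (≋⇒%ℕ 4 (≋-trans (≋-reflexive p) (≋-neg S≋1))) of λ ()

  -S : m %ℕ 4 ≡ 3 → m ≡ ℤ.- S
  -S e with ±S
  ... | inj₂ p = p
  ... | inj₁ p = case trans (sym e) (≋⇒%ℕ 4 (≋-trans (≋-reflexive p) S≋1)) of λ ()

mod4⇒mod2 : ∀ {z r} → z %ℕ 4 ≡ r → z %ℕ 2 ≡ r ℕ.% 2
mod4⇒mod2 {z} refl = sym (≋⇒%ℕ {+ (z %ℕ 4)} {z} 2 (≋-∣ (ℕD.divides 2 refl) (%ℕ-≋ z 4)))

classify : ∀ {D} → FundamentalDiscriminant D → Disc D
classify {D} (_ , inj₁ (D%4 , sf)) = record
  { K = one ; n = O.n ; n-odd = O.n-odd ; ∏qs≡n = O.∏qs≡n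
  ; D≡ = trans (O.+S D%4) (sym (ℤP.*-identityˡ O.S)) }
  where module O = OddSquarefree D (mod4⇒mod2 {D} D%4) sf
classify {D} (_ , inj₂ (m , D≡4m , inj₂ m%4 , sf)) = record
  { K = neg4 ; n = O.n ; n-odd = O.n-odd ; ∏qs≡n = O.∏qs≡n
  ; D≡ = trans D≡4m (trans (cong (+ 4 ℤ.*_) (O.-S m%4)) (lem O.S)) }
  where
  module O = OddSquarefree m (mod4⇒mod2 {m} m%4) sf
  lem : ∀ s → + 4 ℤ.* ℤ.- s ≡ -[1+ 3 ] ℤ.* s
  lem = solve-∀
-- Here m = 2m' with m' odd and squarefree, so D = 8m', and m' modulo 4 decides between 8 and -8.
classify {D} (_ , inj₂ (m , D≡4m , inj₁ m%4 , sf)) with %ℕ⇒≋ {m} {+ 2} 4 m%4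
... | mk≋ k m≡ = go (odd-residue (n%ℕd<d m' 4) (trans (sym (mod4⇒mod2 {m'} refl)) m'-odd))
  where
  m' : ℤ
  m' = + 1 ℤ.+ k ℤ.* + 2
  m≡2m' : m ≡ + 2 ℤ.* m'
  m≡2m' = trans m≡ (lem k)
    where
    lem : ∀ k → + 2 ℤ.+ k ℤ.* + 4 ≡ + 2 ℤ.* (+ 1 ℤ.+ k ℤ.* + 2)
    lem = solve-∀
  m'-odd : m' %ℕ 2 ≡ 1
  m'-odd = ≋⇒%ℕ {m'} {+ 1} 2 (mk≋ k refl)
  sf' : SquarefreeℤD m'
  sf' p pr d = sf p pr (ℕD.∣-trans d (ℕD.divides 2 (trans (cong ℤ.∣_∣ m≡2m') (ℤP.abs-* (+ 2) m'))))
  module O = OddSquarefree m' m'-odd sf'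
  odd-residue : ∀ {r} → r ℕ.< 4 → r ℕ.% 2 ≡ 1 → r ≡ 1 ⊎ r ≡ 3
  odd-residue = from-yes (ℕP.allUpTo? (λ r → (r ℕ.% 2 ℕ.≟ 1) →-dec ((r ℕ.≟ 1) ⊎-dec (r ℕ.≟ 3))) 4)
  D≡8m' : D ≡ + 8 ℤ.* m'
  D≡8m' = trans D≡4m (trans (cong (+ 4 ℤ.*_) m≡2m') (sym (ℤP.*-assoc (+ 4) (+ 2) m')))
  lem : ∀ s → + 8 ℤ.* ℤ.- s ≡ -[1+ 7 ] ℤ.* s
  lem = solve-∀
  go : m' %ℕ 4 ≡ 1 ⊎ m' %ℕ 4 ≡ 3 → Disc D
  go (inj₁ e) = record { K = pos8 ; n = O.n ; n-odd = O.n-odd ; ∏qs≡n = O.∏qs≡n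
    ; D≡ = trans D≡8m' (cong (+ 8 ℤ.*_) (O.+S e)) }
  go (inj₂ e) = record { K = neg8 ; n = O.n ; n-odd = O.n-odd ; ∏qs≡n = O.∏qs≡n
    ; D≡ = trans D≡8m' (trans (cong (+ 8 ℤ.*_) (O.-S e)) (lem O.S)) }

module Discriminant {D : ℤ} (disc : Disc D) where

  open Disc disc

  S : ℤ
  S = ∏ star qs

  S≋1 : S ≋ + 1 [ 4 ]
  S≋1 = ∏-star-mod4 qs qs-odd

  D-mod4 : D ≋ + 0 [ 4 ] ⊎ D ≋ + 1 [ 4 ]
  D-mod4 = subst (λ z → z ≋ + 0 [ 4 ] ⊎ z ≋ + 1 [ 4 ]) (sym D≡) (unit-mod4 K)
    where
    unit-mod4 : ∀ K → unit K ℤ.* S ≋ + 0 [ 4 ] ⊎ unit K ℤ.* S ≋ + 1 [ 4 ]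
    unit-mod4 one  = inj₂ (≋-* (≋-refl {+ 1}) S≋1)
    unit-mod4 neg4 = inj₁ (∣⇒≋0 (subst (4 ℕD.∣_) (sym (ℤP.abs-* -[1+ 3 ] S)) (ℕD.m∣m*n ℤ.∣ S ∣)))
    unit-mod4 pos8 = inj₁ (∣⇒≋0 (subst (4 ℕD.∣_) (sym (ℤP.abs-* (+ 8) S)) (ℕD.∣m⇒∣m*n ℤ.∣ S ∣ (ℕD.divides 2 refl))))
    unit-mod4 neg8 = inj₁ (∣⇒≋0 (subst (4 ℕD.∣_) (sym (ℤP.abs-* -[1+ 7 ] S)) (ℕD.∣m⇒∣m*n ℤ.∣ S ∣ (ℕD.divides 2 refl))))

  inert⇔χ : ∀ {p} → Prime p → ¬ p ℕD.∣ ℤ.∣ D ∣ → Inert D p ⇔ χ K qs (+ p) ≡ -[1+ 0 ]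
  inert⇔χ {p} pr p∤D with parity p
  ... | 1+twice h = subst (λ z → Inert D p ⇔ z ≡ -[1+ 0 ])
        (trans (cong (λ z → legendre z p) D≡) (leg-disc h pr K qs qs-odd (p∤D ∘ q∣D)))
        (inert-odd h pr D D-mod4)
  -- An even prime is 2; as it does not divide D, the conductor must be 1.
  ... | twice k = subst (λ p → Inert D p ⇔ χ K qs (+ p) ≡ -[1+ 0 ]) 2≡p (at-2 K D≡ 2∤conductor)
    where
    2≡p : 2 ≡ k ℕ.+ k
    2≡p = prime-divisor-≡ ℕPr.prime[2] pr (ℕD.m%n≡0⇒n∣m (k ℕ.+ k) 2 (double%2 k))
    2∤conductor : ¬ 2 ℕD.∣ conductor K
    2∤conductor d = p∤D (subst (ℕD._∣ ℤ.∣ D ∣) 2≡p (ℕD.∣-trans d conductor∣D))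
    at-2 : ∀ K → D ≡ unit K ℤ.* S → ¬ 2 ℕD.∣ conductor K → Inert D 2 ⇔ χ K qs (+ 2) ≡ -[1+ 0 ]
    at-2 one  e _ = subst (λ z → Inert D 2 ⇔ z ≡ -[1+ 0 ])
      (trans (cong (ε pos8) D≡S) (trans (χ-2 qs qs-odd) (sym (ℤP.*-identityˡ (∏ (legendre (+ 2)) qs)))))
      (inert-2 D (≋-trans (≋-reflexive D≡S) S≋1))
      where
      D≡S : D ≡ S
      D≡S = trans e (ℤP.*-identityˡ S)
    at-2 neg4 _ n = contradiction (ℕD.divides 2 refl) n
    at-2 pos8 _ n = contradiction (ℕD.divides 4 refl) n
    at-2 neg8 _ n = contradiction (ℕD.divides 4 refl) n

-- Chinese remaindering of sums

Periodic : ℕ → (ℕ → ℤ) → Set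
Periodic m g = ∀ {a b} → + a ≋ + b [ m ] → g a ≡ g b

periodic-* : ∀ {m g h} → Periodic m g → Periodic m h → Periodic m (λ a → g a ℤ.* h a)
periodic-* pg ph e = cong₂ ℤ._*_ (pg e) (ph e)

periodic-∣ : ∀ {m n g} → m ℕD.∣ n → Periodic m g → Periodic n g
periodic-∣ d pg e = pg (≋-∣ d e)

periodic-∏ : ∀ {B : Set} {m} {g : B → ℕ → ℤ} (l : List B) → (∀ {x} → x ∈ l → Periodic m (g x)) →
  Periodic m (λ a → ∏ (λ x → g x a) l)
periodic-∏ l pg e = ∏-cong l (λ x∈ → pg x∈ e)

+*-≋ : ∀ a b m → + (a ℕ.+ b ℕ.* m) ≋ + a [ m ]
+*-≋ a b m = mk≋ (+ b) (cong (ℤ._+_ (+ a)) (ℤP.pos-* b m))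

∑-periodic : ∀ {m g} → Periodic m g → ∀ n → ∑ g (upTo (n ℕ.* m)) ≡ + n ℤ.* ∑ g (upTo m)
∑-periodic {m} {g} pg n = begin
  ∑ g (upTo (n ℕ.* m))                                         ≡⟨ ∑-upTo-* g m n ⟩
  ∑ (λ b → ∑ (λ a → g (a ℕ.+ b ℕ.* m)) (upTo m)) (upTo n)      ≡⟨ ∑-cong (upTo n) (λ {b} _ → ∑-cong (upTo m) (λ {a} _ → pg (+*-≋ a b m))) ⟩
  ∑ (λ b → ∑ g (upTo m)) (upTo n)                              ≡⟨ ∑-const (∑ g (upTo m)) (upTo n) ⟩
  + length (upTo n) ℤ.* ∑ g (upTo m)                           ≡⟨ cong (λ z → + z ℤ.* ∑ g (upTo m)) (length-upTo n) ⟩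
  + n ℤ.* ∑ g (upTo m)                                         ∎
  where open ≡-Reasoning

≋-*-cancel-coprime : ∀ {a b m n} → Coprime n m → a ℤ.* + m ≋ b ℤ.* + m [ n ] → a ≋ b [ n ]
≋-*-cancel-coprime {a} {b} {m} {n} c e = ∣⇒≋ (ℕC.coprime-divisor c (subst (n ℕD.∣_)
  (trans (cong ℤ.∣_∣ (lem a b (+ m))) (trans (ℤP.abs-* (a ℤ.- b) (+ m)) (ℕP.*-comm ℤ.∣ a ℤ.- b ∣ m))) (≋⇒∣ e)))
  where
  lem : ∀ a b m → a ℤ.* m ℤ.- b ℤ.* m ≡ (a ℤ.- b) ℤ.* m
  lem = solve-∀

-- In the index a + bm, `g` sees only a. For fixed a the residues of a + bm modulo n run through all
-- classes, because m is invertible modulo n; no explicit Chinese remainder map is needed.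
∑-crt : ∀ {m n g h} .{{_ : ℕ.NonZero n}} → Coprime n m → Periodic m g → Periodic n h →
  ∑ (λ a → g a ℤ.* h a) (upTo (n ℕ.* m)) ≡ ∑ g (upTo m) ℤ.* ∑ h (upTo n)
∑-crt {m} {n} {g} {h} c pg ph = begin
  ∑ (λ a → g a ℤ.* h a) (upTo (n ℕ.* m))
    ≡⟨ ∑-upTo-* _ m n ⟩
  ∑ (λ b → ∑ (λ a → g (a ℕ.+ b ℕ.* m) ℤ.* h (a ℕ.+ b ℕ.* m)) (upTo m)) (upTo n)
    ≡⟨ ∑-swap _ (upTo n) (upTo m) ⟩
  ∑ (λ a → ∑ (λ b → g (a ℕ.+ b ℕ.* m) ℤ.* h (a ℕ.+ b ℕ.* m)) (upTo n)) (upTo m)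
    ≡⟨ ∑-cong (upTo m) (λ {a} _ → trans
         (∑-cong (upTo n) (λ {b} _ → cong₂ ℤ._*_ (pg (+*-≋ a b m)) (ph (≋-sym (%ℕ-≋ (+ (a ℕ.+ b ℕ.* m)) n)))))
         (trans (∑-*ˡ (g a) _ (upTo n)) (trans (cong (ℤ._*_ (g a)) (permute a)) (ℤP.*-comm (g a) _)))) ⟩
  ∑ (λ a → ∑ h (upTo n) ℤ.* g a) (upTo m)
    ≡⟨ trans (∑-*ˡ (∑ h (upTo n)) g (upTo m)) (ℤP.*-comm (∑ h (upTo n)) (∑ g (upTo m))) ⟩
  ∑ g (upTo m) ℤ.* ∑ h (upTo n) ∎
  where
  open ≡-Reasoning
  permute : ∀ a → ∑ (λ b → h ((a ℕ.+ b ℕ.* m) ℕ.% n)) (upTo n) ≡ ∑ h (upTo n)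
  permute a = ∑-perm h n (λ b → (a ℕ.+ b ℕ.* m) ℕ.% n) (λ {b} _ → ℕDM.m%n<n (a ℕ.+ b ℕ.* m) n)
    λ {b} {b'} b< b'< e → ≋-small-ℕ (≋-*-cancel-coprime c
      (subst₂ (_≋_[ n ]) (ℤP.pos-* b m) (ℤP.pos-* b' m)
        (≋-+-cancelˡ (+ a) (%ℕ⇒≋ {+ (a ℕ.+ b ℕ.* m)} {+ (a ℕ.+ b' ℕ.* m)} n e)))) b< b'<

-- `t` carries the part at 2. The local functions are arbitrary because the lemma is applied both to
-- χ and to χ².
∑-crt-∏ : ∀ t (e : ℕ → ℤ) (g : ℕ → ℕ → ℤ) qs → Unique qs → All Prime qs → All (λ q → ¬ q ℕD.∣ t) qs →
  Periodic t e → (∀ q → Periodic q (g q)) →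
  ∑ (λ a → e a ℤ.* ∏ (λ q → g q a) qs) (upTo (product qs ℕ.* t)) ≡ ∑ e (upTo t) ℤ.* ∏ (λ q → ∑ (g q) (upTo q)) qs
∑-crt-∏ t e g []       _        _          _        pe pg = begin
  ∑ (λ a → e a ℤ.* + 1) (upTo (1 ℕ.* t))   ≡⟨ ∑-cong (upTo (1 ℕ.* t)) (λ {a} _ → ℤP.*-identityʳ (e a)) ⟩
  ∑ e (upTo (1 ℕ.* t))                     ≡⟨ cong (∑ e ∘ upTo) (ℕP.*-identityˡ t) ⟩
  ∑ e (upTo t)                             ≡⟨ sym (ℤP.*-identityʳ _) ⟩
  ∑ e (upTo t) ℤ.* + 1                     ∎
  where open ≡-Reasoning
∑-crt-∏ t e g (q ∷ qs) (q∉ ∷ u) (pr ∷ prs) (q∤ ∷ qs∤) pe pg = begin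
  ∑ (λ a → e a ℤ.* (g q a ℤ.* P a)) (upTo (q ℕ.* product qs ℕ.* t))
    ≡⟨ ∑-cong (upTo (q ℕ.* product qs ℕ.* t)) (λ {a} _ → lem (e a) (g q a) (P a)) ⟩
  ∑ (λ a → e a ℤ.* P a ℤ.* g q a) (upTo (q ℕ.* product qs ℕ.* t))
    ≡⟨ cong (∑ (λ a → e a ℤ.* P a ℤ.* g q a) ∘ upTo) (ℕP.*-assoc q (product qs) t) ⟩
  ∑ (λ a → e a ℤ.* P a ℤ.* g q a) (upTo (q ℕ.* (product qs ℕ.* t)))
    ≡⟨ ∑-crt {{ℕPr.prime⇒nonZero pr}} (prime∤⇒coprime pr q∤rest)
         (periodic-* (periodic-∣ {g = e} (ℕD.n∣m*n (product qs)) pe)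
           (periodic-∏ {g = g} qs λ {q'} q'∈ → periodic-∣ {g = g q'} (ℕD.∣m⇒∣m*n t (∈⇒∣product q'∈)) (pg q'))) (pg q) ⟩
  ∑ (λ a → e a ℤ.* P a) (upTo (product qs ℕ.* t)) ℤ.* Q
    ≡⟨ cong (ℤ._* Q) (∑-crt-∏ t e g qs u prs qs∤ pe pg) ⟩
  ∑ e (upTo t) ℤ.* R ℤ.* Q
    ≡⟨ lem' (∑ e (upTo t)) R Q ⟩
  ∑ e (upTo t) ℤ.* (Q ℤ.* R) ∎
  where
  open ≡-Reasoning
  P : ℕ → ℤ
  P a = ∏ (λ q → g q a) qs
  Q = ∑ (g q) (upTo q)
  R = ∏ (λ q → ∑ (g q) (upTo q)) qs
  lem : ∀ e g p → e ℤ.* (g ℤ.* p) ≡ e ℤ.* p ℤ.* g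
  lem = solve-∀
  lem' : ∀ e r q → e ℤ.* r ℤ.* q ≡ e ℤ.* (q ℤ.* r)
  lem' = solve-∀
  q∤rest : ¬ q ℕD.∣ product qs ℕ.* t
  q∤rest d with euclidsLemma (product qs) t pr d
  ... | inj₂ d' = q∤ d'
  ... | inj₁ d' = All.lookup q∉ (factorisationHasAllPrimeFactors pr d' prs) refl

-- Arithmetic of fractions with natural denominators

module _ where
  open import Data.Rational.Unnormalised as ℚᵘ using (mkℚᵘ; *≡*)
  open import Data.Rational.Unnormalised.Properties as ℚᵘP using ()

  -- The detour through unnormalised rationals makes equality a cross multiplication and hides the
  -- reduction to lowest terms.
  /-cross : ∀ a b d e → a ℤ.* + suc e ≡ b ℤ.* + suc d → a ℚ./ suc d ≡ b ℚ./ suc e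
  /-cross a b d e q = ℚP.fromℚᵘ-cong {mkℚᵘ a d} {mkℚᵘ b e} (*≡* q)

  /-* : ∀ a b d e → (a ℚ./ suc d) ℚ.* (b ℚ./ suc e) ≡ (a ℤ.* b) ℚ./ (suc d ℕ.* suc e)
  /-* a b d e = ℚP.toℚᵘ-injective (ℚᵘP.≃-trans (ℚP.toℚᵘ-homo-* (a ℚ./ suc d) (b ℚ./ suc e))
    (ℚᵘP.≃-trans (ℚᵘP.*-cong (ℚP.toℚᵘ-fromℚᵘ (mkℚᵘ a d)) (ℚP.toℚᵘ-fromℚᵘ (mkℚᵘ b e)))
      (ℚᵘP.≃-sym (ℚP.toℚᵘ-fromℚᵘ (mkℚᵘ (a ℤ.* b) (e ℕ.+ d ℕ.* suc e))))))

  /-+ : ∀ a b d → (a ℚ./ suc d) ℚ.+ (b ℚ./ suc d) ≡ (a ℤ.+ b) ℚ./ suc d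
  /-+ a b d = ℚP.toℚᵘ-injective (ℚᵘP.≃-trans (ℚP.toℚᵘ-homo-+ (a ℚ./ suc d) (b ℚ./ suc d))
    (ℚᵘP.≃-trans (ℚᵘP.+-cong (ℚP.toℚᵘ-fromℚᵘ (mkℚᵘ a d)) (ℚP.toℚᵘ-fromℚᵘ (mkℚᵘ b d)))
      (ℚᵘP.≃-trans (*≡* (trans (lem a b (+ suc d)) (cong ((a ℤ.+ b) ℤ.*_) (sym (ℤP.pos-* (suc d) (suc d))))))
        (ℚᵘP.≃-sym (ℚP.toℚᵘ-fromℚᵘ (mkℚᵘ (a ℤ.+ b) d))))))
    where
    lem : ∀ a b d → (a ℤ.* d ℤ.+ b ℤ.* d) ℤ.* d ≡ (a ℤ.+ b) ℤ.* (d ℤ.* d)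
    lem = solve-∀

  /-neg : ∀ a d → ℚ.- (a ℚ./ suc d) ≡ (ℤ.- a) ℚ./ suc d
  /-neg a d = ℚP.toℚᵘ-injective (ℚᵘP.≃-trans (ℚP.toℚᵘ-homo‿- (a ℚ./ suc d))
    (ℚᵘP.≃-trans (ℚᵘP.-‿cong (ℚP.toℚᵘ-fromℚᵘ (mkℚᵘ a d)))
      (ℚᵘP.≃-sym (ℚP.toℚᵘ-fromℚᵘ (mkℚᵘ (ℤ.- a) d)))))

/ᵗ-cross : ∀ a b d e → 0 ℕ.< d → 0 ℕ.< e → a ℤ.* + e ≡ b ℤ.* + d → a /ᵗ d ≡ b /ᵗ e
/ᵗ-cross a b (suc d) (suc e) _ _ q = /-cross a b d e q

-- A zero denominator makes both sides 0, so the factors of `a-prod` can be collected before any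
-- denominator is known to be positive.
/ᵗ-* : ∀ a b d e → (a /ᵗ d) ℚ.* (b /ᵗ e) ≡ (a ℤ.* b) /ᵗ (d ℕ.* e)
/ᵗ-* a b zero    e       = ℚP.*-zeroˡ (b /ᵗ e)
/ᵗ-* a b (suc d) zero    = trans (ℚP.*-zeroʳ (a /ᵗ suc d)) (cong ((a ℤ.* b) /ᵗ_) (sym (ℕP.*-zeroʳ (suc d))))
/ᵗ-* a b (suc d) (suc e) = /-* a b d e

/ᵗ-+ : ∀ a b d → (a /ᵗ d) ℚ.+ (b /ᵗ d) ≡ (a ℤ.+ b) /ᵗ d
/ᵗ-+ a b zero    = ℚP.+-identityˡ 0ℚ
/ᵗ-+ a b (suc d) = /-+ a b d

/ᵗ-neg : ∀ a d → ℚ.- (a /ᵗ d) ≡ (ℤ.- a) /ᵗ d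
/ᵗ-neg a zero    = refl
/ᵗ-neg a (suc d) = /-neg a d

/ᵗ-- : ∀ a b d → (a /ᵗ d) ℚ.- (b /ᵗ d) ≡ (a ℤ.- b) /ᵗ d
/ᵗ-- a b d = trans (cong ((a /ᵗ d) ℚ.+_) (/ᵗ-neg b d)) (/ᵗ-+ a (ℤ.- b) d)

/ᵗ-self : ∀ d → 0 ℕ.< d → (+ d) /ᵗ d ≡ 1ℚ
/ᵗ-self d d> = /ᵗ-cross (+ d) (+ 1) d 1 d> (ℕ.s≤s ℕ.z≤n) (trans (ℤP.*-identityʳ (+ d)) (sym (ℤP.*-identityˡ (+ d))))

productℚ-/ᵗ : ∀ {B : Set} (g : B → ℤ) (d : B → ℕ) (l : List B) →
  productℚ (map (λ x → g x /ᵗ d x) l) ≡ ∏ g l /ᵗ product (map d l)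
productℚ-/ᵗ g d []      = refl
productℚ-/ᵗ g d (x ∷ l) = trans (cong ((g x /ᵗ d x) ℚ.*_) (productℚ-/ᵗ g d l)) (/ᵗ-* (g x) (∏ g l) (d x) (product (map d l)))

-- Counting the inert residue classes

∏-zero : {B : Set} {g : B → ℤ} {l : List B} {x : B} → x ∈ l → g x ≡ + 0 → ∏ g l ≡ + 0
∏-zero {g = g} {y ∷ l} (here refl) e = cong (ℤ._* ∏ g l) e
∏-zero {g = g} {y ∷ l} (there x∈)  e = trans (cong (ℤ._*_ (g y)) (∏-zero x∈ e)) (ℤP.*-zeroʳ (g y))

prime-factor : ∀ g → g ≢ 0 → g ≢ 1 → ∃ λ p → Prime p × p ℕD.∣ g
prime-factor g g≢0 g≢1 with factorise g {{ℕ.≢-nonZero g≢0}}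
... | record { factors = [] ; isFactorisation = e }                          = contradiction e g≢1
... | record { factors = p ∷ ps ; isFactorisation = e ; factorsPrime = pr ∷ _ } =
  p , pr , subst (p ℕD.∣_) (sym e) (ℕD.m∣m*n (product ps))

legendre-∣ : ∀ {z q} .{{_ : ℕ.NonZero q}} → q ℕD.∣ ℤ.∣ z ∣ → legendre z q ≡ + 0
legendre-∣ {z} {suc k} d with legendre z (suc k) | legendre-view z k
... | _ | divisible _    = refl
... | _ | residue n _ _  = contradiction (∣⇒%ℕ0 z (suc k) d) n
... | _ | nonresidue n _ = contradiction (∣⇒%ℕ0 z (suc k) d) n

legendre-∤ : ∀ {z q} → IsOddPrime q → ¬ q ℕD.∣ ℤ.∣ z ∣ → IsSign (legendre z q)
legendre-∤ {z} (k , refl , pr) q∤z = OddPrime.leg-sign k pr z (q∤z ∘ ≋0⇒∣)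

data IsEven : Kind → Set where
  neg4 : IsEven neg4
  pos8 : IsEven pos8
  neg8 : IsEven neg8

kind-cases : ∀ K → K ≡ one ⊎ IsEven K
kind-cases one  = inj₁ refl
kind-cases neg4 = inj₂ neg4
kind-cases pos8 = inj₂ pos8
kind-cases neg8 = inj₂ neg8

-- For even D the local condition at 2 is that the value is odd; this is where `countRes f 2 1` in
-- the denominator of `α` comes from.
ε² : ∀ {K} → IsEven K → ∀ z → ε K z ℤ.* ε K z ≡ 𝟙 (z %ℕ 2 ℕ.≟ 1)
ε² {K} ev z = trans (check ev (n%ℕd<d z 8))
  (cong (λ r → 𝟙 (r ℕ.≟ 1)) (≋⇒%ℕ {+ (z %ℕ 8)} {z} 2 (≋-∣ (ℕD.divides 4 refl) (%ℕ-≋ z 8))))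
  where
  dec : ∀ K → Dec (∀ {r} → r ℕ.< 8 → ε-residue K r ℤ.* ε-residue K r ≡ 𝟙 (r ℕ.% 2 ℕ.≟ 1))
  dec K = ℕP.allUpTo? (λ r → ε-residue K r ℤ.* ε-residue K r ℤ.≟ 𝟙 (r ℕ.% 2 ℕ.≟ 1)) 8
  check : ∀ {K} → IsEven K → ∀ {r} → r ℕ.< 8 → ε-residue K r ℤ.* ε-residue K r ≡ 𝟙 (r ℕ.% 2 ℕ.≟ 1)
  check neg4 = from-yes (dec neg4)
  check pos8 = from-yes (dec pos8)
  check neg8 = from-yes (dec neg8)

-- The expansion in class indicators modulo 8 that turns sums of ε into the counts behind α.
ε-𝟙 : ∀ {K} → IsEven K → ∀ z → let r = z %ℕ 8 in ε K z ≡
  ε-residue K 1 ℤ.* 𝟙 (r ℕ.≟ 1) ℤ.+ ε-residue K 3 ℤ.* 𝟙 (r ℕ.≟ 3)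
  ℤ.+ ε-residue K 5 ℤ.* 𝟙 (r ℕ.≟ 5) ℤ.+ ε-residue K 7 ℤ.* 𝟙 (r ℕ.≟ 7)
ε-𝟙 {K} ev z = check ev (n%ℕd<d z 8)
  where
  rhs : Kind → ℕ → ℤ
  rhs K r = ε-residue K 1 ℤ.* 𝟙 (r ℕ.≟ 1) ℤ.+ ε-residue K 3 ℤ.* 𝟙 (r ℕ.≟ 3)
    ℤ.+ ε-residue K 5 ℤ.* 𝟙 (r ℕ.≟ 5) ℤ.+ ε-residue K 7 ℤ.* 𝟙 (r ℕ.≟ 7)
  dec : ∀ K → Dec (∀ {r} → r ℕ.< 8 → ε-residue K r ≡ rhs K r)
  dec K = ℕP.allUpTo? (λ r → ε-residue K r ℤ.≟ rhs K r) 8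
  check : ∀ {K} → IsEven K → ∀ {r} → r ℕ.< 8 → ε-residue K r ≡ rhs K r
  check neg4 = from-yes (dec neg4)
  check pos8 = from-yes (dec pos8)
  check neg8 = from-yes (dec neg8)

ε-coprime : ∀ K z → Coprime ℤ.∣ z ∣ (conductor K) → IsSign (ε K z)
ε-coprime K z c with kind-cases K
... | inj₁ refl = inj₁ refl
... | inj₂ ev with z %ℕ 2 ℕ.≟ 1 | ε² ev z
...   | no z%2≢1 | _ = contradiction (c (2∣z , 2∣conductor ev)) (λ ())
  where
  2∣conductor : ∀ {K} → IsEven K → 2 ℕD.∣ conductor K
  2∣conductor neg4 = ℕD.divides 2 refl
  2∣conductor pos8 = ℕD.divides 4 refl
  2∣conductor neg8 = ℕD.divides 4 refl
  2∣z : 2 ℕD.∣ ℤ.∣ z ∣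
  2∣z = %ℕ0⇒∣ z 2 (zero-residue (n%ℕd<d z 2) z%2≢1)
    where
    zero-residue : ∀ {r} → r ℕ.< 2 → r ≢ 1 → r ≡ 0
    zero-residue = from-yes (ℕP.allUpTo? (λ r → ¬? (r ℕ.≟ 1) →-dec (r ℕ.≟ 0)) 2)
...   | yes _ | e with ε K z | ε-ternary K z
...     | _ | isZero = case e of λ ()
...     | _ | isOne  = inj₁ refl
...     | _ | isNeg  = inj₂ refl

ε-2∣ : ∀ {K z} → IsEven K → 2 ℕD.∣ ℤ.∣ z ∣ → ε K z ≡ + 0
ε-2∣ {K} {z} ev d with ε K z | ε-ternary K z | trans (ε² ev z) (cong (λ r → 𝟙 (r ℕ.≟ 1)) (∣⇒%ℕ0 z 2 d))
... | _ | isZero | _ = refl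
... | _ | isOne  | ()
... | _ | isNeg  | ()

prime∣conductor : ∀ {K p} → Prime p → p ℕD.∣ conductor K → IsEven K × p ≡ 2
prime∣conductor {K} {p} pr = go K
  where
  ∣2 : p ℕD.∣ 2 → p ≡ 2
  ∣2 = prime-divisor-≡ pr ℕPr.prime[2]
  ∣4 : p ℕD.∣ 4 → p ≡ 2
  ∣4 d = [ ∣2 , ∣2 ]′ (euclidsLemma 2 2 pr d)
  ∣8 : p ℕD.∣ 8 → p ≡ 2
  ∣8 d = [ ∣2 , ∣4 ]′ (euclidsLemma 2 4 pr d)
  go : ∀ K → p ℕD.∣ conductor K → IsEven K × p ≡ 2
  go one  d = contradiction (subst Prime (ℕD.∣1⇒≡1 d) pr) ℕPr.¬prime[1]
  go neg4 d = neg4 , ∣4 d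
  go pos8 d = pos8 , ∣8 d
  go neg8 d = neg8 , ∣8 d

pos-product : ∀ {B : Set} (d : B → ℕ) (l : List B) → + product (map d l) ≡ ∏ (λ x → + d x) l
pos-product d []      = refl
pos-product d (x ∷ l) = trans (ℤP.pos-* (d x) (product (map d l))) (cong (ℤ._*_ (+ d x)) (pos-product d l))

product-positive : ∀ {B : Set} (d : B → ℕ) (l : List B) → (∀ {x} → x ∈ l → 0 ℕ.< d x) → 0 ℕ.< product (map d l)
product-positive d []      p = ℕ.s≤s ℕ.z≤n
product-positive d (x ∷ l) p = ℕP.*-mono-< (p (here refl)) (product-positive d l (p ∘ there))

module Character {D : ℤ} (disc : Disc D) where

  open Disc disc

  χD : ℤ → ℤ
  χD = χ K qs

  χ-periodic : ∀ {a b} → a ≋ b [ ℤ.∣ D ∣ ] → χD a ≡ χD b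
  χ-periodic e = χ-cong K qs e conductor∣D q∣D

  χ-coprime : ∀ z → Coprime ℤ.∣ z ∣ ℤ.∣ D ∣ → IsSign (χD z)
  χ-coprime z c = isSign-* (ε-coprime K z (λ (d , e) → c (d , ℕD.∣-trans e conductor∣D)))
    (∏-sign qs λ q∈ → legendre-∤ (qs-odd q∈) λ q∣z →
      case qs-odd q∈ of λ { (_ , _ , pr) → ℕPr.¬prime[1] (subst Prime (c (q∣z , q∣D q∈)) pr) })
    where
    ∏-sign : ∀ l → (∀ {q} → q ∈ l → IsSign (legendre z q)) → IsSign (∏ (legendre z) l)
    ∏-sign []      s = inj₁ refl
    ∏-sign (q ∷ l) s = isSign-* (s (here refl)) (∏-sign l (s ∘ there))

  D≢0 : ℤ.∣ D ∣ ≢ 0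
  D≢0 e with ℕP.m*n≡0⇒m≡0∨n≡0 (conductor K) (trans (sym ∣D∣≡) e)
  ... | inj₁ c = conductor≢0 K c
    where
    conductor≢0 : ∀ K → conductor K ≢ 0
    conductor≢0 one  ()
    conductor≢0 neg4 ()
    conductor≢0 pos8 ()
    conductor≢0 neg8 ()
  ... | inj₂ c = case trans (sym (cong (ℕ._% 2) c)) n-odd of λ ()

  -- A common prime factor of z and D divides the conductor, and then ε vanishes, or it is one of
  -- the odd primes, and then its Legendre symbol does.
  χ-non-coprime : ∀ z → ℕG.gcd ℤ.∣ z ∣ ℤ.∣ D ∣ ≢ 1 → χD z ≡ + 0
  χ-non-coprime z g≢1 with prime-factor _ (λ e → D≢0 (ℕG.gcd[m,n]≡0⇒n≡0 ℤ.∣ z ∣ e)) g≢1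
  ... | p , pr , p∣g with euclidsLemma (conductor K) n pr
          (subst (p ℕD.∣_) ∣D∣≡ (ℕD.∣-trans p∣g (ℕG.gcd[m,n]∣n ℤ.∣ z ∣ ℤ.∣ D ∣)))
  ...   | inj₁ d = cong (ℤ._* ∏ (legendre z) qs) (let ev , p≡2 = prime∣conductor {K} pr d in
            ε-2∣ {K} {z} ev (subst (ℕD._∣ ℤ.∣ z ∣) p≡2 (ℕD.∣-trans p∣g (ℕG.gcd[m,n]∣m ℤ.∣ z ∣ ℤ.∣ D ∣))))
  ...   | inj₂ d = trans (cong (ℤ._*_ (ε K z)) (∏-zero {g = legendre z} (∈-primeDivisors⁺ {{ℕ.≢-nonZero n≢0}} pr d)
            (legendre-∣ {{ℕPr.prime⇒nonZero pr}} (ℕD.∣-trans p∣g (ℕG.gcd[m,n]∣m ℤ.∣ z ∣ ℤ.∣ D ∣))))) (ℤP.*-zeroʳ (ε K z))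
    where
    n≢0 : n ≢ 0
    n≢0 e = case trans (sym (cong (ℕ._% 2) e)) n-odd of λ ()

module Formula (f : Poly) {D : ℤ} (disc : Disc D) where

  open Disc disc
  open Character disc

  inertClass? : (a : ℕ) → Dec (χD (f ⟨ a ⟩) ≡ -[1+ 0 ])
  inertClass? a = χD (f ⟨ a ⟩) ℤ.≟ -[1+ 0 ]

  inertClasses : List ℕ
  inertClasses = filter inertClass? (upTo ℤ.∣ D ∣)

  k b : ℕ
  k = numGoodClasses f D
  b = length inertClasses

  -- k = 0 happens only when f is a constant prime dividing D; then τ = b / 0 = 0 is the correct proportion.
  τ : ℚ
  τ = (+ b) /ᵗ k

  X : ℤ
  X = ∑ (λ a → χD (f ⟨ a ⟩)) (upTo ℤ.∣ D ∣)

  χ²-good : ∀ a → χD (f ⟨ a ⟩) ℤ.* χD (f ⟨ a ⟩) ≡ 𝟙 (goodClass? f D a)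
  χ²-good a with goodClass? f D a
  ... | yes g = isSign-² (χ-coprime (f ⟨ a ⟩) (ℕC.gcd≡1⇒coprime (ℤP.+-injective g)))
  ... | no ¬g = cong₂ ℤ._*_ zero' zero'
    where
    zero' = χ-non-coprime (f ⟨ a ⟩) (¬g ∘ cong +_)

  k≡∑ : + k ≡ ∑ (λ a → χD (f ⟨ a ⟩) ℤ.* χD (f ⟨ a ⟩)) (upTo ℤ.∣ D ∣)
  k≡∑ = trans (length-filter-∑ (goodClass? f D) (upTo ℤ.∣ D ∣))
    (∑-cong (upTo ℤ.∣ D ∣) (λ {a} _ → sym (χ²-good a)))

  -- Pointwise, x² - x is 2 at x = -1 and 0 at x = 0 and x = 1.
  2b≡k-X : + 2 ℤ.* + b ≡ + k ℤ.- X
  2b≡k-X = begin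
    + 2 ℤ.* + b
      ≡⟨ cong (+ 2 ℤ.*_) (length-filter-∑ inertClass? (upTo ℤ.∣ D ∣)) ⟩
    + 2 ℤ.* ∑ (λ a → 𝟙 (inertClass? a)) (upTo ℤ.∣ D ∣)
      ≡⟨ sym (∑-*ˡ (+ 2) (λ a → 𝟙 (inertClass? a)) (upTo ℤ.∣ D ∣)) ⟩
    ∑ (λ a → + 2 ℤ.* 𝟙 (inertClass? a)) (upTo ℤ.∣ D ∣)
      ≡⟨ ∑-cong (upTo ℤ.∣ D ∣) (λ {a} _ → twice-neg (χ-ternary K qs (f ⟨ a ⟩))) ⟩
    ∑ (λ a → χf a ℤ.* χf a ℤ.+ -[1+ 0 ] ℤ.* χf a) (upTo ℤ.∣ D ∣)
      ≡⟨ ∑-+ (λ a → χf a ℤ.* χf a) (λ a → -[1+ 0 ] ℤ.* χf a) (upTo ℤ.∣ D ∣) ⟩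
    ∑ (λ a → χf a ℤ.* χf a) (upTo ℤ.∣ D ∣) ℤ.+ ∑ (λ a → -[1+ 0 ] ℤ.* χf a) (upTo ℤ.∣ D ∣)
      ≡⟨ cong₂ ℤ._+_ (sym k≡∑) (trans (∑-*ˡ -[1+ 0 ] χf (upTo ℤ.∣ D ∣)) (ℤP.-1*i≡-i X)) ⟩
    + k ℤ.- X ∎
    where
    open ≡-Reasoning
    χf : ℕ → ℤ
    χf a = χD (f ⟨ a ⟩)
    twice-neg : ∀ {x} → IsTernary x → + 2 ℤ.* 𝟙 (x ℤ.≟ -[1+ 0 ]) ≡ x ℤ.* x ℤ.+ -[1+ 0 ] ℤ.* x
    twice-neg isZero = refl
    twice-neg isOne  = refl
    twice-neg isNeg  = refl

  2τ≡ : 0 ℕ.< k → ℕ→ℚ 2 ℚ.* τ ≡ 1ℚ ℚ.- X /ᵗ k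
  2τ≡ k> = begin
    ℕ→ℚ 2 ℚ.* τ                   ≡⟨ /ᵗ-* (+ 2) (+ b) 1 k ⟩
    (+ 2 ℤ.* + b) /ᵗ (1 ℕ.* k)    ≡⟨ cong₂ _/ᵗ_ 2b≡k-X (ℕP.*-identityˡ k) ⟩
    (+ k ℤ.- X) /ᵗ k              ≡⟨ sym (/ᵗ-- (+ k) X k) ⟩
    (+ k) /ᵗ k ℚ.- X /ᵗ k         ≡⟨ cong (ℚ._- X /ᵗ k) (/ᵗ-self k k>) ⟩
    1ℚ ℚ.- X /ᵗ k                 ∎
    where open ≡-Reasoning

  -- Local factors at 2 (E) and at the odd primes (P) of the sums of χ (index 1) and χ² (index 2).
  -- The quotient of the P's is `a-prod`, and that of the E's gives the combination of α's.
  E₁ E₂ P₁ : ℤ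
  E₁ = ∑ (λ a → ε K (f ⟨ a ⟩)) (upTo (conductor K))
  E₂ = ∑ (λ a → ε K (f ⟨ a ⟩) ℤ.* ε K (f ⟨ a ⟩)) (upTo (conductor K))
  P₁ = ∏ (λ q → ∑ (λ a → legendre (f ⟨ a ⟩) q) (upTo q)) qs

  P₂ : ℕ
  P₂ = product (map (λ q → q ℕ.∸ Nₚ f q) qs)

  ε-periodic : Periodic (conductor K) (λ a → ε K (f ⟨ a ⟩))
  ε-periodic e = ε-cong K (≋-eval f e)

  legendre-periodic : ∀ q → Periodic q (λ a → legendre (f ⟨ a ⟩) q)
  legendre-periodic q e = legendre-cong q (≋-eval f e)

  qs-prime : All Prime qs
  qs-prime = All.tabulate (λ q∈ → proj₁ (∈-primeDivisors⁻ {n} q∈))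

  qs∤conductor : All (λ q → ¬ q ℕD.∣ conductor K) qs
  qs∤conductor = All.tabulate λ q∈ d → let pr , q∣n = ∈-primeDivisors⁻ {n} q∈ in
    ¬2∣odd {n} n-odd (subst (ℕD._∣ n) (proj₂ (prime∣conductor {K} pr d)) q∣n)

  D-split : upTo ℤ.∣ D ∣ ≡ upTo (product qs ℕ.* conductor K)
  D-split = cong upTo (trans ∣D∣≡ (trans (ℕP.*-comm (conductor K) n) (cong (ℕ._* conductor K) (sym ∏qs≡n))))

  X≡E₁P₁ : X ≡ E₁ ℤ.* P₁
  X≡E₁P₁ = trans (cong (∑ (λ a → χD (f ⟨ a ⟩))) D-split)
    (∑-crt-∏ (conductor K) (λ a → ε K (f ⟨ a ⟩)) (λ q a → legendre (f ⟨ a ⟩) q) qs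
      (primeDivisors-unique n) qs-prime qs∤conductor ε-periodic legendre-periodic)

  -- A squared symbol is 1 minus the indicator of a root, whence the denominator of `aₚ`.
  ∑-legendre² : ∀ {q} → q ∈ qs → ∑ (λ a → legendre (f ⟨ a ⟩) q ℤ.* legendre (f ⟨ a ⟩) q) (upTo q) ≡ + (q ℕ.∸ Nₚ f q)
  ∑-legendre² {q} q∈ = begin
    ∑ (λ a → legendre (f ⟨ a ⟩) q ℤ.* legendre (f ⟨ a ⟩) q) (upTo q)   ≡⟨ ∑-cong (upTo q) (λ {a} _ → indicator a) ⟩
    ∑ (λ a → + 1 ℤ.+ -[1+ 0 ] ℤ.* 𝟙 (root? a)) (upTo q)                ≡⟨ ∑-+ (λ _ → + 1) (λ a → -[1+ 0 ] ℤ.* 𝟙 (root? a)) (upTo q) ⟩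
    ∑ (λ _ → + 1) (upTo q) ℤ.+ ∑ (λ a → -[1+ 0 ] ℤ.* 𝟙 (root? a)) (upTo q)
      ≡⟨ cong₂ ℤ._+_ (trans (∑-const (+ 1) (upTo q)) (trans (ℤP.*-identityʳ _) (cong +_ (length-upTo q))))
           (trans (∑-*ˡ -[1+ 0 ] (λ a → 𝟙 (root? a)) (upTo q)) (trans (ℤP.-1*i≡-i _) (cong ℤ.-_ (sym (length-filter-∑ root? (upTo q)))))) ⟩
    + q ℤ.- + Nₚ f q                                                   ≡⟨ ℤP.m-n≡m⊖n q (Nₚ f q) ⟩
    q ℤ.⊖ Nₚ f q                                                       ≡⟨ ℤP.⊖-≥ (subst (Nₚ f q ℕ.≤_) (length-upTo q) (length-filter root? (upTo q))) ⟩
    + (q ℕ.∸ Nₚ f q)                                                   ∎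
    where
    open ≡-Reasoning
    root? : ∀ a → Dec (q ℕD.∣ ℤ.∣ f ⟨ a ⟩ ∣)
    root? a = q ℕD.∣? ℤ.∣ f ⟨ a ⟩ ∣
    indicator : ∀ a → legendre (f ⟨ a ⟩) q ℤ.* legendre (f ⟨ a ⟩) q ≡ + 1 ℤ.+ -[1+ 0 ] ℤ.* 𝟙 (root? a)
    indicator a with q ℕD.∣? ℤ.∣ f ⟨ a ⟩ ∣
    ... | yes d = cong (λ z → z ℤ.* z) (legendre-∣ {{ℕPr.prime⇒nonZero (proj₁ (∈-primeDivisors⁻ {n} q∈))}} d)
    ... | no ¬d = isSign-² (legendre-∤ (qs-odd q∈) ¬d)

  k≡E₂P₂ : + k ≡ E₂ ℤ.* + P₂
  k≡E₂P₂ = begin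
    + k
      ≡⟨ trans k≡∑ (cong (∑ (λ a → χD (f ⟨ a ⟩) ℤ.* χD (f ⟨ a ⟩))) D-split) ⟩
    ∑ (λ a → χD (f ⟨ a ⟩) ℤ.* χD (f ⟨ a ⟩)) (upTo (product qs ℕ.* conductor K))
      ≡⟨ ∑-cong (upTo (product qs ℕ.* conductor K)) (λ {a} _ → trans (lem (ε K (f ⟨ a ⟩)) (∏ (legendre (f ⟨ a ⟩)) qs))
           (cong (ℤ._*_ (ε K (f ⟨ a ⟩) ℤ.* ε K (f ⟨ a ⟩))) (sym (∏-* (legendre (f ⟨ a ⟩)) (legendre (f ⟨ a ⟩)) qs)))) ⟩
    ∑ (λ a → ε K (f ⟨ a ⟩) ℤ.* ε K (f ⟨ a ⟩) ℤ.* ∏ (λ q → legendre (f ⟨ a ⟩) q ℤ.* legendre (f ⟨ a ⟩) q) qs) (upTo (product qs ℕ.* conductor K))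
      ≡⟨ ∑-crt-∏ (conductor K) (λ a → ε K (f ⟨ a ⟩) ℤ.* ε K (f ⟨ a ⟩)) (λ q a → legendre (f ⟨ a ⟩) q ℤ.* legendre (f ⟨ a ⟩) q) qs
           (primeDivisors-unique n) qs-prime qs∤conductor (periodic-* ε-periodic ε-periodic)
           (λ q → periodic-* (legendre-periodic q) (legendre-periodic q)) ⟩
    E₂ ℤ.* ∏ (λ q → ∑ (λ a → legendre (f ⟨ a ⟩) q ℤ.* legendre (f ⟨ a ⟩) q) (upTo q)) qs
      ≡⟨ cong (ℤ._*_ E₂) (trans (∏-cong qs ∑-legendre²) (sym (pos-product (λ q → q ℕ.∸ Nₚ f q) qs))) ⟩
    E₂ ℤ.* + P₂ ∎
    where
    open ≡-Reasoning
    lem : ∀ e l → e ℤ.* l ℤ.* (e ℤ.* l) ≡ e ℤ.* e ℤ.* (l ℤ.* l)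
    lem = solve-∀

  a-prod≡ : a-prod f n ≡ P₁ /ᵗ P₂
  a-prod≡ = productℚ-/ᵗ (λ q → ∑ (λ j → legendre (f ⟨ j ⟩) q) (upTo q)) (λ q → q ℕ.∸ Nₚ f q) qs

  P₂-positive : (∀ p → p ∈ qs → Nₚ f p ℕ.< p) → 0 ℕ.< P₂
  P₂-positive h = product-positive (λ q → q ℕ.∸ Nₚ f q) qs (λ q∈ → ℕP.m<n⇒0<n∸m (h _ q∈))

-- The closed formula in the four cases

module ClosedForm (f : Poly) {D : ℤ} (disc : Disc D) where

  open Disc disc
  open Character disc
  open Formula f disc

  n>0 : 0 ℕ.< n
  n>0 = ℕP.n≢0⇒n>0 λ e → case trans (sym (cong (ℕ._% 2) e)) n-odd of λ ()

  odd⊥conductor : ∀ e → e ℕ.% 2 ≡ 1 → Coprime e (conductor K)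
  odd⊥conductor e e-odd {d} (d∣e , d∣K) with d ℕ.≟ 1
  ... | yes d≡1 = d≡1
  ... | no d≢1 with prime-factor d (λ { refl → ¬2∣odd {e} e-odd (subst (2 ℕD.∣_) (sym (ℕD.0∣⇒≡0 d∣e)) (2 ℕD.∣0)) }) d≢1
  ...   | p , pr , p∣d = ⊥-elim (¬2∣odd {e} e-odd
          (subst (ℕD._∣ e) (proj₂ (prime∣conductor {K} pr (ℕD.∣-trans p∣d d∣K))) (ℕD.∣-trans p∣d d∣e)))

  -- An odd divisor of |D| is coprime to the conductor, a power of 2, and so divides `n`, itself an
  -- odd divisor.
  largestOdd-≡n : ∀ D₁ → LargestOddDivisor D₁ ℤ.∣ D ∣ → D₁ ≡ n
  largestOdd-≡n D₁ (D₁-odd , D₁∣D , largest) = ℕP.≤-antisym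
    (ℕD.∣⇒≤ {{ℕ.>-nonZero n>0}} (ℕC.coprime-divisor (odd⊥conductor D₁ D₁-odd) (subst (D₁ ℕD.∣_) ∣D∣≡ D₁∣D)))
    (largest n n-odd n∣D)

  c : ℕ
  c = countRes f 2 1

  -- The α's count modulo 8 for every kind. Over r = 8/conductor periods both E's are multiplied by
  -- r, which leaves their quotient unchanged.
  C₈ : ℤ
  C₈ = ∑ (λ a → ε K (f ⟨ a ⟩)) (upTo 8)

  8=r*conductor : ∀ K → ∃ λ r → 8 ≡ r ℕ.* conductor K
  8=r*conductor one  = 8 , refl
  8=r*conductor neg4 = 2 , refl
  8=r*conductor pos8 = 1 , refl
  8=r*conductor neg8 = 1 , refl

  r : ℕ
  r = proj₁ (8=r*conductor K)

  ∑-upTo-8 : ∀ {g} → Periodic (conductor K) g → ∑ g (upTo 8) ≡ + r ℤ.* ∑ g (upTo (conductor K))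
  ∑-upTo-8 {g} pg = trans (cong (∑ g ∘ upTo) (proj₂ (8=r*conductor K))) (∑-periodic pg r)

  -- The 4 in the definition of α: eight residues make four periods modulo 2.
  4c≡rE₂ : IsEven K → + (4 ℕ.* c) ≡ + r ℤ.* E₂
  4c≡rE₂ ev = begin
    + (4 ℕ.* c)                                       ≡⟨ ℤP.pos-* 4 c ⟩
    + 4 ℤ.* + c                                       ≡⟨ cong (+ 4 ℤ.*_) (length-filter-∑ odd-value? (upTo 2)) ⟩
    + 4 ℤ.* ∑ (λ s → 𝟙 (odd-value? s)) (upTo 2)       ≡⟨ sym (∑-periodic {2} (λ e → cong (λ r → 𝟙 (r ℕ.≟ 1)) (≋⇒%ℕ 2 (≋-eval f e))) 4) ⟩
    ∑ (λ s → 𝟙 (odd-value? s)) (upTo 8)               ≡⟨ ∑-cong (upTo 8) (λ {s} _ → sym (ε² ev (f ⟨ s ⟩))) ⟩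
    ∑ (λ s → ε K (f ⟨ s ⟩) ℤ.* ε K (f ⟨ s ⟩)) (upTo 8) ≡⟨ ∑-upTo-8 (periodic-* ε-periodic ε-periodic) ⟩
    + r ℤ.* E₂                                        ∎
    where
    open ≡-Reasoning
    odd-value? : ∀ s → Dec (f ⟨ s ⟩ %ℕ 2 ≡ 1)
    odd-value? s = f ⟨ s ⟩ %ℕ 2 ℕ.≟ 1

  signedCount : Kind → ℤ
  signedCount K' = ε-residue K' 1 ℤ.* + countRes f 8 1 ℤ.+ ε-residue K' 3 ℤ.* + countRes f 8 3
    ℤ.+ ε-residue K' 5 ℤ.* + countRes f 8 5 ℤ.+ ε-residue K' 7 ℤ.* + countRes f 8 7

  C₈-counts : IsEven K → C₈ ≡ signedCount K
  C₈-counts ev = begin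
    C₈                                                            ≡⟨ ∑-cong (upTo 8) (λ {s} _ → ε-𝟙 ev (f ⟨ s ⟩)) ⟩
    ∑ (λ s → t 1 s ℤ.+ t 3 s ℤ.+ t 5 s ℤ.+ t 7 s) (upTo 8)         ≡⟨ ∑-+ (λ s → t 1 s ℤ.+ t 3 s ℤ.+ t 5 s) (t 7) (upTo 8) ⟩
    ∑ (λ s → t 1 s ℤ.+ t 3 s ℤ.+ t 5 s) (upTo 8) ℤ.+ ∑ (t 7) (upTo 8) ≡⟨ cong₂ ℤ._+_ (trans (∑-+ (λ s → t 1 s ℤ.+ t 3 s) (t 5) (upTo 8))
                                                                       (cong₂ ℤ._+_ (trans (∑-+ (t 1) (t 3) (upTo 8)) (cong₂ ℤ._+_ (count 1) (count 3))) (count 5))) (count 7) ⟩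
    _ ∎
    where
    open ≡-Reasoning
    t : ℕ → ℕ → ℤ
    t j s = ε-residue K j ℤ.* 𝟙 (f ⟨ s ⟩ %ℕ 8 ℕ.≟ j)
    count : ∀ j → ∑ (t j) (upTo 8) ≡ ε-residue K j ℤ.* + countRes f 8 j
    count j = trans (∑-*ˡ (ε-residue K j) (λ s → 𝟙 (f ⟨ s ⟩ %ℕ 8 ℕ.≟ j)) (upTo 8))
      (cong (ℤ._*_ (ε-residue K j)) (sym (length-filter-∑ (λ s → f ⟨ s ⟩ %ℕ 8 ℕ.≟ j) (upTo 8))))

  module _ (N<p : ∀ p → p ∈ qs → Nₚ f p ℕ.< p) where

    odd-formula : K ≡ one → ℕ→ℚ 2 ℚ.* τ ≡ 1ℚ ℚ.- a-prod f n
    odd-formula K≡one = trans (2τ≡ k>0) (cong (ℚ._-_ 1ℚ) (trans (cong₂ _/ᵗ_ X≡P₁ k≡P₂) (sym a-prod≡)))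
      where
      -- The kind is generalised because `K` is a record projection, on which `refl` cannot be
      -- matched.
      E₁-one : ∀ {K'} → K' ≡ one → ∑ (λ a → ε K' (f ⟨ a ⟩)) (upTo (conductor K')) ≡ + 1
      E₁-one refl = refl
      E₂-one : ∀ {K'} → K' ≡ one → ∑ (λ a → ε K' (f ⟨ a ⟩) ℤ.* ε K' (f ⟨ a ⟩)) (upTo (conductor K')) ≡ + 1
      E₂-one refl = refl
      X≡P₁ : X ≡ P₁
      X≡P₁ = trans X≡E₁P₁ (trans (cong (ℤ._* P₁) (E₁-one K≡one)) (ℤP.*-identityˡ P₁))
      k≡P₂ : k ≡ P₂
      k≡P₂ = ℤP.+-injective (trans k≡E₂P₂ (trans (cong (ℤ._* + P₂) (E₂-one K≡one)) (ℤP.*-identityˡ (+ P₂))))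
      k>0 : 0 ℕ.< k
      k>0 = subst (0 ℕ.<_) (sym k≡P₂) (P₂-positive N<p)

    -- X/k = E₁P₁/(E₂P₂), expanded by r to C₈P₁/(4cP₂). The identity 4cP₂ = rk also yields k > 0.
    even-formula : IsEven K → 0 ℕ.< c → ∀ {A} → A ≡ (ℤ.- C₈) /ᵗ (4 ℕ.* c) →
      ℕ→ℚ 2 ℚ.* τ ≡ 1ℚ ℚ.+ A ℚ.* a-prod f n
    even-formula ev c>0 {A} A≡ = trans (2τ≡ k>0) (cong (1ℚ ℚ.+_) (begin
      ℚ.- X /ᵗ k                                         ≡⟨ /ᵗ-neg X k ⟩
      (ℤ.- X) /ᵗ k                                       ≡⟨ /ᵗ-cross (ℤ.- X) (ℤ.- C₈ ℤ.* P₁) k (4 ℕ.* c ℕ.* P₂) k>0 4cP₂>0 cross ⟩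
      (ℤ.- C₈ ℤ.* P₁) /ᵗ (4 ℕ.* c ℕ.* P₂)                ≡⟨ sym (/ᵗ-* (ℤ.- C₈) P₁ (4 ℕ.* c) P₂) ⟩
      ((ℤ.- C₈) /ᵗ (4 ℕ.* c)) ℚ.* (P₁ /ᵗ P₂)             ≡⟨ cong₂ ℚ._*_ (sym A≡) (sym a-prod≡) ⟩
      A ℚ.* a-prod f n                                   ∎))
      where
      open ≡-Reasoning
      4cP₂>0 : 0 ℕ.< 4 ℕ.* c ℕ.* P₂
      4cP₂>0 = ℕP.*-mono-< (ℕP.*-mono-< {0} {4} (ℕ.s≤s ℕ.z≤n) c>0) (P₂-positive N<p)
      4cP₂≡rk : + (4 ℕ.* c ℕ.* P₂) ≡ + r ℤ.* + k
      4cP₂≡rk = begin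
        + (4 ℕ.* c ℕ.* P₂)            ≡⟨ ℤP.pos-* (4 ℕ.* c) P₂ ⟩
        + (4 ℕ.* c) ℤ.* + P₂          ≡⟨ cong (ℤ._* + P₂) (4c≡rE₂ ev) ⟩
        + r ℤ.* E₂ ℤ.* + P₂           ≡⟨ ℤP.*-assoc (+ r) E₂ (+ P₂) ⟩
        + r ℤ.* (E₂ ℤ.* + P₂)         ≡⟨ cong (+ r ℤ.*_) (sym k≡E₂P₂) ⟩
        + r ℤ.* + k                   ∎
      k>0 : 0 ℕ.< k
      k>0 = ℕP.n≢0⇒n>0 λ k≡0 → ℕP.<⇒≢ 4cP₂>0 (sym (ℤP.+-injective
        (trans 4cP₂≡rk (trans (cong (λ z → + r ℤ.* + z) k≡0) (ℤP.*-zeroʳ (+ r))))))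
      cross : ℤ.- X ℤ.* + (4 ℕ.* c ℕ.* P₂) ≡ ℤ.- C₈ ℤ.* P₁ ℤ.* + k
      cross = begin
        ℤ.- X ℤ.* + (4 ℕ.* c ℕ.* P₂)              ≡⟨ cong₂ (λ x y → ℤ.- x ℤ.* y) X≡E₁P₁ 4cP₂≡rk ⟩
        ℤ.- (E₁ ℤ.* P₁) ℤ.* (+ r ℤ.* + k)         ≡⟨ lem E₁ P₁ (+ r) (+ k) ⟩
        ℤ.- (+ r ℤ.* E₁) ℤ.* P₁ ℤ.* + k           ≡⟨ cong (λ z → ℤ.- z ℤ.* P₁ ℤ.* + k) (sym (∑-upTo-8 ε-periodic)) ⟩
        ℤ.- C₈ ℤ.* P₁ ℤ.* + k                     ∎
        where
        lem : ∀ e p r k → ℤ.- (e ℤ.* p) ℤ.* (r ℤ.* k) ≡ ℤ.- (r ℤ.* e) ℤ.* p ℤ.* k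
        lem = solve-∀

  α-combination : ∀ i j l m → α f i ℚ.+ α f j ℚ.- α f l ℚ.- α f m ≡
    (+ countRes f 8 i ℤ.+ + countRes f 8 j ℤ.- + countRes f 8 l ℤ.- + countRes f 8 m) /ᵗ (4 ℕ.* c)
  α-combination i j l m = trans (cong (λ z → z ℚ.- α f l ℚ.- α f m) (/ᵗ-+ (+ countRes f 8 i) (+ countRes f 8 j) (4 ℕ.* c)))
    (trans (cong (ℚ._- α f m) (/ᵗ-- (+ countRes f 8 i ℤ.+ + countRes f 8 j) (+ countRes f 8 l) (4 ℕ.* c)))
      (/ᵗ-- (+ countRes f 8 i ℤ.+ + countRes f 8 j ℤ.- + countRes f 8 l) (+ countRes f 8 m) (4 ℕ.* c)))

  -- The product of the q* is 1 + 4w, so D ≡ u modulo 4|u|. For u = ±8 this is a congruence modulo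
  -- 32, which separates 8 from -8 ≡ 24.
  D-residue : ∀ {u} → unit K ≡ u → ∀ m .{{_ : ℕ.NonZero m}} → m ℕD.∣ ℤ.∣ u ∣ ℕ.* 4 → D %ℕ m ≡ u %ℕ m
  D-residue {u} refl m m∣ = ≋⇒%ℕ m (≋-∣ m∣ (≋-trans (≋-reflexive D≡) D≋u))
    where
    open _≋_[_] (∏-star-mod4 qs qs-odd) renaming (quot to w; eq to S≡)
    D≋u : u ℤ.* ∏ star qs ≋ u [ ℤ.∣ u ∣ ℕ.* 4 ]
    D≋u = ≋-trans (≋-reflexive (trans (cong (u ℤ.*_) S≡) (lem u w))) (≋-trans (≋-+ (≋-refl {u})
      (∣⇒≋0 {w ℤ.* (u ℤ.* + 4)} (subst (ℤ.∣ u ∣ ℕ.* 4 ℕD.∣_) (sym (trans (ℤP.abs-* w (u ℤ.* + 4)) (cong (ℤ.∣ w ∣ ℕ.*_) (ℤP.abs-* u (+ 4)))))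
        (ℕD.n∣m*n ℤ.∣ w ∣)))) (≋-reflexive (ℤP.+-identityʳ u)))
      where
      lem : ∀ u w → u ℤ.* (+ 1 ℤ.+ w ℤ.* + 4) ≡ u ℤ.+ w ℤ.* (u ℤ.* + 4)
      lem = solve-∀

  formula : (∀ p → p ∈ qs → Nₚ f p ℕ.< p) → (D %ℕ 2 ≡ 0 → 0 ℕ.< c) → ℕ→ℚ 2 ℚ.* τ ≡ twoTauFormula f D n
  formula N<p c>0 = by-kind K refl
    where
    even-case : ∀ {K'} → K ≡ K' → IsEven K' → 0 ℕ.< c → ∀ {A z} → A ≡ z /ᵗ (4 ℕ.* c) → z ≡ ℤ.- signedCount K' →
      ℕ→ℚ 2 ℚ.* τ ≡ 1ℚ ℚ.+ A ℚ.* a-prod f n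
    even-case e ev c>0 A≡ z≡ = even-formula N<p ev' c>0 (trans A≡ (cong (_/ᵗ (4 ℕ.* c))
      (trans z≡ (cong ℤ.-_ (trans (cong signedCount (sym e)) (sym (C₈-counts ev')))))))
      where
      ev' : IsEven K
      ev' = subst IsEven (sym e) ev
    D%2 : ∀ {K'} → K ≡ K' → IsEven K' → D %ℕ 2 ≡ 0
    D%2 e neg4 = D-residue (cong unit e) 2 (ℕD.divides 8 refl)
    D%2 e pos8 = D-residue (cong unit e) 2 (ℕD.divides 16 refl)
    D%2 e neg8 = D-residue (cong unit e) 2 (ℕD.divides 16 refl)
    by-kind : ∀ K' → K ≡ K' → ℕ→ℚ 2 ℚ.* τ ≡ twoTauFormula f D n
    by-kind one e rewrite D-residue (cong unit e) 2 (ℕD.divides 2 refl) = odd-formula N<p e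
    -- The signs are those of -ε: minus on the classes 1 and 5, plus on 3 and 7.
    by-kind neg4 e = trans (even-case e neg4 (c>0 (D%2 e neg4)) (α-combination 3 7 1 5)
        (lem (+ countRes f 8 1) (+ countRes f 8 3) (+ countRes f 8 5) (+ countRes f 8 7))) (sym shape)
      where
      shape : twoTauFormula f D n ≡ 1ℚ ℚ.+ (α f 3 ℚ.+ α f 7 ℚ.- α f 1 ℚ.- α f 5) ℚ.* a-prod f n
      shape rewrite D%2 e neg4 | D-residue (cong unit e) 8 (ℕD.divides 2 refl) = refl
      lem : ∀ a b c d → b ℤ.+ d ℤ.- a ℤ.- c ≡ ℤ.- (+ 1 ℤ.* a ℤ.+ -[1+ 0 ] ℤ.* b ℤ.+ + 1 ℤ.* c ℤ.+ -[1+ 0 ] ℤ.* d)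
      lem = solve-∀
    by-kind pos8 e = trans (even-case e pos8 (c>0 (D%2 e pos8)) (α-combination 3 5 1 7)
        (lem (+ countRes f 8 1) (+ countRes f 8 3) (+ countRes f 8 5) (+ countRes f 8 7))) (sym shape)
      where
      shape : twoTauFormula f D n ≡ 1ℚ ℚ.+ (α f 3 ℚ.+ α f 5 ℚ.- α f 1 ℚ.- α f 7) ℚ.* a-prod f n
      -- D is 0 modulo 8, so the test for 4 fails, and 8 modulo 32.
      shape rewrite D%2 e pos8 | D-residue (cong unit e) 8 (ℕD.divides 4 refl)
        | D-residue (cong unit e) 32 (ℕD.divides 1 refl) = refl
      lem : ∀ a b c d → b ℤ.+ c ℤ.- a ℤ.- d ≡ ℤ.- (+ 1 ℤ.* a ℤ.+ -[1+ 0 ] ℤ.* b ℤ.+ -[1+ 0 ] ℤ.* c ℤ.+ + 1 ℤ.* d)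
      lem = solve-∀
    by-kind neg8 e = trans (even-case e neg8 (c>0 (D%2 e neg8)) (α-combination 5 7 1 3)
        (lem (+ countRes f 8 1) (+ countRes f 8 3) (+ countRes f 8 5) (+ countRes f 8 7))) (sym shape)
      where
      shape : twoTauFormula f D n ≡ 1ℚ ℚ.+ (α f 5 ℚ.+ α f 7 ℚ.- α f 1 ℚ.- α f 3) ℚ.* a-prod f n
      shape rewrite D%2 e neg8 | D-residue (cong unit e) 8 (ℕD.divides 4 refl)
        | D-residue (cong unit e) 32 (ℕD.divides 1 refl) = refl
      lem : ∀ a b c d → c ℤ.+ d ℤ.- a ℤ.- b ≡ ℤ.- (+ 1 ℤ.* a ℤ.+ + 1 ℤ.* b ℤ.+ -[1+ 0 ] ℤ.* c ℤ.+ -[1+ 0 ] ℤ.* d)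
      lem = solve-∀

-- Limits of ratios and the growth of polynomials

module _ where
  open import Data.Rational.Unnormalised as ℚᵘ using (mkℚᵘ; *<*)
  open import Data.Rational.Unnormalised.Properties as ℚᵘP using ()

  /-< : ∀ a b d e → a ℤ.* + suc e ℤ.< b ℤ.* + suc d → a ℚ./ suc d ℚ.< b ℚ./ suc e
  /-< a b d e lt = ℚP.toℚᵘ-cancel-< (ℚᵘP.<-respˡ-≃ (ℚᵘP.≃-sym (ℚP.toℚᵘ-fromℚᵘ (mkℚᵘ a d)))
    (ℚᵘP.<-respʳ-≃ (ℚᵘP.≃-sym (ℚP.toℚᵘ-fromℚᵘ (mkℚᵘ b e))) (*<* lt)))

  /-<⁻ : ∀ a b d e → a ℚ./ suc d ℚ.< b ℚ./ suc e → a ℤ.* + suc e ℤ.< b ℤ.* + suc d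
  /-<⁻ a b d e lt with ℚᵘP.<-respˡ-≃ (ℚP.toℚᵘ-fromℚᵘ (mkℚᵘ a d))
    (ℚᵘP.<-respʳ-≃ (ℚP.toℚᵘ-fromℚᵘ (mkℚᵘ b e)) (ℚP.toℚᵘ-mono-< lt))
  ... | *<* lt' = lt'

  /-abs : ∀ a d → ℚ.∣ a ℚ./ suc d ∣ ≡ (+ ℤ.∣ a ∣) ℚ./ suc d
  /-abs a d = ℚP.toℚᵘ-injective (ℚᵘP.≃-trans (ℚP.toℚᵘ-homo-∣-∣ (a ℚ./ suc d))
    (ℚᵘP.≃-trans (ℚᵘP.∣-∣-cong (ℚP.toℚᵘ-fromℚᵘ (mkℚᵘ a d))) (ℚᵘP.≃-trans (abs-mk a)
      (ℚᵘP.≃-sym (ℚP.toℚᵘ-fromℚᵘ (mkℚᵘ (+ ℤ.∣ a ∣) d))))))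
    where
    abs-mk : ∀ a → ℚᵘ.∣ mkℚᵘ a d ∣ ℚᵘ.≃ mkℚᵘ (+ ℤ.∣ a ∣) d
    abs-mk (+ _)    = ℚᵘP.≃-refl
    abs-mk -[1+ _ ] = ℚᵘP.≃-refl

-- k times the distance of x from (b/k)·y, which keeps the estimates in the natural numbers.
deviation : ℕ → ℕ → ℕ → ℕ → ℕ
deviation k b x y = ℤ.∣ + (x ℕ.* k) ℤ.- + (b ℕ.* y) ∣

difference-/ : ∀ k' b x y → ℕ→ℚ x ℚ.- ((+ b) /ᵗ suc k') ℚ.* ℕ→ℚ y ≡ (+ (x ℕ.* suc k') ℤ.- + (b ℕ.* y)) ℚ./ suc k'
difference-/ k' b x y = begin
  ℕ→ℚ x ℚ.- ((+ b) /ᵗ k) ℚ.* ℕ→ℚ y           ≡⟨ cong₂ (λ u v → u ℚ.- v) scale (/ᵗ-* (+ b) (+ y) k 1) ⟩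
  (+ (x ℕ.* k)) /ᵗ k ℚ.- (+ b ℤ.* + y) /ᵗ (k ℕ.* 1)
                                             ≡⟨ cong₂ (λ u v → (+ (x ℕ.* k)) /ᵗ k ℚ.- u /ᵗ v) (sym (ℤP.pos-* b y)) (ℕP.*-identityʳ k) ⟩
  (+ (x ℕ.* k)) /ᵗ k ℚ.- (+ (b ℕ.* y)) /ᵗ k  ≡⟨ /ᵗ-- (+ (x ℕ.* k)) (+ (b ℕ.* y)) k ⟩
  (+ (x ℕ.* k) ℤ.- + (b ℕ.* y)) /ᵗ k         ∎
  where
  open ≡-Reasoning
  k = suc k'
  scale : ℕ→ℚ x ≡ (+ (x ℕ.* k)) /ᵗ k
  scale = /ᵗ-cross (+ x) (+ (x ℕ.* k)) 1 k (ℕ.s≤s ℕ.z≤n) (ℕ.s≤s ℕ.z≤n)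
    (trans (sym (ℤP.pos-* x k)) (sym (ℤP.*-identityʳ _)))

-- It suffices to treat ε = 1/e, since a positive fraction is at least the reciprocal of its
-- denominator.
ratio-criterion : ∀ k b (num den : ℕ → ℕ) → 0 ℕ.< k →
  (∀ e → 0 ℕ.< e → ∃ λ X → ∀ x → X ℕ.≤ x → e ℕ.* deviation k b (num x) (den x) ℕ.< k ℕ.* den x) →
  RatioTendsTo (λ x → ℕ→ℚ (num x)) (λ x → ℕ→ℚ (den x)) ((+ b) /ᵗ k)
ratio-criterion (suc k') b num den _ crit ε₀@(ℚ.mkℚ (+ suc p') q-1 _) ε> with crit (suc q-1) (ℕ.s≤s ℕ.z≤n)
... | X , large = X , λ x x≥ → subst₂ ℚ._<_
      (sym (trans (cong ℚ.∣_∣ (difference-/ k' b (num x) (den x))) (/-abs (+ (num x ℕ.* suc k') ℤ.- + (b ℕ.* den x)) k')))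
      (sym (trans (cong (ℚ._* ℕ→ℚ (den x)) (sym (ℚP.↥p/↧p≡p ε₀))) (/-* (+ suc p') (+ den x) q-1 0)))
      (/-< (+ deviation (suc k') b (num x) (den x)) (+ suc p' ℤ.* + den x) k' (q-1 ℕ.* 1)
        (subst₂ ℤ._<_ (sym (lhs x)) (sym (rhs x)) (ℤ.+<+ (ℕP.<-≤-trans (large x x≥) (ℕP.m≤m+n (suc k' ℕ.* den x) (p' ℕ.* (suc k' ℕ.* den x)))))))
  where
  lhs : ∀ x → + deviation (suc k') b (num x) (den x) ℤ.* + (suc q-1 ℕ.* 1) ≡ + (suc q-1 ℕ.* deviation (suc k') b (num x) (den x))
  lhs x = trans (sym (ℤP.pos-* (deviation (suc k') b (num x) (den x)) (suc q-1 ℕ.* 1)))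
    (cong +_ (trans (cong (deviation (suc k') b (num x) (den x) ℕ.*_) (ℕP.*-identityʳ (suc q-1))) (ℕP.*-comm _ (suc q-1))))
  rhs : ∀ x → + suc p' ℤ.* + den x ℤ.* + suc k' ≡ + (suc k' ℕ.* den x ℕ.+ p' ℕ.* (suc k' ℕ.* den x))
  rhs x = trans (cong (ℤ._* + suc k') (sym (ℤP.pos-* (suc p') (den x)))) (trans (sym (ℤP.pos-* (suc p' ℕ.* den x) (suc k')))
    (cong +_ (trans (ℕP.*-assoc (suc p') (den x) (suc k')) (cong (suc p' ℕ.*_) (ℕP.*-comm (den x) (suc k'))))))
ratio-criterion (suc k') b num den _ crit (ℚ.mkℚ (+ zero) _ _) (ℚ.*<* (ℤ.+<+ ()))
ratio-criterion (suc k') b num den _ crit (ℚ.mkℚ -[1+ _ ] _ _) (ℚ.*<* ())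

ratio-one⁻ : ∀ (num den : ℕ → ℕ) → RatioTendsTo (λ x → ℕ→ℚ (num x)) (λ x → ℕ→ℚ (den x)) 1ℚ →
  ∀ e → 0 ℕ.< e → ∃ λ X → ∀ x → X ℕ.≤ x → e ℕ.* ℤ.∣ + num x ℤ.- + den x ∣ ℕ.< den x
ratio-one⁻ num den lim (suc e') _ with lim ((+ 1) ℚ./ suc e') (/-< (+ 0) (+ 1) 0 e' (ℤ.+<+ (ℕ.s≤s ℕ.z≤n)))
... | X , close = X , λ x x≥ → ℤP.drop‿+<+ (subst₂ ℤ._<_ (lhs x) (rhs x)
      (/-<⁻ (+ δ x) (+ 1 ℤ.* + den x) 0 (e' ℕ.* 1) (subst₂ ℚ._<_ (left x) (/-* (+ 1) (+ den x) e' 0) (close x x≥))))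
  where
  δ : ℕ → ℕ
  δ x = ℤ.∣ + num x ℤ.- + den x ∣
  left : ∀ x → ℚ.∣ ℕ→ℚ (num x) ℚ.- 1ℚ ℚ.* ℕ→ℚ (den x) ∣ ≡ (+ δ x) ℚ./ 1
  left x = trans (cong ℚ.∣_∣ (trans (cong (ℚ._-_ (ℕ→ℚ (num x))) (ℚP.*-identityˡ (ℕ→ℚ (den x))))
    (/ᵗ-- (+ num x) (+ den x) 1))) (/-abs (+ num x ℤ.- + den x) 0)
  lhs : ∀ x → + δ x ℤ.* + (suc e' ℕ.* 1) ≡ + (suc e' ℕ.* δ x)
  lhs x = trans (sym (ℤP.pos-* (δ x) (suc e' ℕ.* 1))) (cong +_ (trans (cong (δ x ℕ.*_) (ℕP.*-identityʳ (suc e'))) (ℕP.*-comm (δ x) (suc e'))))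
  rhs : ∀ x → + 1 ℤ.* + den x ℤ.* + 1 ≡ + den x
  rhs x = trans (ℤP.*-identityʳ _) (ℤP.*-identityˡ _)

EventuallyIncreasing : (ℕ → ℤ) → Set
EventuallyIncreasing g = ∃ λ N → ∀ n → N ℕ.≤ n → g n ℤ.< g (suc n)

increasing-growth : ∀ {g : ℕ → ℤ} {N} → (∀ n → N ℕ.≤ n → g n ℤ.< g (suc n)) → ∀ i → g N ℤ.+ + i ℤ.≤ g (i ℕ.+ N)
increasing-growth {g} {N} inc zero    = ℤP.≤-reflexive (ℤP.+-identityʳ (g N))
increasing-growth {g} {N} inc (suc i) = ℤP.≤-trans (ℤP.≤-reflexive (lem (g N) (+ i)))
  (ℤP.≤-trans (ℤP.suc-mono (increasing-growth inc i)) (ℤP.i<j⇒suc[i]≤j (inc (i ℕ.+ N) (ℕP.m≤n+m N i))))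
  where
  lem : ∀ a i → a ℤ.+ (+ 1 ℤ.+ i) ≡ + 1 ℤ.+ (a ℤ.+ i)
  lem = solve-∀

increasing-unbounded : ∀ {g} → EventuallyIncreasing g → ∀ B → ∃ λ M →
  (∀ n → M ℕ.≤ n → B ℤ.≤ g n) × (∀ n → M ℕ.≤ n → g n ℤ.< g (suc n))
increasing-unbounded {g} (N , inc) B = i ℕ.+ N , bound , λ n n≥ → inc n (ℕP.≤-trans (ℕP.m≤n+m N i) n≥)
  where
  i = ℤ.∣ B ℤ.- g N ∣
  bound : ∀ n → i ℕ.+ N ℕ.≤ n → B ℤ.≤ g n
  bound n n≥ = ℤP.≤-trans (ℤP.≤-reflexive (lem B (g N))) (ℤP.≤-trans (ℤP.+-monoʳ-≤ (g N) step)
    (subst (λ m → g N ℤ.+ + (n ℕ.∸ N) ℤ.≤ g m) (ℕP.m∸n+n≡m (ℕP.≤-trans (ℕP.m≤n+m N i) n≥)) (increasing-growth inc (n ℕ.∸ N))))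
    where
    lem : ∀ b g → b ≡ g ℤ.+ (b ℤ.- g)
    lem = solve-∀
    i≤∣i∣ : ∀ z → z ℤ.≤ + ℤ.∣ z ∣
    i≤∣i∣ (+ _)    = ℤP.≤-refl
    i≤∣i∣ -[1+ _ ] = ℤ.-≤+
    step : B ℤ.- g N ℤ.≤ + (n ℕ.∸ N)
    step = ℤP.≤-trans (i≤∣i∣ (B ℤ.- g N)) (ℤ.+≤+ (subst (ℕ._≤ n ℕ.∸ N) (ℕP.m+n∸n≡m i N) (ℕP.∸-monoˡ-≤ N n≥)))

increasing-resp : ∀ {g h} → (∀ n → g n ≡ h n) → EventuallyIncreasing g → EventuallyIncreasing h
increasing-resp e (N , inc) = N , λ n n≥ → subst₂ ℤ._<_ (e n) (e (suc n)) (inc n n≥)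

-- One step of Horner's scheme: once g(n) ≥ 0 and g(n) + 1 ≤ g(n + 1), n·g(n) < (n + 1)(g(n) + 1) ≤
-- (n + 1)·g(n + 1).
increasing-shift : ∀ a {g} → EventuallyIncreasing g → EventuallyIncreasing (λ n → a ℤ.+ + n ℤ.* g n)
increasing-shift a {g} inc with increasing-unbounded inc (+ 0)
... | M , nonneg , inc' = M , λ n n≥ → ℤP.+-monoʳ-< a (ℤP.<-≤-trans (step n (g n) (nonneg n n≥))
        (ℤP.*-monoˡ-≤-nonNeg (+ suc n) (ℤP.i<j⇒suc[i]≤j (inc' n n≥))))
  where
  step : ∀ n z → + 0 ℤ.≤ z → + n ℤ.* z ℤ.< + suc n ℤ.* ℤ.suc z
  step n z z≥ = subst₂ ℤ._<_ (ℤP.+-identityʳ _) (sym (lem (+ n) z))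
    (ℤP.+-monoʳ-< (+ n ℤ.* z) (ℤP.+-mono-≤-< z≥ (ℤ.+<+ (ℕ.s≤s (ℕ.z≤n {n})))))
    where
    lem : ∀ n z → (+ 1 ℤ.+ n) ℤ.* (+ 1 ℤ.+ z) ≡ n ℤ.* z ℤ.+ (z ℤ.+ (+ 1 ℤ.+ n))
    lem = solve-∀

linear-increasing : ∀ a c → + 0 ℤ.< c → EventuallyIncreasing (λ n → a ℤ.+ + n ℤ.* c)
linear-increasing a c c> = 0 , λ n _ → ℤP.+-monoʳ-< a (subst₂ ℤ._<_ (ℤP.+-identityˡ (+ n ℤ.* c)) (sym (ℤP.suc-* (+ n) c)) (ℤP.+-monoˡ-< (+ n ℤ.* c) c>))

data Behaviour (g : ℕ → ℤ) : Set where
  constant   : ∀ c → (∀ n → g n ≡ c) → Behaviour g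
  increasing : EventuallyIncreasing g → Behaviour g
  decreasing : EventuallyIncreasing (ℤ.-_ ∘ g) → Behaviour g

-- Coefficient lists may end in zeros, so degree and leading coefficient cannot be read off.
-- Recursion on the list avoids both: the behaviour of the tail determines that of a + n·tail, up to
-- the sign of a constant tail.
behaviour : (f : Poly) → Behaviour (f ⟨_⟩)
behaviour []      = constant (+ 0) (λ _ → refl)
behaviour (a ∷ f) with behaviour f
... | increasing inc = increasing (increasing-shift a inc)
... | decreasing dec = decreasing (increasing-resp (λ n → lem a (+ n) (f ⟨ n ⟩)) (increasing-shift (ℤ.- a) dec))
  where
  lem : ∀ a n z → ℤ.- a ℤ.+ n ℤ.* ℤ.- z ≡ ℤ.- (a ℤ.+ n ℤ.* z)
  lem = solve-∀
... | constant c f≡c with ℤP.<-cmp (+ 0) c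
...   | tri< c>0 _ _  = increasing (increasing-resp (λ n → cong (λ z → a ℤ.+ + n ℤ.* z) (sym (f≡c n))) (linear-increasing a c c>0))
...   | tri≈ _ refl _ = constant a (λ n → trans (cong (λ z → a ℤ.+ + n ℤ.* z) (f≡c n))
                          (trans (cong (ℤ._+_ a) (ℤP.*-zeroʳ (+ n))) (ℤP.+-identityʳ a)))
...   | tri> _ _ c<0  = decreasing (increasing-resp (λ n → trans (lem a (+ n) c) (cong (λ z → ℤ.- (a ℤ.+ + n ℤ.* z)) (sym (f≡c n))))
                          (linear-increasing (ℤ.- a) (ℤ.- c) (ℤP.neg-mono-< c<0)))
  where
  lem : ∀ a n z → ℤ.- a ℤ.+ n ℤ.* ℤ.- z ≡ ℤ.- (a ℤ.+ n ℤ.* z)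
  lem = solve-∀

-- Comparing prime values with their arguments

hasCount-≤ : ∀ {P k} {l : List ℕ} → HasCount P k → (∀ p → P p → p ∈ l) → k ℕ.≤ length l
hasCount-≤ (l , u , iff , refl) sub = unique-⊆-length u (λ {p} p∈ → sub p (Equivalence.to (iff p) p∈))

hasCount-≥ : ∀ {P k} {l : List ℕ} → HasCount P k → Unique l → (∀ {p} → p ∈ l → P p) → length l ℕ.≤ k
hasCount-≥ (l , u , iff , refl) u' sub = unique-⊆-length u' (λ {p} p∈ → Equivalence.from (iff p) (sub p∈))

hasCount-⇔ : ∀ {P Q k} → (∀ p → P p ⇔ Q p) → HasCount P k → HasCount Q k
hasCount-⇔ P⇔Q (l , u , iff , len) = l , u , (λ p → mk⇔ (Equivalence.to (P⇔Q p) ∘ Equivalence.to (iff p))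
  (Equivalence.from (iff p) ∘ Equivalence.from (P⇔Q p))) , len

mod'-≋ : ∀ n M → M ≢ 0 → + (n mod' M) ≋ + n [ M ]
mod'-≋ n zero    M≢0 = contradiction refl M≢0
mod'-≋ n (suc M) _   = %ℕ-≋ (+ n) (suc M)

mod'-< : ∀ n M → M ≢ 0 → n mod' M ℕ.< M
mod'-< n zero    M≢0 = contradiction refl M≢0
mod'-< n (suc M) _   = ℕDM.m%n<n n (suc M)

primeℤ-abs : ∀ {z} → IsPrimeℤ z → z ≡ + ℤ.∣ z ∣ × Prime ℤ.∣ z ∣
primeℤ-abs {+ _} pr = refl , pr

gcd-prime-∣≢1 : ∀ {p m} → Prime p → p ℕD.∣ m → ℕG.gcd p m ≢ 1
gcd-prime-∣≢1 {p} pr d e = ℕPr.¬prime[1] (subst Prime (ℕC.gcd≡1⇒coprime e (ℕD.∣-refl , d)) pr)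

primeCount-mono : ∀ f {x y} → x ℕ.≤ y → primeValueCount f x ℕ.≤ primeValueCount f y
primeCount-mono f {x} {y} x≤y = unique-⊆-length (UniqueP.filter⁺ P? (UniqueP.upTo⁺ (suc x)))
  λ n∈ → let n∈up , pr = ∈-filter⁻ P? {xs = upTo (suc x)} n∈ in
    ∈-filter⁺ P? (∈-upTo⁺ (ℕP.<-≤-trans (∈-upTo⁻ n∈up) (ℕ.s≤s x≤y))) pr
  where P? = λ n → isPrimeℤ? (f ⟨ n ⟩)

primeCount-unbounded : ∀ f → InfinitelyManyPrimeValues f → ∀ m → ∃ λ y → m ℕ.≤ primeValueCount f y
primeCount-unbounded f inf zero    = 0 , ℕ.z≤n
primeCount-unbounded f inf (suc m) with primeCount-unbounded f inf m
... | y , m≤ with inf (suc y)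
...   | n , y<n , pr = n , ℕP.≤-trans (ℕ.s≤s m≤) (unique-⊆-length
        (All.tabulate (λ { j∈ refl → ℕP.<⇒≱ (∈-upTo⁻ (proj₁ (∈-filter⁻ P? {xs = upTo (suc y)} j∈))) y<n })
          ∷ UniqueP.filter⁺ P? (UniqueP.upTo⁺ (suc y)))
        λ { (here refl) → ∈-filter⁺ P? (∈-upTo⁺ ℕP.≤-refl) pr
          ; (there j∈) → let j∈up , prj = ∈-filter⁻ P? {xs = upTo (suc y)} j∈ in
              ∈-filter⁺ P? (∈-upTo⁺ (ℕP.<-≤-trans (∈-upTo⁻ j∈up) (ℕP.m≤n⇒m≤1+n y<n))) prj })
  where P? = λ n → isPrimeℤ? (f ⟨ n ⟩)

∑-delta : ∀ {P : Set} (P? : Dec P) c (l : List ℕ) → Unique l → c ∈ l →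
  ∑ (λ a → 𝟙 (c ℕ.≟ a ×-dec P?)) l ≡ 𝟙 P?
∑-delta P? c (a ∷ l) (a∉ ∷ u) (here refl) = trans
  (cong₂ ℤ._+_ (𝟙-⇔ (c ℕ.≟ c ×-dec P?) P? proj₂ (refl ,_))
    (trans (∑-cong l (λ {a} a∈ → 𝟙-no (c ℕ.≟ a ×-dec P?) (λ (e , _) → All.lookup a∉ a∈ e))) (∑-0 l)))
  (ℤP.+-identityʳ _)
  where
  𝟙-no : {Q : Set} (q : Dec Q) → ¬ Q → 𝟙 q ≡ + 0
  𝟙-no (yes q) ¬q = contradiction q ¬q
  𝟙-no (no _)  _  = refl
∑-delta P? c (a ∷ l) (a∉ ∷ u) (there c∈) = trans
  (cong₂ ℤ._+_ (𝟙-⇔ (c ℕ.≟ a ×-dec P?) (no (λ ())) (λ (e , _) → All.lookup a∉ c∈ (sym e)) (λ ())) (∑-delta P? c l u c∈))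
  (ℤP.+-identityˡ _)

∑-delta-∉ : ∀ {P : Set} (P? : Dec P) c (l : List ℕ) → c ∉ l →
  ∑ (λ a → 𝟙 (c ℕ.≟ a ×-dec P?)) l ≡ + 0
∑-delta-∉ P? c l c∉ = trans (∑-cong l (λ {a} a∈ → 𝟙-⇔ (c ℕ.≟ a ×-dec P?) (no (λ ()))
  (λ { (refl , _) → c∉ a∈ }) (λ ()))) (∑-0 l)

module Increasing (f : Poly) (N : ℕ) (inc : ∀ n → N ℕ.≤ n → f ⟨ n ⟩ ℤ.< f ⟨ suc n ⟩)
  (nonneg : ∀ n → N ℕ.≤ n → + 0 ℤ.≤ f ⟨ n ⟩) where

  v : ℕ → ℕ
  v n = ℤ.∣ f ⟨ n ⟩ ∣

  v-pos : ∀ {n} → N ℕ.≤ n → + v n ≡ f ⟨ n ⟩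
  v-pos n≥ = ℤP.0≤i⇒+∣i∣≡i (nonneg _ n≥)

  v-suc : ∀ {n} → N ℕ.≤ n → v n ℕ.< v (suc n)
  v-suc {n} n≥ = ℤP.drop‿+<+ (subst₂ ℤ._<_ (sym (v-pos n≥)) (sym (v-pos (ℕP.m≤n⇒m≤1+n n≥))) (inc n n≥))

  v-mono : ∀ {m n} → N ℕ.≤ m → m ℕ.≤ n → v m ℕ.≤ v n
  v-mono {m} {n} m≥ m≤n = subst (λ z → v m ℕ.≤ v z) (ℕP.m∸n+n≡m m≤n) (go (n ℕ.∸ m))
    where
    go : ∀ i → v m ℕ.≤ v (i ℕ.+ m)
    go zero    = ℕP.≤-refl
    go (suc i) = ℕP.≤-trans (go i) (ℕP.<⇒≤ (v-suc (ℕP.≤-trans m≥ (ℕP.m≤n+m m i))))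

  v-strict : ∀ {m n} → N ℕ.≤ m → m ℕ.< n → v m ℕ.< v n
  v-strict m≥ m<n = ℕP.<-≤-trans (v-suc m≥) (v-mono (ℕP.m≤n⇒m≤1+n m≥) m<n)

  v-inj : ∀ {m n} → N ℕ.≤ m → N ℕ.≤ n → v m ≡ v n → m ≡ n
  v-inj {m} {n} m≥ n≥ e with ℕP.<-cmp m n
  ... | tri< lt _ _ = contradiction e (ℕP.<⇒≢ (v-strict m≥ lt))
  ... | tri≈ _ eq _ = eq
  ... | tri> _ _ gt = contradiction (sym e) (ℕP.<⇒≢ (v-strict n≥ gt))

  v-growth : ∀ i → i ℕ.≤ v (i ℕ.+ N)
  v-growth zero    = ℕ.z≤n
  v-growth (suc i) = ℕP.≤-<-trans (v-growth i) (v-suc (ℕP.m≤n+m N i))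

  -- Cutting primes at x amounts to cutting arguments at this Y. The search starts at an argument
  -- whose value exceeds x, which exists because values grow at least as fast as arguments.
  last-below : ∀ x → v N ℕ.≤ x → ∃ λ Y → N ℕ.≤ Y × v Y ℕ.≤ x × x ℕ.< v (suc Y)
  last-below x vN≤x = search (suc x) (v-growth (suc x))
    where
    search : ∀ i → x ℕ.< v (i ℕ.+ N) → ∃ λ Y → N ℕ.≤ Y × v Y ℕ.≤ x × x ℕ.< v (suc Y)
    search zero    x< = contradiction vN≤x (ℕP.<⇒≱ x<)
    search (suc i) x< with v (i ℕ.+ N) ℕ.≤? x
    ... | yes v≤ = i ℕ.+ N , ℕP.m≤n+m N i , v≤ , x<
    ... | no v≰  = search i (ℕP.≰⇒> v≰)

  -- For n ≥ N, n ≤ Y holds exactly when the value is at most x, and the values are distinct, so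
  -- arguments and primes correspond one to one. The fewer than N + 1 arguments below N account for
  -- the error. `Q` is a property of primes, and `G` is the same property read off the argument.
  module Compare {x Y : ℕ} (Y≥N : N ℕ.≤ Y) (vY≤x : v Y ℕ.≤ x) (x<vY : x ℕ.< v (suc Y))
    {Q G : ℕ → Set} (G? : Decidable G)
    (Q⇒G : ∀ n → N ℕ.≤ n → IsPrimeℤ (f ⟨ n ⟩) → Q (v n) → G n)
    (G⇒Q : ∀ n → N ℕ.≤ n → IsPrimeℤ (f ⟨ n ⟩) → G n → Q (v n))
    {m : ℕ} (count : HasCount (λ p → p ℕ.≤ x × PrimeOfForm f p × Q p) m) where

    P? : Decidable (λ n → IsPrimeℤ (f ⟨ n ⟩) × G n)
    P? n = isPrimeℤ? (f ⟨ n ⟩) ×-dec G? n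

    all tail : List ℕ
    all  = filter P? (upTo (suc Y))
    tail = filter (N ℕ.≤?_) all

    all-unique : Unique all
    all-unique = UniqueP.filter⁺ P? (UniqueP.upTo⁺ (suc Y))

    tail⁻ : ∀ {n} → n ∈ tail → N ℕ.≤ n × n ℕ.≤ Y × IsPrimeℤ (f ⟨ n ⟩) × G n
    tail⁻ n∈ = let n∈all , n≥ = ∈-filter⁻ (N ℕ.≤?_) {xs = all} n∈
                   n∈up , pr , g = ∈-filter⁻ P? {xs = upTo (suc Y)} n∈all
               in n≥ , ℕ.s≤s⁻¹ (∈-upTo⁻ n∈up) , pr , g

    tail⁺ : ∀ {n} → N ℕ.≤ n → n ℕ.≤ Y → IsPrimeℤ (f ⟨ n ⟩) → G n → n ∈ tail
    tail⁺ n≥ n≤ pr g = ∈-filter⁺ (N ℕ.≤?_) (∈-filter⁺ P? (∈-upTo⁺ (ℕ.s≤s n≤)) (pr , g)) n≥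

    all≤tail : length all ℕ.≤ N ℕ.+ length tail
    all≤tail = subst (length all ℕ.≤_) (trans (length-++ (upTo N)) (cong (ℕ._+ length tail) (length-upTo N)))
      (unique-⊆-length all-unique split)
      where
      split : ∀ {n} → n ∈ all → n ∈ upTo N ++ tail
      split {n} n∈ with N ℕ.≤? n
      ... | yes n≥ = ∈-++⁺ʳ (upTo N) (∈-filter⁺ (N ℕ.≤?_) n∈ n≥)
      ... | no n≱  = ∈-++⁺ˡ (∈-upTo⁺ (ℕP.≰⇒> n≱))

    tail≤count : length tail ℕ.≤ m
    tail≤count = subst (ℕ._≤ m) (length-map v tail) (hasCount-≥ count
      (unique-map v (λ i∈ j∈ → v-inj (proj₁ (tail⁻ i∈)) (proj₁ (tail⁻ j∈))) (UniqueP.filter⁺ (N ℕ.≤?_) all-unique))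
      λ p∈ → case ∈-map⁻ v p∈ of λ { (n , n∈ , refl) → let n≥ , n≤ , pr , g = tail⁻ n∈ in
        ℕP.≤-trans (v-mono n≥ n≤) vY≤x , (proj₂ (primeℤ-abs pr) , n , sym (v-pos n≥)) , G⇒Q n n≥ pr g })

    count≤tail : m ℕ.≤ N ℕ.+ length tail
    count≤tail = subst (m ℕ.≤_) (trans (length-map v (upTo N ++ tail))
        (trans (length-++ (upTo N)) (cong (ℕ._+ length tail) (length-upTo N))))
      (hasCount-≤ count λ { p (p≤x , (pr , n , fn≡p) , q) → value p≤x pr n fn≡p q })
      where
      value : ∀ {p} → p ℕ.≤ x → Prime p → ∀ n → f ⟨ n ⟩ ≡ + p → Q p → p ∈ map v (upTo N ++ tail)
      value {p} p≤x pr n fn≡p q = subst (_∈ map v (upTo N ++ tail)) vn≡p (∈-map⁺ v n∈)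
        where
        vn≡p : v n ≡ p
        vn≡p = cong ℤ.∣_∣ fn≡p
        prn : IsPrimeℤ (f ⟨ n ⟩)
        prn = subst IsPrimeℤ (sym fn≡p) pr
        n∈ : n ∈ upTo N ++ tail
        n∈ with N ℕ.≤? n
        ... | no n≱  = ∈-++⁺ˡ (∈-upTo⁺ (ℕP.≰⇒> n≱))
        ... | yes n≥ = ∈-++⁺ʳ (upTo N) (tail⁺ n≥
              (ℕP.≮⇒≥ λ Y<n → ℕP.<⇒≱ (ℕP.<-≤-trans x<vY (v-mono (ℕP.m≤n⇒m≤1+n Y≥N) Y<n)) (subst (ℕ._≤ x) (sym vn≡p) p≤x))
              prn (Q⇒G n n≥ prn (subst Q (sym vn≡p) q)))

    count≤ : m ℕ.≤ N ℕ.+ length all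
    count≤ = ℕP.≤-trans count≤tail (ℕP.+-monoʳ-≤ N (length-filter (N ℕ.≤?_) all))

    count≥ : length all ℕ.≤ N ℕ.+ m
    count≥ = ℕP.≤-trans all≤tail (ℕP.+-monoʳ-≤ N tail≤count)

abs-close : ∀ {m n N} → m ℕ.≤ N ℕ.+ n → n ℕ.≤ N ℕ.+ m → ℤ.∣ + m ℤ.- + n ∣ ℕ.≤ N
abs-close {m} {n} {N} p q with ℕP.≤-total m n
... | inj₁ m≤n = subst (ℕ._≤ N) (sym (trans (ℤP.∣i-j∣≡∣j-i∣ (+ m) (+ n)) (trans (cong ℤ.∣_∣ (ℤP.m-n≡m⊖n n m)) (cong ℤ.∣_∣ (ℤP.⊖-≥ m≤n)))))
      (ℕP.m≤n+o⇒m∸n≤o n m (subst (n ℕ.≤_) (ℕP.+-comm N m) q))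
... | inj₂ n≤m = subst (ℕ._≤ N) (sym (trans (cong ℤ.∣_∣ (ℤP.m-n≡m⊖n m n)) (cong ℤ.∣_∣ (ℤP.⊖-≥ n≤m))))
      (ℕP.m≤n+o⇒m∸n≤o m n (subst (m ℕ.≤_) (ℕP.+-comm N n) p))

length-filter-⇔ : {B : Set} {P Q : B → Set} (P? : Decidable P) (Q? : Decidable Q) (l : List B) →
  (∀ x → P x → Q x) → (∀ x → Q x → P x) → length (filter P? l) ≡ length (filter Q? l)
length-filter-⇔ P? Q? l f g = ℤP.+-injective (trans (length-filter-∑ P? l)
  (trans (∑-cong l (λ {x} _ → 𝟙-⇔ (P? x) (Q? x) (f x) (g x))) (sym (length-filter-∑ Q? l))))

uniform-threshold : (P : ℕ → ℕ → Set) (l : List ℕ) → (∀ {a} → a ∈ l → ∃ λ X → ∀ x → X ℕ.≤ x → P a x) →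
  ∃ λ X → ∀ x → X ℕ.≤ x → ∀ {a} → a ∈ l → P a x
uniform-threshold P []      h = 0 , λ _ _ ()
uniform-threshold P (a ∷ l) h with h (here refl) | uniform-threshold P l (h ∘ there)
... | X , hX | Y , hY = X ℕ.⊔ Y , λ { x x≥ (here refl) → hX x (ℕP.m⊔n≤o⇒m≤o X Y x≥)
                                    ; x x≥ (there a∈)  → hY x (ℕP.m⊔n≤o⇒n≤o X Y x≥) a∈ }

-- The triangle inequality over the classes, each deviating by at most c/e.
∑-deviation : (g : ℕ → ℕ) (e k c : ℕ) (l : List ℕ) → (∀ {a} → a ∈ l → e ℕ.* ℤ.∣ + (k ℕ.* g a) ℤ.- + c ∣ ℕ.≤ c) →
  e ℕ.* ℤ.∣ + k ℤ.* ∑ (λ a → + g a) l ℤ.- + (length l ℕ.* c) ∣ ℕ.≤ length l ℕ.* c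
∑-deviation g e k c []      h = ℕP.≤-reflexive (trans (cong (λ z → e ℕ.* ℤ.∣ z ℤ.- + 0 ∣) (ℤP.*-zeroʳ (+ k))) (ℕP.*-zeroʳ e))
∑-deviation g e k c (a ∷ l) h = begin
  e ℕ.* ℤ.∣ + k ℤ.* (+ g a ℤ.+ S) ℤ.- (+ c ℤ.+ + (length l ℕ.* c)) ∣
    ≡⟨ cong (λ z → e ℕ.* ℤ.∣ z ∣) (trans (lem (+ k) (+ g a) S (+ c) (+ (length l ℕ.* c))) (cong (λ z → z ℤ.- + c ℤ.+ R) (sym (ℤP.pos-* k (g a))))) ⟩
  e ℕ.* ℤ.∣ + (k ℕ.* g a) ℤ.- + c ℤ.+ R ∣
    ≤⟨ ℕP.*-monoʳ-≤ e (ℤP.∣i+j∣≤∣i∣+∣j∣ (+ (k ℕ.* g a) ℤ.- + c) R) ⟩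
  e ℕ.* (ℤ.∣ + (k ℕ.* g a) ℤ.- + c ∣ ℕ.+ ℤ.∣ R ∣)
    ≡⟨ ℕP.*-distribˡ-+ e _ ℤ.∣ R ∣ ⟩
  e ℕ.* ℤ.∣ + (k ℕ.* g a) ℤ.- + c ∣ ℕ.+ e ℕ.* ℤ.∣ R ∣
    ≤⟨ ℕP.+-mono-≤ (h (here refl)) (∑-deviation g e k c l (h ∘ there)) ⟩
  c ℕ.+ length l ℕ.* c ∎
  where
  open ℕP.≤-Reasoning
  S = ∑ (λ a → + g a) l
  R = + k ℤ.* S ℤ.- + (length l ℕ.* c)
  lem : ∀ k g s c d → k ℤ.* (g ℤ.+ s) ℤ.- (c ℤ.+ d) ≡ k ℤ.* g ℤ.- c ℤ.+ (k ℤ.* s ℤ.- d)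
  lem = solve-∀

-- m, m' are the two prime counts up to x, and A, c the corresponding counts of arguments n.
deviation-estimate : ∀ e k b N m m' A c → 0 ℕ.< k →
  ℤ.∣ + m ℤ.- + A ∣ ℕ.≤ N → ℤ.∣ + m' ℤ.- + c ∣ ℕ.≤ N → c ℕ.≤ N ℕ.+ m' →
  (2 ℕ.* e ℕ.* suc b) ℕ.* ℤ.∣ + k ℤ.* + A ℤ.- + (b ℕ.* c) ∣ ℕ.≤ b ℕ.* c →
  2 ℕ.* e ℕ.* (k ℕ.* N ℕ.+ b ℕ.* N) ℕ.+ N ℕ.< m' →
  e ℕ.* deviation k b m m' ℕ.< k ℕ.* m'
deviation-estimate e k b N m m' A c k>0 mA m'c c≤ Δ≤ C<m' = ℕP.*-cancelˡ-< 2 _ _ (begin-strict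
  2 ℕ.* (e ℕ.* deviation k b m m')                          ≡⟨ sym (ℕP.*-assoc 2 e _) ⟩
  2 ℕ.* e ℕ.* deviation k b m m'                            ≤⟨ ℕP.*-monoʳ-≤ (2 ℕ.* e) dev≤ ⟩
  2 ℕ.* e ℕ.* (k ℕ.* N ℕ.+ b ℕ.* N ℕ.+ Δ)             ≡⟨ ℕP.*-distribˡ-+ (2 ℕ.* e) (k ℕ.* N ℕ.+ b ℕ.* N) Δ ⟩
  2 ℕ.* e ℕ.* (k ℕ.* N ℕ.+ b ℕ.* N) ℕ.+ 2 ℕ.* e ℕ.* Δ ≤⟨ ℕP.+-monoʳ-≤ _ (ℕP.≤-trans 2eΔ≤c c≤) ⟩
  2 ℕ.* e ℕ.* (k ℕ.* N ℕ.+ b ℕ.* N) ℕ.+ (N ℕ.+ m')    ≡⟨ sym (ℕP.+-assoc _ N m') ⟩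
  2 ℕ.* e ℕ.* (k ℕ.* N ℕ.+ b ℕ.* N) ℕ.+ N ℕ.+ m'      <⟨ ℕP.+-monoˡ-< m' C<m' ⟩
  m' ℕ.+ m'                                           ≡⟨ cong (m' ℕ.+_) (sym (ℕP.+-identityʳ m')) ⟩
  2 ℕ.* m'                                            ≤⟨ ℕP.*-monoʳ-≤ 2 (ℕP.≤-trans (ℕP.≤-reflexive (sym (ℕP.*-identityˡ m'))) (ℕP.*-monoˡ-≤ m' k>0)) ⟩
  2 ℕ.* (k ℕ.* m')                                    ∎)
  where
  open ℕP.≤-Reasoning
  Δ = ℤ.∣ + k ℤ.* + A ℤ.- + (b ℕ.* c) ∣
  -- Cancelling `suc b` instead of `b` covers the case without inert classes.
  2eΔ≤c : 2 ℕ.* e ℕ.* Δ ℕ.≤ c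
  2eΔ≤c = ℕP.*-cancelˡ-≤ (suc b) (begin
    suc b ℕ.* (2 ℕ.* e ℕ.* Δ)    ≡⟨ sym (ℕP.*-assoc (suc b) (2 ℕ.* e) Δ) ⟩
    suc b ℕ.* (2 ℕ.* e) ℕ.* Δ    ≡⟨ cong (ℕ._* Δ) (ℕP.*-comm (suc b) (2 ℕ.* e)) ⟩
    2 ℕ.* e ℕ.* suc b ℕ.* Δ      ≤⟨ Δ≤ ⟩
    b ℕ.* c                      ≤⟨ ℕP.m≤n+m (b ℕ.* c) c ⟩
    suc b ℕ.* c                  ∎)
  u w : ℤ
  u = + k ℤ.* (+ m ℤ.- + A)
  w = + b ℤ.* (+ m' ℤ.- + c)
  split : + (m ℕ.* k) ℤ.- + (b ℕ.* m') ≡ u ℤ.- w ℤ.+ (+ k ℤ.* + A ℤ.- + (b ℕ.* c))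
  split = trans (cong₂ ℤ._-_ (ℤP.pos-* m k) (ℤP.pos-* b m'))
    (trans (lem (+ m) (+ k) (+ b) (+ m') (+ A) (+ c)) (cong (λ z → u ℤ.- w ℤ.+ (+ k ℤ.* + A ℤ.- z)) (sym (ℤP.pos-* b c))))
    where
    lem : ∀ m k b m' A c → m ℤ.* k ℤ.- b ℤ.* m' ≡ k ℤ.* (m ℤ.- A) ℤ.- b ℤ.* (m' ℤ.- c) ℤ.+ (k ℤ.* A ℤ.- b ℤ.* c)
    lem = solve-∀
  dev≤ : deviation k b m m' ℕ.≤ k ℕ.* N ℕ.+ b ℕ.* N ℕ.+ Δ
  dev≤ = begin
    deviation k b m m'                                                       ≡⟨ cong ℤ.∣_∣ split ⟩
    ℤ.∣ u ℤ.- w ℤ.+ (+ k ℤ.* + A ℤ.- + (b ℕ.* c)) ∣                      ≤⟨ ℤP.∣i+j∣≤∣i∣+∣j∣ (u ℤ.- w) _ ⟩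
    ℤ.∣ u ℤ.- w ∣ ℕ.+ Δ                                                 ≤⟨ ℕP.+-monoˡ-≤ Δ (ℤP.∣i-j∣≤∣i∣+∣j∣ u w) ⟩
    ℤ.∣ u ∣ ℕ.+ ℤ.∣ w ∣ ℕ.+ Δ                                           ≡⟨ cong₂ (λ x y → x ℕ.+ y ℕ.+ Δ) (ℤP.abs-* (+ k) _) (ℤP.abs-* (+ b) _) ⟩
    k ℕ.* ℤ.∣ + m ℤ.- + A ∣ ℕ.+ b ℕ.* ℤ.∣ + m' ℤ.- + c ∣ ℕ.+ Δ          ≤⟨ ℕP.+-monoˡ-≤ Δ (ℕP.+-mono-≤ (ℕP.*-monoʳ-≤ k mA) (ℕP.*-monoʳ-≤ b m'c)) ⟩
    k ℕ.* N ℕ.+ b ℕ.* N ℕ.+ Δ                                           ∎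

neg-prime≱1 : ∀ {z} → IsPrimeℤ z → ¬ + 1 ℤ.≤ ℤ.- z
neg-prime≱1 {z} pr 1≤ = contradiction (ℤP.≤-trans 1≤ (ℤP.neg-mono-≤ 0≤z)) λ { (ℤ.+≤+ ()) }
  where
  0≤z : + 0 ℤ.≤ z
  0≤z = ℤP.+∣i∣≡i⇒0≤i (sym (proj₁ (primeℤ-abs pr)))

decreasing-impossible : ∀ f → InfinitelyManyPrimeValues f → ¬ EventuallyIncreasing (ℤ.-_ ∘ (f ⟨_⟩))
decreasing-impossible f inf dec =
  let N , large , _ = increasing-unbounded dec (+ 1)
      n , n≥ , pr   = inf N
  in neg-prime≱1 pr (large n n≥)

-- The limit of the proportion

module Limit (f : Poly) {D : ℤ} (disc : Disc D)
  (πf : ℕ → ℕ) (πf-count : ∀ x → HasCount (λ p → p ℕ.≤ x × PrimeOfForm f p) (πf x))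
  (πi : ℕ → ℕ) (πi-count : ∀ x → HasCount (λ p → p ℕ.≤ x × PrimeOfForm f p × Inert D p) (πi x)) where

  open Disc disc
  open Discriminant disc using (inert⇔χ)
  open Character disc
  open Formula f disc

  M : ℕ
  M = ℤ.∣ D ∣

  χ-class : ∀ n → χD (f ⟨ n mod' M ⟩) ≡ χD (f ⟨ n ⟩)
  χ-class n = χ-periodic (≋-eval f (mod'-≋ n M D≢0))

  χ≢0⇒good : ∀ a → χD (f ⟨ a ⟩) ≢ + 0 → goodClass f D a
  χ≢0⇒good a χ≢0 with ℕG.gcd ℤ.∣ f ⟨ a ⟩ ∣ M ℕ.≟ 1
  ... | yes e = cong +_ e
  ... | no ne = contradiction (χ-non-coprime (f ⟨ a ⟩) ne) χ≢0

  χ-prime : ∀ {p} → Prime p → ¬ p ℕD.∣ M → IsSign (χD (+ p))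
  χ-prime {p} pr p∤D = χ-coprime (+ p) (prime∤⇒coprime pr p∤D)

  sign≢0 : ∀ {z} → IsSign z → z ≢ + 0
  sign≢0 (inj₁ refl) ()
  sign≢0 (inj₂ refl) ()

  k-positive : ∀ n → χD (f ⟨ n ⟩) ≢ + 0 → 0 ℕ.< k
  k-positive n χ≢0 = ∈-length (∈-filter⁺ (goodClass? f D) (∈-upTo⁺ (mod'-< n M D≢0))
    (χ≢0⇒good (n mod' M) (χ≢0 ∘ trans (sym (χ-class n)))))

  inertCount : ℕ → ℕ
  inertCount Y = length (filter (λ n → isPrimeℤ? (f ⟨ n ⟩) ×-dec inertClass? n) (upTo (suc Y)))

  -- Double counting: an argument lies in one class modulo |D|, and χ at that class equals χ at the
  -- argument.
  inertCount-∑ : ∀ Y → + inertCount Y ≡ ∑ (λ a → + primeValueCountIn f M a Y) inertClasses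
  inertCount-∑ Y = begin
    + inertCount Y
      ≡⟨ length-filter-∑ (λ n → isPrimeℤ? (f ⟨ n ⟩) ×-dec inertClass? n) (upTo (suc Y)) ⟩
    ∑ (λ n → 𝟙 (isPrimeℤ? (f ⟨ n ⟩) ×-dec inertClass? n)) (upTo (suc Y))
      ≡⟨ ∑-cong (upTo (suc Y)) (λ {n} _ → by-class n) ⟩
    ∑ (λ n → ∑ (λ a → 𝟙 ((n mod' M) ℕ.≟ a ×-dec isPrimeℤ? (f ⟨ n ⟩))) inertClasses) (upTo (suc Y))
      ≡⟨ ∑-swap (λ n a → 𝟙 ((n mod' M) ℕ.≟ a ×-dec isPrimeℤ? (f ⟨ n ⟩))) (upTo (suc Y)) inertClasses ⟩
    ∑ (λ a → ∑ (λ n → 𝟙 ((n mod' M) ℕ.≟ a ×-dec isPrimeℤ? (f ⟨ n ⟩))) (upTo (suc Y))) inertClasses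
      ≡⟨ ∑-cong inertClasses (λ {a} _ → sym (length-filter-∑ (λ n → (n mod' M) ℕ.≟ a ×-dec isPrimeℤ? (f ⟨ n ⟩)) (upTo (suc Y)))) ⟩
    ∑ (λ a → + primeValueCountIn f M a Y) inertClasses ∎
    where
    open ≡-Reasoning
    by-class : ∀ n → 𝟙 (isPrimeℤ? (f ⟨ n ⟩) ×-dec inertClass? n) ≡
      ∑ (λ a → 𝟙 ((n mod' M) ℕ.≟ a ×-dec isPrimeℤ? (f ⟨ n ⟩))) inertClasses
    by-class n with inertClass? n
    ... | yes e = trans (𝟙-⇔ (isPrimeℤ? (f ⟨ n ⟩) ×-dec yes e) (isPrimeℤ? (f ⟨ n ⟩)) proj₁ (_, e))
          (sym (∑-delta (isPrimeℤ? (f ⟨ n ⟩)) (n mod' M) inertClasses (UniqueP.filter⁺ inertClass? (UniqueP.upTo⁺ M))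
            (∈-filter⁺ inertClass? (∈-upTo⁺ (mod'-< n M D≢0)) (trans (χ-class n) e))))
    ... | no ne = trans (𝟙-⇔ (isPrimeℤ? (f ⟨ n ⟩) ×-dec no ne) (no (λ ())) (ne ∘ proj₂) (λ ()))
          (sym (∑-delta-∉ (isPrimeℤ? (f ⟨ n ⟩)) (n mod' M) inertClasses
            λ c∈ → ne (trans (sym (χ-class n)) (proj₂ (∈-filter⁻ inertClass? {xs = upTo M} c∈)))))

  inertClass-good : ∀ {a} → a ∈ inertClasses → a ℕ.< M × goodClass f D a
  inertClass-good {a} a∈ = let a∈up , e = ∈-filter⁻ inertClass? {xs = upTo M} a∈ in
    ∈-upTo⁻ a∈up , χ≢0⇒good a (sign≢0 (inj₂ e))

  RatioConverges : Set
  RatioConverges = RatioTendsTo (λ x → ℕ→ℚ (πi x)) (λ x → ℕ→ℚ (πf x)) τ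

  module _ (inf : InfinitelyManyPrimeValues f) (equi : Equidistributed f D) where

    -- Values above |D| cannot divide D, so beyond `N` inertness of a prime value is decided by χ.
    module IncreasingBeyond (N : ℕ) (large : ∀ n → N ℕ.≤ n → + suc M ℤ.≤ f ⟨ n ⟩)
      (inc : ∀ n → N ℕ.≤ n → f ⟨ n ⟩ ℤ.< f ⟨ suc n ⟩) where

      open Increasing f N inc (λ n n≥ → ℤP.≤-trans (ℤ.+≤+ ℕ.z≤n) (large n n≥))

      value∤D : ∀ n → N ℕ.≤ n → ¬ v n ℕD.∣ M
      value∤D n n≥ d = ℕP.<⇒≱ (ℤP.drop‿+≤+ (subst (+ suc M ℤ.≤_) (sym (v-pos n≥)) (large n n≥)))
        (ℕD.∣⇒≤ {{ℕ.≢-nonZero D≢0}} d)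

      k>0 : 0 ℕ.< k
      k>0 = let n , n≥ , pr = inf N
                fn≡ , prv   = primeℤ-abs pr
            in k-positive n (sign≢0 (subst (IsSign ∘ χD) (sym fn≡) (χ-prime prv (value∤D n n≥))))

      eventually : ∀ e → 0 ℕ.< e → ∃ λ X → ∀ x → X ℕ.≤ x → e ℕ.* deviation k b (πi x) (πf x) ℕ.< k ℕ.* πf x
      eventually e e>0 = v Y₀ , estimate
        where
        e' C : ℕ
        -- The allowed deviation is split in halves. `e'` makes the equidistribution error over all
        -- inert classes at most 1/(2e) of the number of prime values; `C` collects the bounded
        -- errors (k + b)N, scaled by 2e, and the N lost between arguments and primes.
        e' = 2 ℕ.* e ℕ.* suc b
        C = 2 ℕ.* e ℕ.* (k ℕ.* N ℕ.+ b ℕ.* N) ℕ.+ N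
        equi-threshold : ∃ λ X → ∀ x → X ℕ.≤ x → ∀ {a} → a ∈ inertClasses →
          e' ℕ.* ℤ.∣ + (k ℕ.* primeValueCountIn f M a x) ℤ.- + primeValueCount f x ∣ ℕ.< primeValueCount f x
        equi-threshold = uniform-threshold _ inertClasses λ {a} a∈ → let a< , good = inertClass-good a∈ in
          ratio-one⁻ (λ x → k ℕ.* primeValueCountIn f M a x) (primeValueCount f) (equi a a< good) e'
            (ℕP.*-mono-< {0} {2 ℕ.* e} (ℕP.*-mono-< {0} {2} (ℕ.s≤s ℕ.z≤n) e>0) (ℕ.s≤s ℕ.z≤n))
        -- The extra N pays for passing from arguments to primes, leaving πf x > C.
        many : ∃ λ y → N ℕ.+ suc C ℕ.≤ primeValueCount f y
        many = primeCount-unbounded f inf (N ℕ.+ suc C)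
        Xe = proj₁ equi-threshold
        y₁ = proj₁ many
        Y₀ = N ℕ.⊔ (Xe ℕ.⊔ y₁)
        estimate : ∀ x → v Y₀ ℕ.≤ x → e ℕ.* deviation k b (πi x) (πf x) ℕ.< k ℕ.* πf x
        estimate x x≥ = at (last-below x (ℕP.≤-trans (v-mono ℕP.≤-refl (ℕP.m≤m⊔n N _)) x≥))
          where
          at : (∃ λ Y → N ℕ.≤ Y × v Y ℕ.≤ x × x ℕ.< v (suc Y)) → e ℕ.* deviation k b (πi x) (πf x) ℕ.< k ℕ.* πf x
          at (Y , Y≥N , vY≤x , x<vY) = deviation-estimate e k b N (πi x) (πf x) (inertCount Y) (primeValueCount f Y) k>0
                (abs-close I.count≤ I.count≥) (abs-close (subst (λ z → πf x ℕ.≤ N ℕ.+ z) all≡ F.count≤) c≤) c≤ Δ≤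
                (ℕP.+-cancelˡ-≤ N _ _ (ℕP.≤-trans (proj₂ many) (ℕP.≤-trans (primeCount-mono f y₁≤Y) c≤)))
            where
            Y₀≤Y : Y₀ ℕ.≤ Y
            Y₀≤Y = ℕP.≮⇒≥ λ Y<Y₀ → ℕP.<⇒≱ x<vY (ℕP.≤-trans (v-mono (ℕP.m≤n⇒m≤1+n Y≥N) Y<Y₀) x≥)
            Xe≤Y : Xe ℕ.≤ Y
            Xe≤Y = ℕP.≤-trans (ℕP.≤-trans (ℕP.m≤m⊔n Xe y₁) (ℕP.m≤n⊔m N _)) Y₀≤Y
            y₁≤Y : y₁ ℕ.≤ Y
            y₁≤Y = ℕP.≤-trans (ℕP.≤-trans (ℕP.m≤n⊔m Xe y₁) (ℕP.m≤n⊔m N _)) Y₀≤Y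
            inert-prime : ∀ n → N ℕ.≤ n → IsPrimeℤ (f ⟨ n ⟩) → Inert D (v n) ⇔ χD (f ⟨ n ⟩) ≡ -[1+ 0 ]
            inert-prime n n≥ pr = subst (λ z → Inert D (v n) ⇔ χD z ≡ -[1+ 0 ]) (v-pos n≥)
              (inert⇔χ (proj₂ (primeℤ-abs pr)) (value∤D n n≥))
            module I = Compare {x} {Y} Y≥N vY≤x x<vY {Inert D} inertClass?
              (λ n n≥ pr → Equivalence.to (inert-prime n n≥ pr))
              (λ n n≥ pr → Equivalence.from (inert-prime n n≥ pr)) (πi-count x)
            πf-count' : HasCount (λ p → p ℕ.≤ x × PrimeOfForm f p × ⊤) (πf x)
            πf-count' = hasCount-⇔ (λ p → mk⇔ (λ (p≤ , pf) → p≤ , pf , tt) (λ (p≤ , pf , _) → p≤ , pf)) (πf-count x)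
            module F = Compare {x} {Y} Y≥N vY≤x x<vY {λ _ → ⊤} {λ _ → ⊤} (λ _ → yes tt)
              (λ _ _ _ _ → tt) (λ _ _ _ _ → tt) πf-count'
            all≡ : length F.all ≡ primeValueCount f Y
            all≡ = length-filter-⇔ F.P? (λ n → isPrimeℤ? (f ⟨ n ⟩)) (upTo (suc Y)) (λ _ → proj₁) (λ _ → _, tt)
            c≤ : primeValueCount f Y ℕ.≤ N ℕ.+ πf x
            c≤ = subst (ℕ._≤ N ℕ.+ πf x) all≡ F.count≥
            Δ≤ : e' ℕ.* ℤ.∣ + k ℤ.* + inertCount Y ℤ.- + (b ℕ.* primeValueCount f Y) ∣ ℕ.≤ b ℕ.* primeValueCount f Y
            Δ≤ = subst (λ z → e' ℕ.* ℤ.∣ + k ℤ.* z ℤ.- + (b ℕ.* primeValueCount f Y) ∣ ℕ.≤ b ℕ.* primeValueCount f Y)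
              (sym (inertCount-∑ Y)) (∑-deviation (λ a → primeValueCountIn f M a Y) e' k (primeValueCount f Y) inertClasses
                (λ a∈ → ℕP.<⇒≤ (proj₂ equi-threshold Y Xe≤Y a∈)))

      converges : RatioConverges
      converges = ratio-criterion k b πi πf k>0 eventually

    increasing-case : EventuallyIncreasing (f ⟨_⟩) → RatioConverges
    increasing-case inc = beyond (increasing-unbounded inc (+ suc M))
      where
      beyond : (∃ λ N → (∀ n → N ℕ.≤ n → + suc M ℤ.≤ f ⟨ n ⟩) × (∀ n → N ℕ.≤ n → f ⟨ n ⟩ ℤ.< f ⟨ suc n ⟩)) →
        RatioConverges
      beyond (N , large , inc') = IncreasingBeyond.converges N large inc'

    -- f is then a fixed prime p. If p divides D, no class is good and p is not inert, so both τ and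
    -- the numerators are 0. Otherwise every class is good and either all or none are inert, so the
    -- ratio equals τ as soon as x ≥ p.
    constant-case : ∀ c → (∀ n → f ⟨ n ⟩ ≡ c) → RatioConverges
    constant-case c f≡c = by-divisibility (p ℕD.∣? M)
      where
      n₀ = proj₁ (inf 0)
      p = ℤ.∣ c ∣
      c-prime : IsPrimeℤ c
      c-prime = subst IsPrimeℤ (f≡c n₀) (proj₂ (proj₂ (inf 0)))
      c≡p : c ≡ + p
      c≡p = proj₁ (primeℤ-abs c-prime)
      p-prime : Prime p
      p-prime = proj₂ (primeℤ-abs c-prime)
      p-of-form : PrimeOfForm f p
      p-of-form = p-prime , 0 , trans (f≡c 0) c≡p
      only-p : ∀ {q} → PrimeOfForm f q → q ≡ p
      only-p (_ , n , e) = ℤP.+-injective (trans (sym e) (trans (f≡c n) c≡p))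
      πf≡1 : ∀ x → p ℕ.≤ x → πf x ≡ 1
      πf≡1 x x≥ = ℕP.≤-antisym (hasCount-≤ {l = p ∷ []} (πf-count x) (λ q (_ , pf) → here (only-p pf)))
        (hasCount-≥ {l = p ∷ []} (πf-count x) ([] ∷ []) λ { (here refl) → x≥ , p-of-form })
      πi≡1 : Inert D p → ∀ x → p ℕ.≤ x → πi x ≡ 1
      πi≡1 inert x x≥ = ℕP.≤-antisym (hasCount-≤ {l = p ∷ []} (πi-count x) (λ q (_ , pf , _) → here (only-p pf)))
        (hasCount-≥ {l = p ∷ []} (πi-count x) ([] ∷ []) λ { (here refl) → x≥ , p-of-form , inert })
      πi≡0 : ¬ Inert D p → ∀ x → πi x ≡ 0
      πi≡0 ¬inert x = ℕP.n≤0⇒n≡0 (hasCount-≤ {l = []} (πi-count x)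
        λ q (_ , pf , inert) → contradiction (subst (Inert D) (only-p pf) inert) ¬inert)
      χ≡ : ∀ a → χD (f ⟨ a ⟩) ≡ χD (+ p)
      χ≡ a = cong χD (trans (f≡c a) c≡p)
      by-divisibility : Dec (p ℕD.∣ M) → RatioConverges
      by-divisibility (yes d) = λ ε ε>0 → p , λ x x≥ → subst₂ ℚ._<_ (sym (lhs x)) (sym (rhs ε x x≥)) ε>0
        where
        k≡0 : k ≡ 0
        k≡0 = cong length (filter-none (goodClass? f D) {xs = upTo M} (All.tabulate λ {a} _ good →
          gcd-prime-∣≢1 p-prime d (subst (λ z → ℕG.gcd ℤ.∣ z ∣ M ≡ 1) (f≡c a) (ℤP.+-injective good))))
        τ≡0 : τ ≡ 0ℚ
        τ≡0 = cong ((+ b) /ᵗ_) k≡0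
        lhs : ∀ x → ℚ.∣ ℕ→ℚ (πi x) ℚ.- τ ℚ.* ℕ→ℚ (πf x) ∣ ≡ 0ℚ
        lhs x = cong ℚ.∣_∣ (cong₂ ℚ._-_ (cong ℕ→ℚ (πi≡0 (λ (p∤D , _) → p∤D d) x))
          (trans (cong (ℚ._* ℕ→ℚ (πf x)) τ≡0) (ℚP.*-zeroˡ (ℕ→ℚ (πf x)))))
        rhs : ∀ ε x → p ℕ.≤ x → ε ℚ.* ℕ→ℚ (πf x) ≡ ε
        rhs ε x x≥ = trans (cong (λ m → ε ℚ.* ℕ→ℚ m) (πf≡1 x x≥)) (ℚP.*-identityʳ ε)
      by-divisibility (no p∤D) = ratio-criterion k b πi πf k>0 λ e _ → p , λ x x≥ →
          subst₂ ℕ._<_ (sym (trans (cong (e ℕ.*_) (dev≡0 x x≥)) (ℕP.*-zeroʳ e)))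
            (sym (trans (cong (k ℕ.*_) (πf≡1 x x≥)) (ℕP.*-identityʳ k))) k>0
        where
        χp-sign : IsSign (χD (+ p))
        χp-sign = χ-prime p-prime p∤D
        k>0 : 0 ℕ.< k
        k>0 = k-positive 0 (sign≢0 (subst IsSign (sym (χ≡ 0)) χp-sign))
        all-good : k ≡ length (upTo M)
        all-good = cong length (filter-all (goodClass? f D) {xs = upTo M} (All.tabulate λ {a} _ →
          χ≢0⇒good a (sign≢0 (subst IsSign (sym (χ≡ a)) χp-sign))))
        dev≡0 : ∀ x → p ℕ.≤ x → deviation k b (πi x) (πf x) ≡ 0
        dev≡0 x x≥ = by-sign (χD (+ p) ℤ.≟ -[1+ 0 ])
          where
          open ≡-Reasoning
          all-inert : χD (+ p) ≡ -[1+ 0 ] → b ≡ length (upTo M)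
          all-inert e = cong length (filter-all inertClass? {xs = upTo M} (All.tabulate λ {a} _ → trans (χ≡ a) e))
          by-sign : Dec (χD (+ p) ≡ -[1+ 0 ]) → deviation k b (πi x) (πf x) ≡ 0
          by-sign (yes e) = cong ℤ.∣_∣ (ℤP.i≡j⇒i-j≡0 (cong +_ (begin
                πi x ℕ.* k     ≡⟨ cong (ℕ._* k) (πi≡1 (Equivalence.from (inert⇔χ p-prime p∤D) e) x x≥) ⟩
                1 ℕ.* k        ≡⟨ ℕP.*-identityˡ k ⟩
                k              ≡⟨ trans all-good (sym (all-inert e)) ⟩
                b              ≡⟨ sym (ℕP.*-identityʳ b) ⟩
                b ℕ.* 1        ≡⟨ cong (b ℕ.*_) (sym (πf≡1 x x≥)) ⟩
                b ℕ.* πf x     ∎)))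
          by-sign (no ne) = cong₂ (λ m b' → ℤ.∣ + (m ℕ.* k) ℤ.- + (b' ℕ.* πf x) ∣)
                (πi≡0 (ne ∘ Equivalence.to (inert⇔χ p-prime p∤D)) x)
                (cong length (filter-none inertClass? {xs = upTo M} (All.tabulate λ {a} _ e → ne (trans (sym (χ≡ a)) e))))

    ratio-converges : RatioConverges
    ratio-converges = from-behaviour (behaviour f)
      where
      from-behaviour : Behaviour (f ⟨_⟩) → RatioConverges
      from-behaviour (constant c f≡c) = constant-case c f≡c
      from-behaviour (increasing inc) = increasing-case inc
      from-behaviour (decreasing dec) = ⊥-elim (decreasing-impossible f inf dec)

theorem1 : (f : Poly) (D : ℤ) →
    FundamentalDiscriminant D →
    InfinitelyManyPrimeValues f →
    Equidistributed f D →
    (πf : ℕ → ℕ) → (∀ x → HasCount (λ p → p ℕ.≤ x × PrimeOfForm f p) (πf x)) →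
    (πi : ℕ → ℕ) → (∀ x → HasCount (λ p → p ℕ.≤ x × PrimeOfForm f p × Inert D p) (πi x)) →
    Σ ℚ λ τ →
    RatioTendsTo (λ x → ℕ→ℚ (πi x)) (λ x → ℕ→ℚ (πf x)) τ ×
    (∀ (D₁ : ℕ) → LargestOddDivisor D₁ ℤ.∣ D ∣ → 1 ℕ.< D₁ →
    (∀ p → p ∈ primeDivisors D₁ → Nₚ f p ℕ.< p) →
    (D %ℕ 2 ≡ 0 → 0 ℕ.< countRes f 2 1) →
    ℕ→ℚ 2 ℚ.* τ ≡ twoTauFormula f D D₁)
theorem1 f D fund inf equi πf πf-count πi πi-count =
  Formula.τ f disc , ratio-converges inf equi , λ D₁ largest _ → closed-form D₁ (largestOdd-≡n D₁ largest)
  where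
  disc : Disc D
  disc = classify fund
  open Limit f disc πf πf-count πi πi-count
  open ClosedForm f disc
  -- The equation is an argument so that matching it replaces `D₁` in the hypotheses and the formula
  -- at once.
  closed-form : ∀ D₁ → D₁ ≡ Disc.n disc → (∀ p → p ∈ primeDivisors D₁ → Nₚ f p ℕ.< p) →
    (D %ℕ 2 ≡ 0 → 0 ℕ.< countRes f 2 1) → ℕ→ℚ 2 ℚ.* Formula.τ f disc ≡ twoTauFormula f D D₁
  closed-form _ refl = formula
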